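{- Let $\mathcal T$ be the set of all Pólya trees and $\operatorname{MSET}^{(\ge2)}(\mathcal T)$ the set of finite multisets (rooted forests) of Pólya trees in which each tree that appears, appears at least twice. Then for every $n\ge0$, $$d_n=\sum_{\substack{F\in\operatorname{MSET}^{(\ge2)}(\mathcal T)\\ |F|=n}}\frac{|\{\sigma\in\mathrm{Aut}(F):\sigma_1=0\}|}{|\mathrm{Aut}(F)|}.$$ Furthermore, for every $n\ge1$, $$t_{c,n}(u)=\sum_{T\in\mathcal T,\ |T|=n}t_T(u),\qquad\text{where } t_T(u)=\frac{1}{|\mathrm{Aut}(T)|}\sum_{\sigma\in\mathrm{Aut}(T)}u^{\sigma_1}.$$ In particular, for every $T\in\mathcal T$, $t_T'(1)=|\mathcal P(T)|$, where $\mathcal P(T)$ is the set of (isomorphism classes of) trees obtained from $T$ by pointing (coloring) exactly one vertex.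
   Context: A Pólya tree is a rooted unlabeled tree; its size $|T|$ is its number of vertices; $T(z)=\sum_{n\ge1}t_nz^n$ with $t_n$ the number of Pólya trees of size $n$, satisfying $T(z)=z\exp\bigl(\sum_{i\ge1}T(z^i)/i\bigr)$. Define $d_n=[z^n]D(z)$ where $D(z)=\exp\bigl(\sum_{i\ge2}T(z^i)/i\bigr)$. Define the bivariate series $T_c(z,u)=\sum_{n\ge0}t_{c,n}(u)z^n$ as the unique power series solution of $T_c(z,u)=zu\exp(T_c(z,u))D(z)$; $t_{c,n}(u)$ is a polynomial in $u$. For a rooted tree or rooted forest $X$, $\mathrm{Aut}(X)$ denotes its automorphism group (bijections of the vertex set preserving adjacency and mapping roots to roots), and for $\sigma\in\mathrm{Aut}(X)$, $\sigma_1$ denotes the number of vertices fixed by $\sigma$; the size $|F|$ of a forest is its total number of vertices. -}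

module Defs where

open import Data.Nat as ℕ using (ℕ; zero; suc; _∸_; _≤_; _≤?_; _!)
open import Data.Integer using (+_)
open import Data.Rational as ℚ using (ℚ; 0ℚ; 1ℚ)
open import Data.Fin using (Fin) renaming (zero to fzero; suc to fsuc)
open import Data.Fin.Properties using (all?; any?) renaming (_≟_ to _≟ᶠ_)
open import Data.Maybe using (Maybe; just; nothing)
open import Data.List using (List; []; _∷_; length; map; filter; concatMap; allFin; foldr; lookup)
open import Data.List.Relation.Unary.All using (All)
open import Data.Product using (Σ; ∃; _×_; _,_)
open import Data.Sum using (_⊎_)
open import Data.Bool using (if_then_else_)
open import Relation.Nullary using (Dec; ¬_; does)
open import Relation.Nullary.Decidable using (_×-dec_; _→-dec_; _⊎-dec_)
open import Relation.Binary.PropositionalEquality using (_≡_; _≢_)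
import Data.Maybe.Properties as MP

-- a / b in ℚ, with the convention a / 0 = 0 (only ever used with b ≥ 1)
frac : ℕ → ℕ → ℚ
frac a zero    = 0ℚ
frac a (suc b) = (+ a) ℚ./ suc b

sumQ : List ℚ → ℚ
sumQ = foldr ℚ._+_ 0ℚ

Σ< : ℕ → (ℕ → ℚ) → ℚ
Σ< zero    f = 0ℚ
Σ< (suc m) f = Σ< m f ℚ.+ f m

-- Formal power series over ℚ: univariate (coefficient of z^n) and
-- bivariate (coefficient of z^n u^m).

PS : Set
PS = ℕ → ℚ

BS : Set
BS = ℕ → ℕ → ℚ

bone : BS
bone zero    zero    = 1ℚ
bone zero    (suc m) = 0ℚ
bone (suc n) m       = 0ℚ

bmul : BS → BS → BS
bmul A B n m = Σ< (suc n) λ i → Σ< (suc m) λ j → A i j ℚ.* B (n ∸ i) (m ∸ j)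

bpow : BS → ℕ → BS
bpow A zero    = bone
bpow A (suc k) = bmul A (bpow A k)

-- exp(A) = Σ_k A^k / k! for A with zero constant term in z; the
-- coefficient of z^n only receives contributions from k ≤ n.
bexp : BS → BS
bexp A n m = Σ< (suc n) λ k → frac 1 (k !) ℚ.* bpow A k n m

one : PS
one zero    = 1ℚ
one (suc n) = 0ℚ

mul : PS → PS → PS
mul A B n = Σ< (suc n) λ i → A i ℚ.* B (n ∸ i)

pow : PS → ℕ → PS
pow A zero    = one
pow A (suc k) = mul A (pow A k)

expS : PS → PS
expS A n = Σ< (suc n) λ k → frac 1 (k !) ℚ.* pow A k n

-- [z^n] Σ_{i≥2} T(z^i)/i  =  Σ_{i ≥ 2, k, i k = n} t_k / i
sumTzi≥2 : PS → PS
sumTzi≥2 t n = Σ< (suc n) λ i → Σ< (suc n) λ k →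
  if does ((2 ≤? i) ×-dec (i ℕ.* k ℕ.≟ n)) then frac 1 i ℚ.* t k else 0ℚ

Dser : PS → PS
Dser t = expS (sumTzi≥2 t)

shiftZU : BS → BS
shiftZU X zero    m       = 0ℚ
shiftZU X (suc n) zero    = 0ℚ
shiftZU X (suc n) (suc m) = X n m

liftU : PS → BS
liftU A n zero    = A n
liftU A n (suc m) = 0ℚ

SolvesTc : PS → BS → Set
SolvesTc t tc = ∀ n m → tc n m ≡ shiftZU (bmul (bexp tc) (liftU (Dser t))) n m

-- Rooted forests on the vertex set Fin n, given by a parent map
-- (roots are the vertices without parent).

Parent : ℕ → Set
Parent n = Fin n → Maybe (Fin n)

up : ∀ {n} → Parent n → Maybe (Fin n) → Maybe (Fin n)
up p nothing  = nothing
up p (just v) = p v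

iter : ∀ {n} → Parent n → ℕ → Maybe (Fin n) → Maybe (Fin n)
iter p zero    x = x
iter p (suc k) x = iter p k (up p x)

IsForest : ∀ {n} → Parent n → Set
IsForest {n} p = ∀ v → iter p n (just v) ≡ nothing

Root : ∀ {n} → Parent n → Fin n → Set
Root p v = p v ≡ nothing

Adj : ∀ {n} → Parent n → Fin n → Fin n → Set
Adj p u v = (p u ≡ just v) ⊎ (p v ≡ just u)

IsTree : ∀ {n} → Parent n → Set
IsTree p = IsForest p × ∃ λ r → Root p r × (∀ v → Root p v → v ≡ r)

Iff : Set → Set → Set
Iff A B = (A → B) × (B → A)

IsBijection : ∀ {n} → (Fin n → Fin n) → Set
IsBijection σ = (∀ i j → σ i ≡ σ j → i ≡ j) × (∀ w → ∃ λ v → σ v ≡ w)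

IsIso : ∀ {n} → Parent n → Parent n → (Fin n → Fin n) → Set
IsIso p q σ = IsBijection σ
  × (∀ u v → Iff (Adj p u v) (Adj q (σ u) (σ v)))
  × (∀ v → Iff (Root p v) (Root q (σ v)))

Isomorphic : ∀ {n} → Parent n → Parent n → Set
Isomorphic {n} p q = Σ (Fin n → Fin n) (IsIso p q)

IsAut : ∀ {n} → Parent n → (Fin n → Fin n) → Set
IsAut p σ = IsIso p p σ

private
  maybe? : ∀ {n} (x y : Maybe (Fin n)) → Dec (x ≡ y)
  maybe? = MP.≡-dec _≟ᶠ_

  iff? : ∀ {A B : Set} → Dec A → Dec B → Dec (Iff A B)
  iff? a b = (a →-dec b) ×-dec (b →-dec a)

  adj? : ∀ {n} (p : Parent n) u v → Dec (Adj p u v)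
  adj? p u v = maybe? (p u) (just v) ⊎-dec maybe? (p v) (just u)

isIso? : ∀ {n} (p q : Parent n) (σ : Fin n → Fin n) → Dec (IsIso p q σ)
isIso? p q σ =
  ((all? λ i → all? λ j → (σ i ≟ᶠ σ j) →-dec (i ≟ᶠ j))
     ×-dec (all? λ w → any? λ v → σ v ≟ᶠ w))
  ×-dec (all? λ u → all? λ v → iff? (adj? p u v) (adj? q (σ u) (σ v)))
  ×-dec (all? λ v → iff? (maybe? (p v) nothing) (maybe? (q (σ v)) nothing))

maps : (n k : ℕ) → List (Fin k → Fin n)
maps n zero    = (λ ()) ∷ []
maps n (suc k) = concatMap (λ i → map (cons i) (maps n k)) (allFin n)
  where
  cons : Fin n → (Fin k → Fin n) → Fin (suc k) → Fin n
  cons i f fzero    = i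
  cons i f (fsuc j) = f j

autList : ∀ {n} → Parent n → List (Fin n → Fin n)
autList {n} p = filter (isIso? p p) (maps n n)

fixCount : ∀ {n} → (Fin n → Fin n) → ℕ
fixCount {n} σ = length (filter (λ v → σ v ≟ᶠ v) (allFin n))

fpfWeight : ∀ {n} → Parent n → ℚ
fpfWeight p = frac (length (filter (λ σ → fixCount σ ℕ.≟ 0) (autList p)))
                   (length (autList p))

-- [u^m] t_T(u) = |{σ ∈ Aut(T) : σ₁ = m}| / |Aut(T)|
autWeight : ∀ {n} → Parent n → ℕ → ℚ
autWeight p m = frac (length (filter (λ σ → fixCount σ ℕ.≟ m) (autList p)))
                     (length (autList p))

-- t_T'(1) = (1/|Aut(T)|) Σ_{σ ∈ Aut(T)} σ₁
derivWeight : ∀ {n} → Parent n → ℚ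
derivWeight p = frac (foldr ℕ._+_ 0 (map fixCount (autList p))) (length (autList p))

Desc : ∀ {n} → Parent n → Fin n → Fin n → Set
Desc p r v = ∃ λ k → iter p k (just v) ≡ just r

CompIso : ∀ {n} → Parent n → Fin n → Fin n → Set
CompIso {n} p r r' = Σ (Fin n → Fin n) λ σ →
    σ r ≡ r'
  × (∀ v → Desc p r v → Desc p r' (σ v))
  × (∀ u v → Desc p r u → Desc p r v → σ u ≡ σ v → u ≡ v)
  × (∀ w → Desc p r' w → ∃ λ v → Desc p r v × σ v ≡ w)
  × (∀ u v → Desc p r u → Desc p r v → Iff (Adj p u v) (Adj p (σ u) (σ v)))

IsMset2 : ∀ {n} → Parent n → Set
IsMset2 p = IsForest p ×
  (∀ r → Root p r → ∃ λ r' → Root p r' × r' ≢ r × CompIso p r r')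

RepSystem : ∀ {n} → (Parent n → Set) → List (Parent n) → Set
RepSystem P L = All P L ×
  (∀ F → P F → Σ (Fin (length L)) λ i →
     Isomorphic F (lookup L i) × (∀ j → Isomorphic F (lookup L j) → j ≡ i))

PointIso : ∀ {n} → Parent n → Fin n → Fin n → Set
PointIso {n} p v w = Σ (Fin n → Fin n) λ σ → IsAut p σ × σ v ≡ w

PointRep : ∀ {n} → Parent n → List (Fin n) → Set
PointRep p P = ∀ w → Σ (Fin (length P)) λ i →
  PointIso p w (lookup P i) × (∀ j → PointIso p w (lookup P j) → j ≡ i)

-- t_k = number of Pólya trees of size k, from representative lists
countSeq : ((k : ℕ) → List (Parent k)) → PS
countSeq R k = (+ length (R k)) ℚ./ 1

{-# OPTIONS --safe #-}
-- Up to isomorphism a forest F is a plane forest, and w(F)/|Aut F| plane forests are isomorphic to F,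
-- where w(F) is the product of the factorials of all numbers of children (a virtual root included).
-- So a sum over isomorphism classes of f(F)/|Aut F| is the sum of f(F)/w(F) over plane forests. Let
-- Φ(z,u) be the sum of z^|F| u^σ₁ / w(F) over plane forests F and σ ∈ Aut F, and let A = z u Φ, which
-- is the same series for trees.
--
-- A fixed vertex lies in a tree of F that σ maps to itself, and the rest of σ is an automorphism of
-- the other trees; so u ∂Φ/∂u = (u ∂A/∂u) Φ. The series exp(A) D satisfies the same equation, whence
-- it suffices to compare both at u = 1. There Φ counts isomorphism classes of forests, and
-- z ∂/∂z log Φ(z,1) = z ∂/∂z Σ_{i≥1} T(z^i)/i by counting vertices, so Φ(z,1) = exp(T) D. Hence
-- Φ = exp(A) D, and A = T_c. At u = 0 this says Φ(z,0) = D, and forests outside MSET^{(≥2)} do not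
-- contribute to Φ(z,0). The last claim is Burnside's lemma.

module Submission where

open import Defs
open import Data.Nat as ℕ using (ℕ; zero; suc; _∸_; _≤_; _<_; z≤n; s≤s; _!)
import Data.Nat.Properties as ℕP
import Data.Integer as ℤ
import Data.Integer.Properties as ℤP
open import Data.Rational as ℚ using (ℚ; 0ℚ; 1ℚ; _+_; _*_; _/_; toℚᵘ)
import Data.Rational.Properties as ℚP
import Data.Rational.Unnormalised as ℚᵘ
import Data.Rational.Unnormalised.Properties as ℚᵘP
open import Data.Rational.Solver using (module +-*-Solver)
open import Data.Bool using (if_then_else_)
open import Data.Empty using (⊥; ⊥-elim)
open import Data.Fin as Fin using (Fin) renaming (zero to fzero; suc to fsuc)
import Data.Fin.Properties as FinP
open import Data.Maybe as Maybe using (Maybe; just; nothing; maybe′)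
import Data.Maybe.Properties as MaybeP
open import Data.List using (List; []; _∷_; _++_; length; map; filter; concatMap; allFin; foldr; lookup; cartesianProduct; downFrom)
open import Data.List.Relation.Unary.All as All using (All; []; _∷_)
import Data.List.Relation.Unary.All.Properties as AllP
open import Data.List.Relation.Unary.Any as Any using (Any; here; there)
import Data.List.Relation.Unary.Any.Properties as AnyP
open import Data.List.Relation.Unary.AllPairs as AllPairs using (AllPairs; []; _∷_)
import Data.List.Relation.Unary.AllPairs.Properties as AllPairsP
open import Data.List.Membership.Propositional using (_∈_)
import Data.List.Membership.Propositional.Properties as ∈P
import Data.List.Properties as ListP
open import Data.Product using (Σ; ∃; _×_; _,_; proj₁; proj₂; uncurry)
open import Data.Sum as Sum using (inj₁; inj₂)
open import Function using (_∘_; id)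
open import Relation.Nullary using (Dec; yes; no; ¬_; does; contradiction)
open import Relation.Nullary.Decidable using (map′; _×-dec_; _→-dec_; dec-true; dec-false)
open import Relation.Binary.PropositionalEquality using (_≡_; _≢_; _≗_; refl; sym; trans; cong; cong₂; subst; module ≡-Reasoning)
open import Relation.Binary using (IsEquivalence; Setoid; tri<; tri≈; tri>)
import Relation.Binary.Reasoning.Setoid as SetoidReasoning

-- Isomorphism classes carry no induction, plane forests do. The weight 1/`w F` fits their
-- recursion: if removing a tree with root forest a from F leaves s, then `w F` = (`len s` + 1)
-- `w a` `w s`, and `len s` + 1 is the number of places where the tree can be put back. So marking
-- one tree in each forest turns a sum over forests into a product of series. This is why
-- differential equations take the place of the cycle index: a marked vertex singles out one tree,
-- whereas expanding exp(Σ T(z^i)/i) directly would require the cycle type of σ on the trees. The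
-- operator u ∂/∂u annihilates u^0, so its equation leaves those coefficients open; the comparison
-- at u = 1 settles them, and it is there that D is identified. At u = 1 the Euler transform comes
-- from |Aut(a ◃ s)| = |Aut a| |Aut s| (1 + m), where m is the multiplicity of the first tree in s.
-- Hence the series M of forests weighted by the multiplicity of a fixed tree of size k satisfies M
-- = z^k (Φ(z,1) + M), and iteration gives M = (z^k + z^2k + ...) Φ(z,1), the source of the terms
-- T(z^i).

-- By the convention of frac, inv 0 = 0.

opaque
  c : ℕ → ℚ
  c n = (ℤ.+ n) / 1

  inv : ℕ → ℚ
  inv n = frac 1 n

opaque
  unfolding c inv

  private
    c≃ : ∀ n → toℚᵘ (c n) ℚᵘ.≃ ℚᵘ.mkℚᵘ (ℤ.+ n) 0
    c≃ n = ℚP.toℚᵘ-fromℚᵘ (ℚᵘ.mkℚᵘ (ℤ.+ n) 0)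

    frac≃ : ∀ a b → toℚᵘ (frac a (suc b)) ℚᵘ.≃ ℚᵘ.mkℚᵘ (ℤ.+ a) b
    frac≃ a b = ℚP.toℚᵘ-fromℚᵘ (ℚᵘ.mkℚᵘ (ℤ.+ a) b)

  c-def : ∀ n → (ℤ.+ n) / 1 ≡ c n
  c-def n = refl

  inv-def : ∀ n → frac 1 n ≡ inv n
  inv-def n = refl

  c-0 : c 0 ≡ 0ℚ
  c-0 = refl

  c-1 : c 1 ≡ 1ℚ
  c-1 = refl

  inv-1 : inv 1 ≡ 1ℚ
  inv-1 = refl

  c-+ : ∀ m n → c (m ℕ.+ n) ≡ c m + c n
  c-+ m n = ℚP.toℚᵘ-injective (ℚᵘP.≃-trans (c≃ (m ℕ.+ n)) (ℚᵘP.≃-sym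
    (ℚᵘP.≃-trans (ℚP.toℚᵘ-homo-+ (c m) (c n))
      (ℚᵘP.≃-trans (ℚᵘP.+-cong (c≃ m) (c≃ n)) (ℚᵘ.*≡* eq)))))
    where
    eq : ((ℤ.+ m) ℤ.* (ℤ.+ 1) ℤ.+ (ℤ.+ n) ℤ.* (ℤ.+ 1)) ℤ.* (ℤ.+ 1) ≡ (ℤ.+ (m ℕ.+ n)) ℤ.* (ℤ.+ 1)
    eq = cong (ℤ._* (ℤ.+ 1)) (trans (cong₂ ℤ._+_ (ℤP.*-identityʳ (ℤ.+ m)) (ℤP.*-identityʳ (ℤ.+ n)))
                                  (sym (ℤP.pos-+ m n)))

  c-* : ∀ m n → c (m ℕ.* n) ≡ c m * c n
  c-* m n = ℚP.toℚᵘ-injective (ℚᵘP.≃-trans (c≃ (m ℕ.* n)) (ℚᵘP.≃-sym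
    (ℚᵘP.≃-trans (ℚP.toℚᵘ-homo-* (c m) (c n))
      (ℚᵘP.≃-trans (ℚᵘP.*-cong (c≃ m) (c≃ n))
        (ℚᵘ.*≡* (cong (ℤ._* (ℤ.+ 1)) (sym (ℤP.pos-* m n))))))))

  c-injective : ∀ {m n} → c m ≡ c n → m ≡ n
  c-injective {m} {n} eq with ℚᵘP.≃-trans (ℚᵘP.≃-sym (c≃ m))
      (ℚᵘP.≃-trans (ℚP.toℚᵘ-cong eq) (c≃ n))
  ... | ℚᵘ.*≡* e = ℤP.+-injective (trans (sym (ℤP.*-identityʳ (ℤ.+ m)))
                                   (trans e (ℤP.*-identityʳ (ℤ.+ n))))

  frac-c : ∀ a b → frac a b ≡ c a * inv b
  frac-c a zero = sym (ℚP.*-zeroʳ (c a))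
  frac-c a (suc b) = ℚP.toℚᵘ-injective (ℚᵘP.≃-trans (frac≃ a b) (ℚᵘP.≃-sym
    (ℚᵘP.≃-trans (ℚP.toℚᵘ-homo-* (c a) (frac 1 (suc b)))
      (ℚᵘP.≃-trans (ℚᵘP.*-cong (c≃ a) (frac≃ 1 b))
        (ℚᵘ.*≡* (cong₂ ℤ._*_ (ℤP.*-identityʳ (ℤ.+ a)) (cong (λ x → ℤ.+ suc x) (sym (ℕP.+-identityʳ b)))))))))

  c-inv-suc : ∀ n → c (suc n) * inv (suc n) ≡ 1ℚ
  c-inv-suc n = trans (sym (frac-c (suc n) (suc n))) (ℚP.toℚᵘ-injective (ℚᵘP.≃-trans (frac≃ (suc n) n)
    (ℚᵘ.*≡* (ℤP.*-comm (ℤ.+ suc n) (ℤ.+ 1)))))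

c-suc : ∀ n → c (suc n) ≡ 1ℚ + c n
c-suc n = trans (c-+ 1 n) (cong (_+ c n) c-1)

c-inv : ∀ {n} → n ≢ 0 → c n * inv n ≡ 1ℚ
c-inv {zero}  n≢0 = contradiction refl n≢0
c-inv {suc n} _   = c-inv-suc n

inv-c-cancel : ∀ {n} x → n ≢ 0 → inv n * (c n * x) ≡ x
inv-c-cancel {n} x n≢0 = trans (sym (ℚP.*-assoc (inv n) (c n) x))
  (trans (cong (_* x) (trans (ℚP.*-comm (inv n) (c n)) (c-inv n≢0))) (ℚP.*-identityˡ x))

c-cancel : ∀ {n x y} → n ≢ 0 → c n * x ≡ c n * y → x ≡ y
c-cancel {n} {x} {y} n≢0 eq = trans (sym (inv-c-cancel x n≢0))
  (trans (cong (inv n *_) eq) (inv-c-cancel y n≢0))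

inv-unique : ∀ {n x} → n ≢ 0 → c n * x ≡ 1ℚ → x ≡ inv n
inv-unique n≢0 eq = c-cancel n≢0 (trans eq (sym (c-inv n≢0)))

m*n≢0 : ∀ {m n} → m ≢ 0 → n ≢ 0 → m ℕ.* n ≢ 0
m*n≢0 {m} m≢0 n≢0 eq with ℕP.m*n≡0⇒m≡0∨n≡0 m eq
... | inj₁ e = m≢0 e
... | inj₂ e = n≢0 e

inv-* : ∀ {m n} → m ≢ 0 → n ≢ 0 → inv (m ℕ.* n) ≡ inv m * inv n
inv-* {m} {n} m≢0 n≢0 = sym (inv-unique (m*n≢0 m≢0 n≢0) (begin
  c (m ℕ.* n) * (inv m * inv n)     ≡⟨ cong (_* (inv m * inv n)) (c-* m n) ⟩
  c m * c n * (inv m * inv n)       ≡⟨ solve 4 (λ a b x y → a :* b :* (x :* y) := (a :* x) :* (b :* y)) refl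
                                         (c m) (c n) (inv m) (inv n) ⟩
  (c m * inv m) * (c n * inv n)     ≡⟨ cong₂ _*_ (c-inv m≢0) (c-inv n≢0) ⟩
  1ℚ * 1ℚ                           ≡⟨ ℚP.*-identityˡ 1ℚ ⟩
  1ℚ                                ∎))
  where
  open ≡-Reasoning
  open +-*-Solver

-- Finite sums over lists

variable
  S T : Set

ind : {P : Set} → Dec P → ℚ
ind P? = if does P? then 1ℚ else 0ℚ

ind-yes : {P : Set} (P? : Dec P) → P → ind P? ≡ 1ℚ
ind-yes P? p rewrite dec-true P? p = refl

ind-no : {P : Set} (P? : Dec P) → ¬ P → ind P? ≡ 0ℚ
ind-no P? ¬p rewrite dec-false P? ¬p = refl

ind-iff : {P Q : Set} (P? : Dec P) (Q? : Dec Q) → (P → Q) → (Q → P) → ind P? ≡ ind Q?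
ind-iff P? (yes q) f g = ind-yes P? (g q)
ind-iff P? (no ¬q) f g = ind-no P? (¬q ∘ f)

ind-cong : {P : Set} (P? : Dec P) {x y : ℚ} → (P → x ≡ y) → ind P? * x ≡ ind P? * y
ind-cong (yes p) eq = cong (1ℚ *_) (eq p)
ind-cong (no _) {x} {y} eq = trans (ℚP.*-zeroˡ x) (sym (ℚP.*-zeroˡ y))

if-ind : {P : Set} (P? : Dec P) (x : ℚ) → (if does P? then x else 0ℚ) ≡ ind P? * x
if-ind (yes _) x = sym (ℚP.*-identityˡ x)
if-ind (no _)  x = sym (ℚP.*-zeroˡ x)

∑ : List S → (S → ℚ) → ℚ
∑ []       f = 0ℚ
∑ (x ∷ xs) f = f x + ∑ xs f

∑-All : {xs : List S} {f g : S → ℚ} → All (λ x → f x ≡ g x) xs → ∑ xs f ≡ ∑ xs g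
∑-All []         = refl
∑-All (eq ∷ eqs) = cong₂ _+_ eq (∑-All eqs)

∑-cong : (xs : List S) {f g : S → ℚ} → f ≗ g → ∑ xs f ≡ ∑ xs g
∑-cong xs eq = ∑-All (All.universal eq xs)

∑-zero : (xs : List S) {f : S → ℚ} → (∀ x → f x ≡ 0ℚ) → ∑ xs f ≡ 0ℚ
∑-zero []       eq = refl
∑-zero (x ∷ xs) eq = trans (cong₂ _+_ (eq x) (∑-zero xs eq)) refl

∑-+ : (xs : List S) (f g : S → ℚ) → ∑ xs (λ x → f x + g x) ≡ ∑ xs f + ∑ xs g
∑-+ []       f g = refl
∑-+ (x ∷ xs) f g = trans (cong (f x + g x +_) (∑-+ xs f g))
  (solve 4 (λ a b s t → a :+ b :+ (s :+ t) := a :+ s :+ (b :+ t)) refl (f x) (g x) (∑ xs f) (∑ xs g))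
  where open +-*-Solver

∑-*ˡ : (xs : List S) (k : ℚ) (f : S → ℚ) → ∑ xs (λ x → k * f x) ≡ k * ∑ xs f
∑-*ˡ []       k f = sym (ℚP.*-zeroʳ k)
∑-*ˡ (x ∷ xs) k f = trans (cong (k * f x +_) (∑-*ˡ xs k f)) (sym (ℚP.*-distribˡ-+ k (f x) (∑ xs f)))

∑-*ʳ : (xs : List S) (k : ℚ) (f : S → ℚ) → ∑ xs (λ x → f x * k) ≡ ∑ xs f * k
∑-*ʳ xs k f = trans (∑-cong xs λ x → ℚP.*-comm (f x) k)
  (trans (∑-*ˡ xs k f) (ℚP.*-comm k (∑ xs f)))

∑-swap : (xs : List S) (ys : List T) (f : S → T → ℚ) →
         ∑ xs (λ x → ∑ ys (f x)) ≡ ∑ ys (λ y → ∑ xs λ x → f x y)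
∑-swap []       ys f = sym (∑-zero ys λ _ → refl)
∑-swap (x ∷ xs) ys f = trans (cong (∑ ys (f x) +_) (∑-swap xs ys f))
  (sym (∑-+ ys (f x) λ y → ∑ xs λ x → f x y))

∑-* : (xs : List S) (ys : List T) (f : S → ℚ) (g : T → ℚ) →
      ∑ xs (λ x → ∑ ys λ y → f x * g y) ≡ ∑ xs f * ∑ ys g
∑-* xs ys f g = trans (∑-cong xs λ x → ∑-*ˡ ys (f x) g) (∑-*ʳ xs (∑ ys g) f)

∑-++ : (xs ys : List S) (f : S → ℚ) → ∑ (xs ++ ys) f ≡ ∑ xs f + ∑ ys f
∑-++ []       ys f = sym (ℚP.+-identityˡ (∑ ys f))
∑-++ (x ∷ xs) ys f = trans (cong (f x +_) (∑-++ xs ys f)) (sym (ℚP.+-assoc (f x) (∑ xs f) (∑ ys f)))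

∑-map : (h : S → T) (xs : List S) (f : T → ℚ) → ∑ (map h xs) f ≡ ∑ xs (f ∘ h)
∑-map h []       f = refl
∑-map h (x ∷ xs) f = cong (f (h x) +_) (∑-map h xs f)

∑-cartesian : (xs : List S) (ys : List T) (f : S × T → ℚ) →
              ∑ (cartesianProduct xs ys) f ≡ ∑ xs (λ x → ∑ ys λ y → f (x , y))
∑-cartesian []       ys f = refl
∑-cartesian (x ∷ xs) ys f = trans (∑-++ (map (x ,_) ys) (cartesianProduct xs ys) f)
  (cong₂ _+_ (∑-map (x ,_) ys f) (∑-cartesian xs ys f))

∑-filter : {P : S → Set} (P? : ∀ x → Dec (P x)) (xs : List S) (f : S → ℚ) →
           ∑ (filter P? xs) f ≡ ∑ xs (λ x → ind (P? x) * f x)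
∑-filter P? []       f = refl
∑-filter P? (x ∷ xs) f with P? x
... | yes p = cong₂ _+_ (sym (ℚP.*-identityˡ (f x))) (∑-filter P? xs f)
... | no ¬p = trans (∑-filter P? xs f) (trans (sym (ℚP.+-identityˡ _))
  (cong (_+ ∑ xs (λ x → ind (P? x) * f x)) (sym (ℚP.*-zeroˡ (f x)))))

c-length : (xs : List S) → c (length xs) ≡ ∑ xs (λ _ → 1ℚ)
c-length []       = c-0
c-length (x ∷ xs) = trans (c-suc (length xs)) (cong (1ℚ +_) (c-length xs))

c-count : {P : S → Set} (P? : ∀ x → Dec (P x)) (xs : List S) →
          c (length (filter P? xs)) ≡ ∑ xs (ind ∘ P?)
c-count P? xs = trans (c-length (filter P? xs)) (trans (∑-filter P? xs λ _ → 1ℚ)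
  (∑-cong xs λ x → ℚP.*-identityʳ (ind (P? x))))

c-sum : (f : S → ℕ) (xs : List S) → c (foldr ℕ._+_ 0 (map f xs)) ≡ ∑ xs (c ∘ f)
c-sum f []       = c-0
c-sum f (x ∷ xs) = trans (c-+ (f x) (foldr ℕ._+_ 0 (map f xs))) (cong (c (f x) +_) (c-sum f xs))

sumQ-map : (f : S → ℚ) (xs : List S) → sumQ (map f xs) ≡ ∑ xs f
sumQ-map f []       = refl
sumQ-map f (x ∷ xs) = cong (f x +_) (sumQ-map f xs)

private
  remove : {P : T → Set} {ys : List T} → Any P ys → List T
  remove {ys = y ∷ ys} (here _)  = ys
  remove {ys = y ∷ ys} (there i) = y ∷ remove i

  ∑-remove : {P : T → Set} {ys : List T} (i : Any P ys) (g : T → ℚ) →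
             ∑ ys g ≡ g (Any.lookup i) + ∑ (remove i) g
  ∑-remove {ys = y ∷ ys} (here _)  g = refl
  ∑-remove {ys = y ∷ ys} (there i) g = trans (cong (g y +_) (∑-remove i g))
    (solve 3 (λ a b s → a :+ (b :+ s) := b :+ (a :+ s)) refl (g y) (g (Any.lookup i)) (∑ (remove i) g))
    where open +-*-Solver

  Any-remove : {P Q : T → Set} {ys : List T} (i : Any P ys) →
               Any Q ys → ¬ Q (Any.lookup i) → Any Q (remove i)
  Any-remove (here _)  (here q)  ¬q = contradiction q ¬q
  Any-remove (here _)  (there j) ¬q = j
  Any-remove (there i) (here q)  ¬q = here q
  Any-remove (there i) (there j) ¬q = there (Any-remove i j ¬q)

  All-remove : {P Q : T → Set} {ys : List T} (i : Any P ys) → All Q ys → All Q (remove i)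
  All-remove (here _)  (_ ∷ qs) = qs
  All-remove (there i) (q ∷ qs) = q ∷ All-remove i qs

  All-lookup : {P Q : T → Set} {ys : List T} (i : Any P ys) → All Q ys → Q (Any.lookup i)
  All-lookup (here _)  (q ∷ _)  = q
  All-lookup (there i) (_ ∷ qs) = All-lookup i qs

  AllPairs-remove : {P : T → Set} {R : T → T → Set} {ys : List T} (i : Any P ys) →
                    AllPairs R ys → AllPairs R (remove i)
  AllPairs-remove (here _)  (_ ∷ rs) = rs
  AllPairs-remove (there i) (r ∷ rs) = All-remove i r ∷ AllPairs-remove i rs

  AllPairs-others : {P : T → Set} {R : T → T → Set} {ys : List T} → (∀ {x y} → R x y → R y x) →
                    (i : Any P ys) → AllPairs R ys → All (R (Any.lookup i)) (remove i)
  AllPairs-others R-sym (here _)  (r ∷ _)  = r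
  AllPairs-others R-sym (there i) (r ∷ rs) = R-sym (All-lookup i r) ∷ AllPairs-others R-sym i rs

-- R matches the entries of xs one-to-one with those of ys.
∑-match : (R : S → T → Set) (xs : List S) (ys : List T) {f : S → ℚ} {g : T → ℚ} →
          All (λ x → Any (R x) ys) xs → All (λ y → Any (λ x → R x y) xs) ys →
          AllPairs (λ x x′ → ∀ y → R x y → ¬ R x′ y) xs →
          AllPairs (λ y y′ → ∀ x → R x y → ¬ R x y′) ys →
          (∀ x y → R x y → f x ≡ g y) → ∑ xs f ≡ ∑ ys g
∑-match R [] []       _ _          _ _ _  = refl
∑-match R [] (y ∷ ys) _ (() ∷ _) _ _ _
∑-match {T = T} R (x ∷ xs) ys {f} {g} (i ∷ is) js (u ∷ us) vs eq = trans
  (cong₂ _+_ (eq x (Any.lookup i) Rxy)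
    (∑-match R xs (remove i)
      (All.zipWith (λ (a , ¬R) → Any-remove i a (¬R (Any.lookup i) Rxy)) (is , u))
      (All.zipWith (λ (j , ¬R) → drop-head j (¬R x Rxy))
        (All-remove i js , AllPairs-others flip-≢ i vs))
      us (AllPairs-remove i vs) eq))
  (sym (∑-remove i g))
  where
  Rxy : R x (Any.lookup i)
  Rxy = AnyP.lookup-result i
  flip-≢ : ∀ {y y′} → (∀ x → R x y → ¬ R x y′) → ∀ x → R x y′ → ¬ R x y
  flip-≢ h x r′ r = h x r r′
  drop-head : ∀ {y} → Any (λ x → R x y) (x ∷ xs) → ¬ R x y → Any (λ x → R x y) xs
  drop-head (here r)  ¬r = contradiction r ¬r
  drop-head (there j) _  = j

∑-single : (xs : List S) (f : S → ℚ) (i : Fin (length xs)) →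
           (∀ j → j ≢ i → f (lookup xs j) ≡ 0ℚ) → ∑ xs f ≡ f (lookup xs i)
∑-single (x ∷ xs) f fzero    z = trans (cong (f x +_) (rest xs λ j → z (fsuc j) λ ()))
  (ℚP.+-identityʳ (f x))
  where
  rest : ∀ ys → (∀ j → f (lookup ys j) ≡ 0ℚ) → ∑ ys f ≡ 0ℚ
  rest []       _ = refl
  rest (y ∷ ys) z = trans (cong₂ _+_ (z fzero) (rest ys (z ∘ fsuc))) refl
∑-single (x ∷ xs) f (fsuc i) z = trans (cong₂ _+_ (z fzero λ ())
  (∑-single xs f i λ j j≢i → z (fsuc j) (j≢i ∘ FinP.suc-injective))) (ℚP.+-identityˡ _)

+-cancelʳ : ∀ z x y → x + z ≡ y + z → x ≡ y
+-cancelʳ z x y eq = trans (undo x) (trans (cong (_+ ℚ.- z) eq) (sym (undo y)))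
  where
  undo : ∀ x → x ≡ x + z + ℚ.- z
  undo x = sym (trans (ℚP.+-assoc x z (ℚ.- z)) (trans (cong (x +_) (ℚP.+-inverseʳ z)) (ℚP.+-identityʳ x)))

-- Sums over initial segments of ℕ

Σ<-∑ : ∀ n f → Σ< n f ≡ ∑ (downFrom n) f
Σ<-∑ zero    f = refl
Σ<-∑ (suc n) f = trans (cong (_+ f n) (Σ<-∑ n f)) (ℚP.+-comm (∑ (downFrom n) f) (f n))

Σ<-cong : ∀ n {f g} → (∀ i → i < n → f i ≡ g i) → Σ< n f ≡ Σ< n g
Σ<-cong zero    eq = refl
Σ<-cong (suc n) eq = cong₂ _+_ (Σ<-cong n λ i i<n → eq i (ℕP.m<n⇒m<1+n i<n)) (eq n ℕP.≤-refl)

Σ<-ext : ∀ n {f g} → f ≗ g → Σ< n f ≡ Σ< n g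
Σ<-ext n eq = Σ<-cong n λ i _ → eq i

Σ<-zero : ∀ n {f} → (∀ i → i < n → f i ≡ 0ℚ) → Σ< n f ≡ 0ℚ
Σ<-zero zero    eq = refl
Σ<-zero (suc n) eq = trans (cong₂ _+_ (Σ<-zero n λ i i<n → eq i (ℕP.m<n⇒m<1+n i<n)) (eq n ℕP.≤-refl)) refl

Σ<-+ : ∀ n f g → Σ< n (λ i → f i + g i) ≡ Σ< n f + Σ< n g
Σ<-+ n f g = trans (Σ<-∑ n _) (trans (∑-+ (downFrom n) f g)
  (sym (cong₂ _+_ (Σ<-∑ n f) (Σ<-∑ n g))))

Σ<-*ˡ : ∀ n k f → Σ< n (λ i → k * f i) ≡ k * Σ< n f
Σ<-*ˡ n k f = trans (Σ<-∑ n _) (trans (∑-*ˡ (downFrom n) k f) (cong (k *_) (sym (Σ<-∑ n f))))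

Σ<-*ʳ : ∀ n k f → Σ< n (λ i → f i * k) ≡ Σ< n f * k
Σ<-*ʳ n k f = trans (Σ<-∑ n _) (trans (∑-*ʳ (downFrom n) k f) (cong (_* k) (sym (Σ<-∑ n f))))

∑-Σ<-swap : {X : Set} (xs : List X) (n : ℕ) (f : X → ℕ → ℚ) →
            ∑ xs (λ x → Σ< n (f x)) ≡ Σ< n (λ i → ∑ xs λ x → f x i)
∑-Σ<-swap xs n f = trans (∑-cong xs λ x → Σ<-∑ n (f x))
  (trans (∑-swap xs (downFrom n) f) (sym (Σ<-∑ n _)))

Σ<-swap : ∀ m n (f : ℕ → ℕ → ℚ) → Σ< m (λ i → Σ< n (f i)) ≡ Σ< n (λ j → Σ< m λ i → f i j)
Σ<-swap m n f = trans (Σ<-∑ m _) (trans (∑-Σ<-swap (downFrom m) n f)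
  (Σ<-ext n λ j → sym (Σ<-∑ m λ i → f i j)))

Σ<-front : ∀ n f → Σ< (suc n) f ≡ f 0 + Σ< n (f ∘ suc)
Σ<-front zero    f = ℚP.+-comm 0ℚ (f 0)
Σ<-front (suc n) f = trans (cong (_+ f (suc n)) (Σ<-front n f)) (ℚP.+-assoc (f 0) _ _)

Σ<-extend : ∀ {m n} f → m ≤ n → (∀ i → m ≤ i → f i ≡ 0ℚ) → Σ< n f ≡ Σ< m f
Σ<-extend {m} f m≤n z with ℕP.m≤n⇒∃[o]m+o≡n m≤n
... | k , refl = go k
  where
  go : ∀ k → Σ< (m ℕ.+ k) f ≡ Σ< m f
  go zero    = cong (λ n → Σ< n f) (ℕP.+-identityʳ m)
  go (suc k) = trans (cong (λ n → Σ< n f) (ℕP.+-suc m k))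
    (trans (cong₂ _+_ (go k) (z (m ℕ.+ k) (ℕP.m≤m+n m k))) (ℚP.+-identityʳ _))

Σ<-single : ∀ {m n} f → m < n → (∀ i → i ≢ m → f i ≡ 0ℚ) → Σ< n f ≡ f m
Σ<-single {m} f m<n z = trans (Σ<-extend f m<n λ i m<i → z i (ℕP.>⇒≢ m<i))
  (trans (cong (_+ f m) (Σ<-zero m λ i i<m → z i (ℕP.<⇒≢ i<m))) (ℚP.+-identityˡ (f m)))

-- Cauchy products

-- Closed under passing to power series, so that applying `Cauchy` twice reaches bivariate series.
-- Equality is a field because series are compared coefficientwise.
record NonUnitalSemiring : Set₁ where
  infix  4 _≈_
  infixl 6 _⊕_
  infixl 7 _⊗_
  field
    Carrier       : Set
    _≈_           : Carrier → Carrier → Set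
    isEquivalence : IsEquivalence _≈_
    _⊕_ _⊗_       : Carrier → Carrier → Carrier
    ⊕-cong        : ∀ {x y u v} → x ≈ y → u ≈ v → x ⊕ u ≈ y ⊕ v
    ⊗-cong        : ∀ {x y u v} → x ≈ y → u ≈ v → x ⊗ u ≈ y ⊗ v
    ⊕-assoc       : ∀ x y z → (x ⊕ y) ⊕ z ≈ x ⊕ (y ⊕ z)
    ⊕-comm        : ∀ x y → x ⊕ y ≈ y ⊕ x
    ⊗-assoc       : ∀ x y z → (x ⊗ y) ⊗ z ≈ x ⊗ (y ⊗ z)
    ⊗-comm        : ∀ x y → x ⊗ y ≈ y ⊗ x
    distribˡ      : ∀ x y z → x ⊗ (y ⊕ z) ≈ (x ⊗ y) ⊕ (x ⊗ z)

  open IsEquivalence isEquivalence public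
    renaming (refl to ≈-refl; sym to ≈-sym; trans to ≈-trans)

  setoid : Setoid _ _
  setoid = record { isEquivalence = isEquivalence }

  ⊕-interchange : ∀ x y u v → (x ⊕ y) ⊕ (u ⊕ v) ≈ (x ⊕ u) ⊕ (y ⊕ v)
  ⊕-interchange x y u v = ≈-trans (⊕-assoc x y (u ⊕ v)) (≈-trans
    (⊕-cong ≈-refl (≈-trans (≈-sym (⊕-assoc y u v)) (≈-trans (⊕-cong (⊕-comm y u) ≈-refl) (⊕-assoc u y v))))
    (≈-sym (⊕-assoc x u (y ⊕ v))))

ℚ-semiring : NonUnitalSemiring
ℚ-semiring = record
  { Carrier = ℚ ; _≈_ = _≡_
  ; isEquivalence = record { refl = refl ; sym = sym ; trans = trans }
  ; _⊕_ = _+_ ; _⊗_ = _*_ ; ⊕-cong = cong₂ _+_ ; ⊗-cong = cong₂ _*_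
  ; ⊕-assoc = ℚP.+-assoc ; ⊕-comm = ℚP.+-comm
  ; ⊗-assoc = ℚP.*-assoc ; ⊗-comm = ℚP.*-comm ; distribˡ = ℚP.*-distribˡ-+
  }

module Cauchy (K : NonUnitalSemiring) where
  open NonUnitalSemiring K
  open SetoidReasoning setoid

  Ser : Set
  Ser = ℕ → Carrier

  -- Convolution by recursion on the exponent, splitting off the constant term of `A`; associativity
  -- becomes an induction without any reindexing of double sums.
  cauchy : Ser → Ser → Ser
  cauchy A B zero    = A 0 ⊗ B 0
  cauchy A B (suc n) = (A 0 ⊗ B (suc n)) ⊕ cauchy (A ∘ suc) B n

  cauchy-cong : ∀ {A A′ B B′} → (∀ n → A n ≈ A′ n) → (∀ n → B n ≈ B′ n) →
                ∀ n → cauchy A B n ≈ cauchy A′ B′ n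
  cauchy-cong a b zero    = ⊗-cong (a 0) (b 0)
  cauchy-cong a b (suc n) = ⊕-cong (⊗-cong (a 0) (b (suc n))) (cauchy-cong (a ∘ suc) b n)

  -- The same recursion from the other end, splitting off the constant term of `B`. The two together
  -- give commutativity.
  cauchy-last : ∀ A B n → cauchy A B (suc n) ≈ cauchy A (B ∘ suc) n ⊕ (A (suc n) ⊗ B 0)
  cauchy-last A B zero    = ≈-refl
  cauchy-last A B (suc n) = ≈-trans (⊕-cong ≈-refl (cauchy-last (A ∘ suc) B n)) (≈-sym (⊕-assoc _ _ _))

  cauchy-comm : ∀ A B n → cauchy A B n ≈ cauchy B A n
  cauchy-comm A B zero    = ⊗-comm (A 0) (B 0)
  cauchy-comm A B (suc n) = ≈-trans (⊕-cong (⊗-comm _ _) (cauchy-comm (A ∘ suc) B n))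
    (≈-trans (⊕-comm _ _) (≈-sym (cauchy-last B A n)))

  cauchy-distribˡ : ∀ A B C n → cauchy A (λ i → B i ⊕ C i) n ≈ cauchy A B n ⊕ cauchy A C n
  cauchy-distribˡ A B C zero    = distribˡ (A 0) (B 0) (C 0)
  cauchy-distribˡ A B C (suc n) = ≈-trans (⊕-cong (distribˡ _ _ _) (cauchy-distribˡ (A ∘ suc) B C n))
    (⊕-interchange _ _ _ _)

  cauchy-distribʳ : ∀ A B C n → cauchy (λ i → B i ⊕ C i) A n ≈ cauchy B A n ⊕ cauchy C A n
  cauchy-distribʳ A B C n = ≈-trans (cauchy-comm _ A n) (≈-trans (cauchy-distribˡ A B C n)
    (⊕-cong (cauchy-comm A B n) (cauchy-comm A C n)))

  cauchy-scale : ∀ k A B n → cauchy (λ i → k ⊗ A i) B n ≈ k ⊗ cauchy A B n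
  cauchy-scale k A B zero    = ⊗-assoc k (A 0) (B 0)
  cauchy-scale k A B (suc n) = ≈-trans (⊕-cong (⊗-assoc _ _ _) (cauchy-scale k (A ∘ suc) B n))
    (≈-sym (distribˡ _ _ _))

  cauchy-assoc : ∀ A B C n → cauchy (cauchy A B) C n ≈ cauchy A (cauchy B C) n
  cauchy-assoc A B C zero    = ⊗-assoc (A 0) (B 0) (C 0)
  cauchy-assoc A B C (suc n) = begin
    (A 0 ⊗ B 0 ⊗ C (suc n)) ⊕ cauchy (λ i → (A 0 ⊗ B (suc i)) ⊕ cauchy (A ∘ suc) B i) C n
      ≈⟨ ⊕-cong (⊗-assoc _ _ _) (≈-trans (cauchy-distribʳ C _ _ n)
           (⊕-cong (cauchy-scale (A 0) (B ∘ suc) C n) (cauchy-assoc (A ∘ suc) B C n))) ⟩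
    (A 0 ⊗ (B 0 ⊗ C (suc n))) ⊕ ((A 0 ⊗ cauchy (B ∘ suc) C n) ⊕ cauchy (A ∘ suc) (cauchy B C) n)
      ≈⟨ ≈-trans (≈-sym (⊕-assoc _ _ _)) (⊕-cong (≈-sym (distribˡ _ _ _)) ≈-refl) ⟩
    (A 0 ⊗ cauchy B C (suc n)) ⊕ cauchy (A ∘ suc) (cauchy B C) n ∎

  series : NonUnitalSemiring
  series = record
    { Carrier = Ser ; _≈_ = λ A B → ∀ n → A n ≈ B n
    ; isEquivalence = record { refl = λ n → ≈-refl ; sym = λ e n → ≈-sym (e n) ; trans = λ e f n → ≈-trans (e n) (f n) }
    ; _⊕_ = λ A B n → A n ⊕ B n ; _⊗_ = cauchy
    ; ⊕-cong = λ e f n → ⊕-cong (e n) (f n) ; ⊗-cong = cauchy-cong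
    ; ⊕-assoc = λ A B C n → ⊕-assoc _ _ _ ; ⊕-comm = λ A B n → ⊕-comm _ _
    ; ⊗-assoc = cauchy-assoc ; ⊗-comm = cauchy-comm ; distribˡ = cauchy-distribˡ
    }

module C₁ = Cauchy ℚ-semiring
module C₂ = Cauchy C₁.series

mul-cauchy : ∀ A B n → mul A B n ≡ C₁.cauchy A B n
mul-cauchy A B zero    = ℚP.+-identityˡ (A 0 * B 0)
mul-cauchy A B (suc n) = trans (Σ<-front (suc n) _)
  (cong (A 0 * B (suc n) +_) (mul-cauchy (A ∘ suc) B n))

bmul-cauchy : ∀ A B n m → bmul A B n m ≡ C₂.cauchy A B n m
bmul-cauchy A B zero    m = trans (ℚP.+-identityˡ _) (mul-cauchy (A 0) (B 0) m)
bmul-cauchy A B (suc n) m = trans (Σ<-front (suc n) _)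
  (cong₂ _+_ (mul-cauchy (A 0) (B (suc n)) m) (bmul-cauchy (A ∘ suc) B n m))

infix 4 _≐_
_≐_ : BS → BS → Set
A ≐ B = ∀ n m → A n m ≡ B n m

-- The bound on the exponents of z is what allows inductions along z, as in `solution-unique`.
bmul-cong-≤ : ∀ {A A′ B B′} n → (∀ i → i ≤ n → ∀ j → A i j ≡ A′ i j) →
              (∀ i → i ≤ n → ∀ j → B i j ≡ B′ i j) → ∀ m → bmul A B n m ≡ bmul A′ B′ n m
bmul-cong-≤ n a b m = Σ<-cong (suc n) λ i i≤n → Σ<-ext (suc m) λ j →
  cong₂ _*_ (a i (ℕP.≤-pred i≤n) j) (b (n ∸ i) (ℕP.m∸n≤m n i) (m ∸ j))

bmul-cong : ∀ {A A′ B B′} → A ≐ A′ → B ≐ B′ → bmul A B ≐ bmul A′ B′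
bmul-cong a b n m = bmul-cong-≤ n (λ i _ → a i) (λ i _ → b i) m

bmul-comm : ∀ A B → bmul A B ≐ bmul B A
bmul-comm A B n m = trans (bmul-cauchy A B n m) (trans (C₂.cauchy-comm A B n m) (sym (bmul-cauchy B A n m)))

bmul-assoc : ∀ A B C → bmul (bmul A B) C ≐ bmul A (bmul B C)
bmul-assoc A B C n m = begin
  bmul (bmul A B) C n m              ≡⟨ bmul-cong {B = C} (bmul-cauchy A B) (λ _ _ → refl) n m ⟩
  bmul (C₂.cauchy A B) C n m         ≡⟨ bmul-cauchy _ C n m ⟩
  C₂.cauchy (C₂.cauchy A B) C n m    ≡⟨ C₂.cauchy-assoc A B C n m ⟩
  C₂.cauchy A (C₂.cauchy B C) n m    ≡⟨ bmul-cauchy A _ n m ⟨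
  bmul A (C₂.cauchy B C) n m         ≡⟨ bmul-cong {A = A} (λ _ _ → refl) (bmul-cauchy B C) n m ⟨
  bmul A (bmul B C) n m              ∎
  where open ≡-Reasoning

bmul-leftComm : ∀ A B C → bmul A (bmul B C) ≐ bmul B (bmul A C)
bmul-leftComm A B C n m = begin
  bmul A (bmul B C) n m ≡⟨ bmul-assoc A B C n m ⟨
  bmul (bmul A B) C n m ≡⟨ bmul-cong {B = C} (bmul-comm A B) (λ _ _ → refl) n m ⟩
  bmul (bmul B A) C n m ≡⟨ bmul-assoc B A C n m ⟩
  bmul B (bmul A C) n m ∎
  where open ≡-Reasoning

bmul-distribˡ : ∀ A B C → bmul A (λ n m → B n m + C n m) ≐ λ n m → bmul A B n m + bmul A C n m
bmul-distribˡ A B C n m = trans (bmul-cauchy A _ n m) (trans (C₂.cauchy-distribˡ A B C n m)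
  (sym (cong₂ _+_ (bmul-cauchy A B n m) (bmul-cauchy A C n m))))

bmul-scaleʳ : ∀ k A B → bmul A (λ n m → k * B n m) ≐ λ n m → k * bmul A B n m
bmul-scaleʳ k A B n m = trans
  (Σ<-ext (suc n) λ i → trans
    (Σ<-ext (suc m) λ j → solve 3 (λ k a b → a :* (k :* b) := k :* (a :* b)) refl k (A i j) (B (n ∸ i) (m ∸ j)))
    (Σ<-*ˡ (suc m) k _))
  (Σ<-*ˡ (suc n) k _)
  where open +-*-Solver

bmul-zeroʳ : ∀ A B → (∀ n m → B n m ≡ 0ℚ) → ∀ n m → bmul A B n m ≡ 0ℚ
bmul-zeroʳ A B z n m = Σ<-zero (suc n) λ i _ → Σ<-zero (suc m) λ j _ →
  trans (cong (A i j *_) (z (n ∸ i) (m ∸ j))) (ℚP.*-zeroʳ (A i j))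

bmul-Σ<ʳ : ∀ N (k : ℕ → ℚ) A (B : ℕ → BS) →
           bmul A (λ n m → Σ< N λ l → k l * B l n m) ≐ λ n m → Σ< N λ l → k l * bmul A (B l) n m
bmul-Σ<ʳ zero    k A B n m = bmul-zeroʳ A _ (λ _ _ → refl) n m
bmul-Σ<ʳ (suc N) k A B n m = trans
  (bmul-distribˡ A (λ n m → Σ< N λ l → k l * B l n m) (λ n m → k N * B N n m) n m)
  (cong₂ _+_ (bmul-Σ<ʳ N k A B n m) (bmul-scaleʳ (k N) A (B N) n m))

-- Powers and exponentials of bivariate series

bpow-cong-≤ : ∀ {A A′} n → (∀ i → i ≤ n → ∀ j → A i j ≡ A′ i j) →
              ∀ k i → i ≤ n → ∀ j → bpow A k i j ≡ bpow A′ k i j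
bpow-cong-≤ n a zero    i i≤n j = refl
bpow-cong-≤ n a (suc k) i i≤n j = bmul-cong-≤ i (λ l l≤i → a l (ℕP.≤-trans l≤i i≤n))
  (λ l l≤i → bpow-cong-≤ n a k l (ℕP.≤-trans l≤i i≤n)) j

bexp-cong-≤ : ∀ {A A′} n → (∀ i → i ≤ n → ∀ j → A i j ≡ A′ i j) →
              ∀ i → i ≤ n → ∀ j → bexp A i j ≡ bexp A′ i j
bexp-cong-≤ n a i i≤n j = Σ<-ext (suc i) λ k → cong (frac 1 (k !) *_) (bpow-cong-≤ n a k i i≤n j)

bpow-low : ∀ {A} → (∀ m → A 0 m ≡ 0ℚ) → ∀ k n → n < k → ∀ m → bpow A k n m ≡ 0ℚ
bpow-low {A} A₀ (suc k) n (s≤s n≤k) m = Σ<-zero (suc n) λ i i≤n → Σ<-zero (suc m) λ j _ → term i (ℕP.≤-pred i≤n) j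
  where
  term : ∀ i → i ≤ n → ∀ j → A i j * bpow A k (n ∸ i) (m ∸ j) ≡ 0ℚ
  term zero    _   j = trans (cong (_* bpow A k n (m ∸ j)) (A₀ j)) (ℚP.*-zeroˡ (bpow A k n (m ∸ j)))
  term (suc i) i<n j = trans (cong (A (suc i) j *_) (bpow-low A₀ k (n ∸ suc i)
    (ℕP.<-≤-trans (ℕP.∸-monoʳ-< (s≤s z≤n) i<n) n≤k) (m ∸ j))) (ℚP.*-zeroʳ (A (suc i) j))

-- The cutoff in `bexp` moves with `n`. A common cutoff for all exponents below `N` makes exp(A) one
-- finite combination of powers, to be multiplied and differentiated term by term.
bexp-trunc : ∀ {A} → (∀ m → A 0 m ≡ 0ℚ) → ∀ {N} n → n < N → ∀ m →
             bexp A n m ≡ Σ< N (λ k → inv (k !) * bpow A k n m)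
bexp-trunc {A} A₀ n n<N m = trans
  (Σ<-ext (suc n) λ k → cong (_* bpow A k n m) (inv-def (k !)))
  (sym (Σ<-extend _ n<N λ k n<k → trans (cong (inv (k !) *_) (bpow-low A₀ k n n<k m)) (ℚP.*-zeroʳ (inv (k !)))))

k!≢0 : ∀ k → k ! ≢ 0
k!≢0 zero    ()
k!≢0 (suc k) = m*n≢0 {suc k} (λ ()) (k!≢0 k)

-- Multiplication of the (n , m) coefficient by an additive function of (n , m) is a derivation.
module Derivation (ω : ℕ → ℕ → ℕ)
                  (ω-+ : ∀ i i′ j j′ → ω (i ℕ.+ i′) (j ℕ.+ j′) ≡ ω i j ℕ.+ ω i′ j′) where

  ∂ : BS → BS
  ∂ A n m = c (ω n m) * A n m

  ω-0 : ω 0 0 ≡ 0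
  ω-0 = ℕP.+-cancelˡ-≡ (ω 0 0) (ω 0 0) 0 (trans (sym (ω-+ 0 0 0 0)) (sym (ℕP.+-identityʳ (ω 0 0))))

  ∂-bmul : ∀ A B → ∂ (bmul A B) ≐ λ n m → bmul (∂ A) B n m + bmul A (∂ B) n m
  ∂-bmul A B n m = begin
    c (ω n m) * bmul A B n m
      ≡⟨ trans (Σ<-ext (suc n) λ i → Σ<-*ˡ (suc m) (c (ω n m)) _) (Σ<-*ˡ (suc n) (c (ω n m)) _) ⟨
    (Σ< (suc n) λ i → Σ< (suc m) λ j → c (ω n m) * (A i j * B (n ∸ i) (m ∸ j)))
      ≡⟨ (Σ<-cong (suc n) λ i i≤n → Σ<-cong (suc m) λ j j≤m → term i j (ℕP.≤-pred i≤n) (ℕP.≤-pred j≤m)) ⟩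
    (Σ< (suc n) λ i → Σ< (suc m) λ j → ∂ A i j * B (n ∸ i) (m ∸ j) + A i j * ∂ B (n ∸ i) (m ∸ j))
      ≡⟨ trans (Σ<-ext (suc n) λ i → Σ<-+ (suc m) _ _) (Σ<-+ (suc n) _ _) ⟩
    bmul (∂ A) B n m + bmul A (∂ B) n m ∎
    where
    open ≡-Reasoning
    open +-*-Solver
    term : ∀ i j → i ≤ n → j ≤ m → c (ω n m) * (A i j * B (n ∸ i) (m ∸ j)) ≡
           ∂ A i j * B (n ∸ i) (m ∸ j) + A i j * ∂ B (n ∸ i) (m ∸ j)
    term i j i≤n j≤m = trans
      (cong (_* (A i j * B (n ∸ i) (m ∸ j))) (trans
        (cong c (trans (cong₂ ω (sym (ℕP.m+[n∸m]≡n i≤n)) (sym (ℕP.m+[n∸m]≡n j≤m)))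
                       (ω-+ i (n ∸ i) j (m ∸ j))))
        (c-+ (ω i j) (ω (n ∸ i) (m ∸ j)))))
      (solve 4 (λ x y a b → (x :+ y) :* (a :* b) := x :* a :* b :+ a :* (y :* b)) refl
        (c (ω i j)) (c (ω (n ∸ i) (m ∸ j))) (A i j) (B (n ∸ i) (m ∸ j)))

  ∂-bone : ∀ n m → ∂ bone n m ≡ 0ℚ
  ∂-bone zero    zero    = trans (cong (λ k → c k * 1ℚ) ω-0) (trans (cong (_* 1ℚ) c-0) (ℚP.*-zeroˡ 1ℚ))
  ∂-bone zero    (suc m) = ℚP.*-zeroʳ (c (ω 0 (suc m)))
  ∂-bone (suc n) m       = ℚP.*-zeroʳ (c (ω (suc n) m))

  ∂-bpow : ∀ A k → ∂ (bpow A (suc k)) ≐ λ n m → c (suc k) * bmul (∂ A) (bpow A k) n m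
  ∂-bpow A zero    n m = begin
    ∂ (bmul A bone) n m                           ≡⟨ ∂-bmul A bone n m ⟩
    bmul (∂ A) bone n m + bmul A (∂ bone) n m     ≡⟨ cong (bmul (∂ A) bone n m +_) (bmul-zeroʳ A (∂ bone) ∂-bone n m) ⟩
    bmul (∂ A) bone n m + 0ℚ                      ≡⟨ trans (ℚP.+-identityʳ X) (sym (ℚP.*-identityˡ X)) ⟩
    1ℚ * bmul (∂ A) bone n m                      ≡⟨ cong (_* bmul (∂ A) bone n m) c-1 ⟨
    c 1 * bmul (∂ A) bone n m                     ∎
    where
    open ≡-Reasoning
    X = bmul (∂ A) bone n m
  ∂-bpow A (suc k) n m = begin
    ∂ (bmul A (bpow A (suc k))) n m
      ≡⟨ ∂-bmul A (bpow A (suc k)) n m ⟩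
    X + bmul A (∂ (bpow A (suc k))) n m
      ≡⟨ cong (X +_) (trans (bmul-cong {A = A} (λ _ _ → refl) (∂-bpow A k) n m)
                            (bmul-scaleʳ (c (suc k)) A (bmul (∂ A) (bpow A k)) n m)) ⟩
    X + c (suc k) * bmul A (bmul (∂ A) (bpow A k)) n m
      ≡⟨ cong (λ x → X + c (suc k) * x) (bmul-leftComm A (∂ A) (bpow A k) n m) ⟩
    X + c (suc k) * X
      ≡⟨ solve 2 (λ k x → x :+ k :* x := (con 1ℚ :+ k) :* x) refl (c (suc k)) X ⟩
    (1ℚ + c (suc k)) * X
      ≡⟨ cong (_* X) (c-suc (suc k)) ⟨
    c (suc (suc k)) * X ∎
    where
    open ≡-Reasoning
    open +-*-Solver
    X = bmul (∂ A) (bpow A (suc k)) n m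

  -- Termwise: the derivative of A^(k+1)/(k+1)! is (∂A) A^k/k!, and the term k = 0 has derivative
  -- zero.
  ∂-bexp : ∀ A → (∀ m → A 0 m ≡ 0ℚ) → ∂ (bexp A) ≐ bmul (∂ A) (bexp A)
  ∂-bexp A A₀ n m = begin
    c (ω n m) * bexp A n m
      ≡⟨ cong (c (ω n m) *_) (bexp-trunc A₀ n ℕP.≤-refl m) ⟩
    c (ω n m) * Σ< (suc n) (λ k → inv (k !) * bpow A k n m)
      ≡⟨ trans (sym (Σ<-*ˡ (suc n) (c (ω n m)) _)) (Σ<-front n _) ⟩
    c (ω n m) * (inv 1 * bone n m) + Σ< n (λ k → c (ω n m) * (inv (suc k !) * bpow A (suc k) n m))
      ≡⟨ cong₂ _+_ head-vanishes (Σ<-ext n term) ⟩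
    0ℚ + Σ< n (λ k → inv (k !) * bmul (∂ A) (bpow A k) n m)
      ≡⟨ trans (ℚP.+-identityˡ _) (sym (bmul-Σ<ʳ n (λ k → inv (k !)) (∂ A) (bpow A) n m)) ⟩
    bmul (∂ A) (λ n′ m′ → Σ< n λ k → inv (k !) * bpow A k n′ m′) n m
      ≡⟨ (Σ<-cong (suc n) λ i i≤n → Σ<-ext (suc m) λ j → truncate i (ℕP.≤-pred i≤n) j) ⟨
    bmul (∂ A) (bexp A) n m ∎
    where
    open ≡-Reasoning
    open +-*-Solver
    head-vanishes : c (ω n m) * (inv 1 * bone n m) ≡ 0ℚ
    head-vanishes = trans (solve 3 (λ a b x → a :* (b :* x) := b :* (a :* x)) refl (c (ω n m)) (inv 1) (bone n m))
      (trans (cong (inv 1 *_) (∂-bone n m)) (ℚP.*-zeroʳ (inv 1)))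
    term : ∀ k → c (ω n m) * (inv (suc k !) * bpow A (suc k) n m) ≡ inv (k !) * bmul (∂ A) (bpow A k) n m
    term k = begin
      c (ω n m) * (inv (suc k !) * bpow A (suc k) n m)
        ≡⟨ solve 3 (λ a b x → a :* (b :* x) := b :* (a :* x)) refl (c (ω n m)) (inv (suc k !)) (bpow A (suc k) n m) ⟩
      inv (suc k !) * ∂ (bpow A (suc k)) n m
        ≡⟨ cong₂ _*_ (inv-* {suc k} (λ ()) (k!≢0 k)) (∂-bpow A k n m) ⟩
      inv (suc k) * inv (k !) * (c (suc k) * Y)
        ≡⟨ solve 4 (λ a b x y → a :* b :* (x :* y) := a :* (x :* (b :* y))) refl
             (inv (suc k)) (inv (k !)) (c (suc k)) Y ⟩
      inv (suc k) * (c (suc k) * (inv (k !) * Y))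
        ≡⟨ inv-c-cancel {suc k} (inv (k !) * Y) (λ ()) ⟩
      inv (k !) * Y ∎
      where Y = bmul (∂ A) (bpow A k) n m
    -- After the shift of k only `n` terms are left. They suffice for exp(A) at the exponents n - i
    -- with i ≥ 1, and for i = 0 the factor ∂A vanishes.
    truncate : ∀ i → i ≤ n → ∀ j → ∂ A i j * bexp A (n ∸ i) (m ∸ j) ≡
               ∂ A i j * Σ< n (λ k → inv (k !) * bpow A k (n ∸ i) (m ∸ j))
    truncate zero    _   j = trans (vanish (bexp A n (m ∸ j))) (sym (vanish (Σ< n (λ k → inv (k !) * bpow A k n (m ∸ j)))))
      where
      vanish : ∀ x → ∂ A 0 j * x ≡ 0ℚ
      vanish x = trans (cong (_* x) (trans (cong (c (ω 0 j) *_) (A₀ j)) (ℚP.*-zeroʳ (c (ω 0 j))))) (ℚP.*-zeroˡ x)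
    truncate (suc i) i<n j = cong (∂ A (suc i) j *_)
      (bexp-trunc A₀ (n ∸ suc i) (ℕP.∸-monoʳ-< (s≤s z≤n) i<n) (m ∸ j))

mul-cong : ∀ {A A′ B B′} → A ≗ A′ → B ≗ B′ → mul A B ≗ mul A′ B′
mul-cong a b n = Σ<-ext (suc n) λ i → cong₂ _*_ (a i) (b (n ∸ i))

mul-comm : ∀ A B → mul A B ≗ mul B A
mul-comm A B n = trans (mul-cauchy A B n) (trans (C₁.cauchy-comm A B n) (sym (mul-cauchy B A n)))

mul-assoc : ∀ A B C → mul (mul A B) C ≗ mul A (mul B C)
mul-assoc A B C n = begin
  mul (mul A B) C n                  ≡⟨ mul-cong {B = C} (mul-cauchy A B) (λ _ → refl) n ⟩
  mul (C₁.cauchy A B) C n            ≡⟨ mul-cauchy (C₁.cauchy A B) C n ⟩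
  C₁.cauchy (C₁.cauchy A B) C n      ≡⟨ C₁.cauchy-assoc A B C n ⟩
  C₁.cauchy A (C₁.cauchy B C) n      ≡⟨ mul-cauchy A (C₁.cauchy B C) n ⟨
  mul A (C₁.cauchy B C) n            ≡⟨ mul-cong {A = A} (λ _ → refl) (mul-cauchy B C) n ⟨
  mul A (mul B C) n                  ∎
  where open ≡-Reasoning

mul-distribʳ : ∀ A B C → mul (λ n → B n + C n) A ≗ λ n → mul B A n + mul C A n
mul-distribʳ A B C n = trans (mul-cauchy (λ n → B n + C n) A n) (trans (C₁.cauchy-distribʳ A B C n)
  (sym (cong₂ _+_ (mul-cauchy B A n) (mul-cauchy C A n))))

-- Univariate series as bivariate ones

liftU-mul : ∀ A B → bmul (liftU A) (liftU B) ≐ liftU (mul A B)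
liftU-mul A B n zero    = Σ<-ext (suc n) λ i → ℚP.+-identityˡ (A i * B (n ∸ i))
liftU-mul A B n (suc m) = Σ<-zero (suc n) λ i _ → Σ<-zero (suc (suc m)) λ j _ → term i j
  where
  term : ∀ i j → liftU A i j * liftU B (n ∸ i) (suc m ∸ j) ≡ 0ℚ
  term i zero    = ℚP.*-zeroʳ (A i)
  term i (suc j) = ℚP.*-zeroˡ (liftU B (n ∸ i) (m ∸ j))

liftU-pow : ∀ A k → bpow (liftU A) k ≐ liftU (pow A k)
liftU-pow A zero    zero    zero    = refl
liftU-pow A zero    zero    (suc m) = refl
liftU-pow A zero    (suc n) zero    = refl
liftU-pow A zero    (suc n) (suc m) = refl
liftU-pow A (suc k) n       m       = trans
  (bmul-cong {A = liftU A} (λ _ _ → refl) (liftU-pow A k) n m) (liftU-mul A (pow A k) n m)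

liftU-exp : ∀ A n → bexp (liftU A) n 0 ≡ expS A n
liftU-exp A n = Σ<-ext (suc n) λ k → cong (frac 1 (k !) *_) (liftU-pow A k n 0)

bmul-0 : ∀ A B n → bmul A B n 0 ≡ mul (λ i → A i 0) (λ i → B i 0) n
bmul-0 A B n = Σ<-ext (suc n) λ i → ℚP.+-identityˡ (A i 0 * B (n ∸ i) 0)

-- The Euler operators z ∂/∂z and u ∂/∂u.
module ∂z = Derivation (λ n m → n) (λ _ _ _ _ → refl)
module ∂u = Derivation (λ n m → m) (λ _ _ _ _ → refl)

-- First-order differential equations in z

δ : PS → PS
δ A n = c n * A n

δ-mul : ∀ A B → δ (mul A B) ≗ λ n → mul (δ A) B n + mul A (δ B) n
δ-mul A B n = begin
  c n * mul A B n                                       ≡⟨ cong (c n *_) (bmul-0 (liftU A) (liftU B) n) ⟨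
  c n * bmul (liftU A) (liftU B) n 0                    ≡⟨ ∂z.∂-bmul (liftU A) (liftU B) n 0 ⟩
  bmul (∂z.∂ (liftU A)) (liftU B) n 0 + bmul (liftU A) (∂z.∂ (liftU B)) n 0
    ≡⟨ cong₂ _+_ (bmul-0 (∂z.∂ (liftU A)) (liftU B) n) (bmul-0 (liftU A) (∂z.∂ (liftU B)) n) ⟩
  mul (δ A) B n + mul A (δ B) n                         ∎
  where open ≡-Reasoning

δ-exp : ∀ A → A 0 ≡ 0ℚ → δ (expS A) ≗ mul (δ A) (expS A)
δ-exp A A₀ n = begin
  c n * expS A n                          ≡⟨ cong (c n *_) (liftU-exp A n) ⟨
  c n * bexp (liftU A) n 0                ≡⟨ ∂z.∂-bexp (liftU A) (λ { zero → A₀ ; (suc m) → refl }) n 0 ⟩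
  bmul (∂z.∂ (liftU A)) (bexp (liftU A)) n 0 ≡⟨ bmul-0 (∂z.∂ (liftU A)) (bexp (liftU A)) n ⟩
  mul (δ A) (λ i → bexp (liftU A) i 0) n  ≡⟨ mul-cong {A = δ A} (λ _ → refl) (liftU-exp A) n ⟩
  mul (δ A) (expS A) n                    ∎
  where open ≡-Reasoning

-- Logarithmic derivatives add up. Working with the product bypasses exp(A) exp(B) = exp(A + B).
δ-exp-mul-exp : ∀ A B → A 0 ≡ 0ℚ → B 0 ≡ 0ℚ →
  δ (mul (expS A) (expS B)) ≗ mul (λ n → δ A n + δ B n) (mul (expS A) (expS B))
δ-exp-mul-exp A B A₀ B₀ n = begin
  δ X n                                              ≡⟨ δ-mul (expS A) (expS B) n ⟩
  mul (δ (expS A)) (expS B) n + mul (expS A) (δ (expS B)) n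
    ≡⟨ cong₂ _+_
         (trans (mul-cong {B = expS B} (δ-exp A A₀) (λ _ → refl) n) (mul-assoc (δ A) (expS A) (expS B) n))
         (begin
            mul (expS A) (δ (expS B)) n              ≡⟨ mul-cong {A = expS A} (λ _ → refl) (δ-exp B B₀) n ⟩
            mul (expS A) (mul (δ B) (expS B)) n      ≡⟨ mul-assoc (expS A) (δ B) (expS B) n ⟨
            mul (mul (expS A) (δ B)) (expS B) n      ≡⟨ mul-cong {B = expS B} (mul-comm (expS A) (δ B)) (λ _ → refl) n ⟩
            mul (mul (δ B) (expS A)) (expS B) n      ≡⟨ mul-assoc (δ B) (expS A) (expS B) n ⟩
            mul (δ B) X n                            ∎) ⟩
  mul (δ A) X n + mul (δ B) X n                      ≡⟨ mul-distribʳ X (δ A) (δ B) n ⟨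
  mul (λ n → δ A n + δ B n) X n                      ∎
  where
  open ≡-Reasoning
  X = mul (expS A) (expS B)

<-strong : (Q : ℕ → Set) → (∀ n → (∀ i → i < n → Q i) → Q n) → ∀ n → Q n
<-strong Q step n = step n (below n)
  where
  below : ∀ n i → i < n → Q i
  below (suc n) i (s≤s i≤n) = step i λ l l<i → below n l (ℕP.<-≤-trans l<i i≤n)

-- At z^(n+1) the equation reads (n + 1) X_(n+1) = a sum over lower coefficients of `X`, because `E`
-- has no constant term.
δ-unique : ∀ E X Y → E 0 ≡ 0ℚ → X 0 ≡ Y 0 → δ X ≗ mul E X → δ Y ≗ mul E Y → X ≗ Y
δ-unique E X Y E₀ XY₀ hX hY = <-strong _ step
  where
  step : ∀ n → (∀ i → i < n → X i ≡ Y i) → X n ≡ Y n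
  step zero    _  = XY₀
  step (suc n) ih = c-cancel {suc n} (λ ()) (trans (hX (suc n)) (trans
    (Σ<-cong (suc (suc n)) λ i i≤n → term i (ℕP.≤-pred i≤n)) (sym (hY (suc n)))))
    where
    term : ∀ i → i ≤ suc n → E i * X (suc n ∸ i) ≡ E i * Y (suc n ∸ i)
    term zero    _       = trans (cong (_* X (suc n)) E₀) (trans (ℚP.*-zeroˡ (X (suc n)))
      (sym (trans (cong (_* Y (suc n)) E₀) (ℚP.*-zeroˡ (Y (suc n))))))
    term (suc i) (s≤s _) = cong (E (suc i) *_) (ih (n ∸ i) (s≤s (ℕP.m∸n≤m n i)))

-- z times the derivative of Σ_{i≥1} T(z^i)/i
eulerE : PS → PS
eulerE t n = Σ< (suc n) λ i → Σ< (suc n) λ k → ind ((1 ℕ.≤? i) ×-dec (i ℕ.* k ℕ.≟ n)) * (c k * t k)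

eulerE-0 : ∀ t → eulerE t 0 ≡ 0ℚ
eulerE-0 t = trans (ℚP.+-identityˡ _) (trans (ℚP.+-identityˡ _) (ℚP.*-zeroˡ (c 0 * t 0)))

-- When i k = n, the factor n of the derivative and the denominator of T(z^i)/i combine to n/i = k.
-- The index i = 1 gives `δ t`, and the indices i ≥ 2 give the derivative of `sumTzi≥2 t`.
eulerE-split : ∀ t n → δ t n + δ (sumTzi≥2 t) n ≡ eulerE t n
eulerE-split t n = sym (begin
  eulerE t n
    ≡⟨ (Σ<-ext (suc n) λ i → Σ<-ext (suc n) λ k → split i k) ⟩
  (Σ< (suc n) λ i → Σ< (suc n) λ k → ind (i ℕ.≟ 1) * (ind (k ℕ.≟ n) * (c k * t k)) + c n * term₂ i k)
    ≡⟨ trans (Σ<-ext (suc n) λ i → Σ<-+ (suc n) _ _) (Σ<-+ (suc n) _ _) ⟩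
  (Σ< (suc n) λ i → Σ< (suc n) λ k → ind (i ℕ.≟ 1) * (ind (k ℕ.≟ n) * (c k * t k))) +
  (Σ< (suc n) λ i → Σ< (suc n) λ k → c n * term₂ i k)
    ≡⟨ cong₂ _+_ first (trans (Σ<-ext (suc n) λ i → Σ<-*ˡ (suc n) (c n) _) (Σ<-*ˡ (suc n) (c n) _)) ⟩
  δ t n + δ (sumTzi≥2 t) n ∎)
  where
  open ≡-Reasoning
  term₂ : ℕ → ℕ → ℚ
  term₂ i k = if does ((2 ℕ.≤? i) ×-dec (i ℕ.* k ℕ.≟ n)) then frac 1 i * t k else 0ℚ

  first : (Σ< (suc n) λ i → Σ< (suc n) λ k → ind (i ℕ.≟ 1) * (ind (k ℕ.≟ n) * (c k * t k))) ≡ δ t n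
  first = begin
    (Σ< (suc n) λ i → Σ< (suc n) λ k → ind (i ℕ.≟ 1) * (ind (k ℕ.≟ n) * (c k * t k)))
      ≡⟨ (Σ<-ext (suc n) λ i → trans (Σ<-*ˡ (suc n) (ind (i ℕ.≟ 1)) _) (cong (ind (i ℕ.≟ 1) *_)
           (trans (Σ<-single {n} _ ℕP.≤-refl λ k k≢n → trans (cong (_* (c k * t k)) (ind-no (k ℕ.≟ n) k≢n)) (ℚP.*-zeroˡ (c k * t k)))
                  (trans (cong (_* (c n * t n)) (ind-yes (n ℕ.≟ n) refl)) (ℚP.*-identityˡ (c n * t n)))))) ⟩
    (Σ< (suc n) λ i → ind (i ℕ.≟ 1) * δ t n)
      ≡⟨ ones n ⟩
    δ t n ∎
    where
    ones : ∀ l → (Σ< (suc l) λ i → ind (i ℕ.≟ 1) * δ t l) ≡ δ t l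
    -- For n = 0 the index i = 1 lies outside the range, but then the factor n makes `δ t 0` vanish
    -- as well.
    ones zero    = trans (ℚP.+-identityˡ _) (trans (ℚP.*-zeroˡ (δ t 0))
      (sym (trans (cong (_* t 0) c-0) (ℚP.*-zeroˡ (t 0)))))
    ones (suc l) = trans (Σ<-single {1} {suc (suc l)} (λ i → ind (i ℕ.≟ 1) * δ t (suc l)) (s≤s (s≤s z≤n))
      λ i i≢1 → trans (cong (_* δ t (suc l)) (ind-no (i ℕ.≟ 1) i≢1)) (ℚP.*-zeroˡ (δ t (suc l))))
      (ℚP.*-identityˡ (δ t (suc l)))

  split : ∀ i k → ind ((1 ℕ.≤? i) ×-dec (i ℕ.* k ℕ.≟ n)) * (c k * t k) ≡
          ind (i ℕ.≟ 1) * (ind (k ℕ.≟ n) * (c k * t k)) + c n * term₂ i k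
  split zero k = trans (ℚP.*-zeroˡ (c k * t k)) (sym (trans
    (cong₂ _+_ (ℚP.*-zeroˡ (ind (k ℕ.≟ n) * (c k * t k))) (ℚP.*-zeroʳ (c n))) refl))
  split (suc zero) k = trans
    (cong (_* (c k * t k)) (ind-iff ((1 ℕ.≤? 1) ×-dec (1 ℕ.* k ℕ.≟ n)) (k ℕ.≟ n)
      (λ (_ , e) → trans (sym (ℕP.*-identityˡ k)) e) (λ e → s≤s z≤n , trans (ℕP.*-identityˡ k) e)))
    (sym (trans (cong₂ _+_ (ℚP.*-identityˡ (ind (k ℕ.≟ n) * (c k * t k))) (ℚP.*-zeroʳ (c n)))
                (ℚP.+-identityʳ _)))
  split (suc (suc i)) k = trans
    (cong (_* (c k * t k)) (ind-iff P₁ P₂ (λ (_ , e) → s≤s (s≤s z≤n) , e) (λ (_ , e) → s≤s z≤n , e)))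
    (trans rest (sym (trans (cong (_+ c n * term₂ l k) (ℚP.*-zeroˡ (ind (k ℕ.≟ n) * (c k * t k))))
                             (ℚP.+-identityˡ (c n * term₂ l k)))))
    where
    l = suc (suc i)
    P₁ = (1 ℕ.≤? l) ×-dec (l ℕ.* k ℕ.≟ n)
    P₂ = (2 ℕ.≤? l) ×-dec (l ℕ.* k ℕ.≟ n)
    rest : ind P₂ * (c k * t k) ≡ c n * term₂ l k
    rest = trans (ind-cong P₂ λ (_ , e) → value e) (trans
      (solve 3 (λ a b x → a :* (b :* x) := b :* (a :* x)) refl (ind P₂) (c n) (frac 1 l * t k))
      (cong (c n *_) (sym (if-ind P₂ (frac 1 l * t k)))))
      where
      open +-*-Solver
      value : l ℕ.* k ≡ n → c k * t k ≡ c n * (frac 1 l * t k)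
      value e = sym (begin
        c n * (frac 1 l * t k)            ≡⟨ cong₂ (λ x y → x * (y * t k)) (cong c (sym e)) (inv-def l) ⟩
        c (l ℕ.* k) * (inv l * t k)       ≡⟨ cong (_* (inv l * t k)) (c-* l k) ⟩
        c l * c k * (inv l * t k)         ≡⟨ solve 4 (λ a b x y → a :* b :* (x :* y) := x :* (a :* (b :* y))) refl
                                               (c l) (c k) (inv l) (t k) ⟩
        inv l * (c l * (c k * t k))       ≡⟨ inv-c-cancel {l} (c k * t k) (λ ()) ⟩
        c k * t k                         ∎)

euler-unique : ∀ t P → t 0 ≡ 0ℚ → P 0 ≡ 1ℚ → δ P ≗ mul (eulerE t) P → P ≗ mul (expS t) (Dser t)
euler-unique t P t₀ P₀ hP = δ-unique (eulerE t) P X (eulerE-0 t) P₀ hP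
  λ n → trans (δ-exp-mul-exp t (sumTzi≥2 t) t₀ (trans (ℚP.+-identityˡ _) (ℚP.+-identityˡ _)) n)
    (mul-cong {B = X} (eulerE-split t) (λ _ → refl) n)
  where X = mul (expS t) (Dser t)

-- Setting u = 1 in a series whose coefficient of z^n is a polynomial of degree at most n in u

Deg : BS → Set
Deg X = ∀ n m → n < m → X n m ≡ 0ℚ

ev : BS → PS
ev X n = Σ< (suc n) (X n)

-- Evaluation at 1 is multiplicative on polynomials. Factors with a and b coefficients have a
-- product with a + b - 1 of them, whence the bound on `N`.
mul-sum : ∀ a b N f g → (∀ m → a ≤ m → f m ≡ 0ℚ) → (∀ m → b ≤ m → g m ≡ 0ℚ) → a ℕ.+ b ≤ suc N →
          Σ< N (mul f g) ≡ Σ< a f * Σ< b g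
mul-sum zero    b N f g hf hg _ = trans
  (Σ<-zero N λ m _ → Σ<-zero (suc m) λ i _ → trans (cong (_* g (m ∸ i)) (hf i z≤n)) (ℚP.*-zeroˡ (g (m ∸ i))))
  (sym (ℚP.*-zeroˡ (Σ< b g)))
mul-sum (suc a) zero zero f g hf hg _ = sym (ℚP.*-zeroʳ (Σ< (suc a) f))
mul-sum (suc a) (suc b) zero f g hf hg (s≤s le) with () ← ℕP.m+n≤o⇒n≤o a le
mul-sum (suc a) b (suc N) f g hf hg (s≤s le) = begin
  Σ< (suc N) (mul f g)
    ≡⟨ Σ<-front N (mul f g) ⟩
  mul f g 0 + Σ< N (λ m → mul f g (suc m))
    ≡⟨ cong₂ _+_ (ℚP.+-identityˡ (f 0 * g 0)) (trans (Σ<-ext N λ m → Σ<-front (suc m) (λ i → f i * g (suc m ∸ i)))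
         (Σ<-+ N _ _)) ⟩
  f 0 * g 0 + (Σ< N (λ m → f 0 * g (suc m)) + Σ< N (mul (f ∘ suc) g))
    ≡⟨ sym (ℚP.+-assoc (f 0 * g 0) (Σ< N (λ m → f 0 * g (suc m))) (Σ< N (mul (f ∘ suc) g))) ⟩
  f 0 * g 0 + Σ< N (λ m → f 0 * g (suc m)) + Σ< N (mul (f ∘ suc) g)
    ≡⟨ cong₂ _+_ (trans (sym (Σ<-front N (λ m → f 0 * g m))) (trans (Σ<-*ˡ (suc N) (f 0) g)
           (cong (f 0 *_) (Σ<-extend g (ℕP.m+n≤o⇒n≤o a le) hg))))
         (mul-sum a b N (f ∘ suc) g (λ m a≤m → hf (suc m) (s≤s a≤m)) hg le) ⟩
  f 0 * Σ< b g + Σ< a (f ∘ suc) * Σ< b g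
    ≡⟨ ℚP.*-distribʳ-+ (Σ< b g) (f 0) (Σ< a (f ∘ suc)) ⟨
  (f 0 + Σ< a (f ∘ suc)) * Σ< b g
    ≡⟨ cong (_* Σ< b g) (Σ<-front a f) ⟨
  Σ< (suc a) f * Σ< b g ∎
  where open ≡-Reasoning

Deg-bmul : ∀ {X Y} → Deg X → Deg Y → Deg (bmul X Y)
Deg-bmul {X} {Y} dX dY n m n<m = Σ<-zero (suc n) λ i i≤n → Σ<-zero (suc m) λ j j≤m → term i j (ℕP.≤-pred i≤n)
  where
  term : ∀ i j → i ≤ n → X i j * Y (n ∸ i) (m ∸ j) ≡ 0ℚ
  term i j i≤n with i ℕ.<? j
  ... | yes i<j = trans (cong (_* Y (n ∸ i) (m ∸ j)) (dX i j i<j)) (ℚP.*-zeroˡ (Y (n ∸ i) (m ∸ j)))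
  ... | no  i≮j = trans (cong (X i j *_) (dY (n ∸ i) (m ∸ j) (ℕP.<-≤-trans (ℕP.∸-monoˡ-< n<m i≤n)
                    (ℕP.∸-monoʳ-≤ m (ℕP.≮⇒≥ i≮j))))) (ℚP.*-zeroʳ (X i j))

Deg-bpow : ∀ {X} → Deg X → ∀ k → Deg (bpow X k)
Deg-bpow dX zero    zero    (suc m) _ = refl
Deg-bpow dX zero    (suc n) m       _ = refl
Deg-bpow {X} dX (suc k) = Deg-bmul {X} {bpow X k} dX (Deg-bpow dX k)

Deg-bexp : ∀ {X} → Deg X → Deg (bexp X)
Deg-bexp dX n m n<m = Σ<-zero (suc n) λ k _ →
  trans (cong (frac 1 (k !) *_) (Deg-bpow dX k n m n<m)) (ℚP.*-zeroʳ (frac 1 (k !)))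

Deg-liftU : ∀ B → Deg (liftU B)
Deg-liftU B n (suc m) _ = refl

ev-bmul : ∀ {X Y} → Deg X → Deg Y → ev (bmul X Y) ≗ mul (ev X) (ev Y)
ev-bmul {X} {Y} dX dY n = trans (Σ<-swap (suc n) (suc n) _)
  -- By `Deg` the two factors have i + 1 and n - i + 1 coefficients in u, so the n + 1 coefficients
  -- kept by `ev` are exactly enough.
  (Σ<-cong (suc n) λ i i≤n → mul-sum (suc i) (suc (n ∸ i)) (suc n) (X i) (Y (n ∸ i)) (dX i) (dY (n ∸ i))
    (ℕP.≤-reflexive (cong suc (trans (ℕP.+-suc i (n ∸ i)) (cong suc (ℕP.m+[n∸m]≡n (ℕP.≤-pred i≤n)))))))

ev-bpow : ∀ {X} → Deg X → ∀ k → ev (bpow X k) ≗ pow (ev X) k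
ev-bpow dX zero    zero    = ℚP.+-identityˡ 1ℚ
ev-bpow dX zero    (suc n) = Σ<-zero (suc (suc n)) λ _ _ → refl
ev-bpow {X} dX (suc k) n = trans (ev-bmul {X} {bpow X k} dX (Deg-bpow dX k) n)
  (mul-cong {A = ev X} (λ _ → refl) (ev-bpow dX k) n)

ev-bexp : ∀ {X} → Deg X → ev (bexp X) ≗ expS (ev X)
ev-bexp {X} dX n = trans (Σ<-swap (suc n) (suc n) _)
  (Σ<-ext (suc n) λ k → trans (Σ<-*ˡ (suc n) (frac 1 (k !)) (bpow X k n))
    (cong (frac 1 (k !) *_) (ev-bpow dX k n)))

ev-liftU : ∀ B → ev (liftU B) ≗ B
ev-liftU B n = trans (Σ<-front n _) (trans (cong (B n +_) (Σ<-zero n λ _ _ → refl)) (ℚP.+-identityʳ (B n)))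

-- A linear differential equation in u determines a series from its value at u = 1.
∂u-unique : ∀ A X Y → (∀ m → A 0 m ≡ 0ℚ) → ∂u.∂ X ≐ bmul (∂u.∂ A) X → ∂u.∂ Y ≐ bmul (∂u.∂ A) Y →
            ev X ≗ ev Y → X ≐ Y
∂u-unique A X Y A₀ hX hY evXY = <-strong _ step
  where
  step : ∀ n → (∀ i → i < n → ∀ m → X i m ≡ Y i m) → ∀ m → X n m ≡ Y n m
  step n ih = all
    where
    -- For positive powers of u the factor m + 1 can be cancelled, and since `A` has no constant
    -- term in z the right side involves only lower powers of z.
    pos : ∀ m → X n (suc m) ≡ Y n (suc m)
    pos m = c-cancel {suc m} (λ ()) (trans (hX n (suc m)) (trans
      (Σ<-cong (suc n) λ i i≤n → Σ<-ext (suc (suc m)) λ j → term i (ℕP.≤-pred i≤n) j)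
      (sym (hY n (suc m)))))
      where
      vanish : ∀ j x → ∂u.∂ A 0 j * x ≡ 0ℚ
      vanish j x = trans (cong (_* x) (trans (cong (c j *_) (A₀ j)) (ℚP.*-zeroʳ (c j)))) (ℚP.*-zeroˡ x)
      term : ∀ i → i ≤ n → ∀ j → ∂u.∂ A i j * X (n ∸ i) (suc m ∸ j) ≡ ∂u.∂ A i j * Y (n ∸ i) (suc m ∸ j)
      term zero    _   j = trans (vanish j (X n (suc m ∸ j))) (sym (vanish j (Y n (suc m ∸ j))))
      term (suc i) i<n j = cong (∂u.∂ A (suc i) j *_) (ih (n ∸ suc i) (ℕP.∸-monoʳ-< (s≤s z≤n) i<n) (suc m ∸ j))
    all : ∀ m → X n m ≡ Y n m
    -- The coefficient of u^0, invisible to u ∂/∂u, is the value at u = 1 minus all the other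
    -- coefficients.
    all zero    = +-cancelʳ (Σ< n (X n ∘ suc)) (X n 0) (Y n 0) (trans (sym (Σ<-front n (X n)))
      (trans (evXY n) (trans (Σ<-front n (Y n)) (cong (Y n 0 +_) (sym (Σ<-ext n pos))))))
    all (suc m) = pos m

Deg-shiftZU : ∀ {X} → Deg X → Deg (shiftZU X)
Deg-shiftZU dX zero    m       _         = refl
Deg-shiftZU dX (suc n) (suc m) (s≤s n<m) = dX n m n<m

ev-shiftZU : ∀ X n → ev (shiftZU X) (suc n) ≡ ev X n
ev-shiftZU X n = trans (Σ<-front (suc n) (shiftZU X (suc n))) (ℚP.+-identityˡ (ev X n))

-- Positive powers of `A` vanish at u = 0, so only the term k = 0 of the exponential survives.
bexp-0 : ∀ {A} → (∀ n → A n 0 ≡ 0ℚ) → ∀ n → bexp A n 0 ≡ one n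
bexp-0 {A} A₀ n = trans (Σ<-front n _) (trans
  (cong₂ _+_ (trans (ℚP.*-identityˡ (bone n 0)) (unit n))
    (Σ<-zero n λ k _ → trans (cong (frac 1 (suc k !) *_) (trans (bmul-0 A (bpow A k) n)
      (Σ<-zero (suc n) λ i _ → trans (cong (_* bpow A k (n ∸ i) 0) (A₀ i)) (ℚP.*-zeroˡ (bpow A k (n ∸ i) 0)))))
      (ℚP.*-zeroʳ (frac 1 (suc k !)))))
  (ℚP.+-identityʳ (one n)))
  where
  unit : ∀ n → bone n 0 ≡ one n
  unit zero    = refl
  unit (suc n) = refl

-- Here A = z u Φ, so that the conclusions say A = z u exp(A) D and Φ(z, 0) = D.
module FunctionalEquation
  (t P : PS) (Φ : BS) (t₀ : t 0 ≡ 0ℚ) (t-suc : ∀ n → t (suc n) ≡ P n)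
  (Φ-deg : Deg Φ) (Φ-ev : ev Φ ≗ P) (Φ-∂ : ∂u.∂ Φ ≐ bmul (∂u.∂ (shiftZU Φ)) Φ)
  (P₀ : P 0 ≡ 1ℚ) (P-δ : δ P ≗ mul (eulerE t) P) where

  private
    Ψ : BS
    Ψ = bmul (bexp (shiftZU Φ)) (liftU (Dser t))

    -- Differentiating the exponential brings out the factor ∂A, while D is constant in u.
    Ψ-∂ : ∂u.∂ Ψ ≐ bmul (∂u.∂ (shiftZU Φ)) Ψ
    Ψ-∂ n m = begin
      ∂u.∂ Ψ n m                                ≡⟨ ∂u.∂-bmul E L n m ⟩
      bmul (∂u.∂ E) L n m + bmul E (∂u.∂ L) n m ≡⟨ cong (bmul (∂u.∂ E) L n m +_) (bmul-zeroʳ E (∂u.∂ L) L-const n m) ⟩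
      bmul (∂u.∂ E) L n m + 0ℚ                  ≡⟨ ℚP.+-identityʳ (bmul (∂u.∂ E) L n m) ⟩
      bmul (∂u.∂ E) L n m                       ≡⟨ bmul-cong {B = L} (∂u.∂-bexp A (λ _ → refl)) (λ _ _ → refl) n m ⟩
      bmul (bmul (∂u.∂ A) E) L n m              ≡⟨ bmul-assoc (∂u.∂ A) E L n m ⟩
      bmul (∂u.∂ A) Ψ n m                       ∎
      where
      open ≡-Reasoning
      A = shiftZU Φ
      E = bexp A
      L = liftU (Dser t)
      L-const : ∀ n m → ∂u.∂ L n m ≡ 0ℚ
      L-const n zero    = trans (cong (_* Dser t n) c-0) (ℚP.*-zeroˡ (Dser t n))
      L-const n (suc m) = ℚP.*-zeroʳ (c (suc m))

    ev-A : ev (shiftZU Φ) ≗ t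
    ev-A zero    = trans (ℚP.+-identityˡ 0ℚ) (sym t₀)
    ev-A (suc n) = trans (ev-shiftZU Φ n) (trans (Φ-ev n) (sym (t-suc n)))

    expS-cong : ∀ {X Y} → X ≗ Y → expS X ≗ expS Y
    expS-cong {X} {Y} eq n = Σ<-ext (suc n) λ k → cong (frac 1 (k !) *_) (pow-cong k n)
      where
      pow-cong : ∀ k → pow X k ≗ pow Y k
      pow-cong zero    n = refl
      pow-cong (suc k) n = mul-cong eq (pow-cong k) n

    Ψ-ev : ev Ψ ≗ P
    Ψ-ev n = begin
      ev Ψ n                                 ≡⟨ ev-bmul {bexp A} {liftU (Dser t)} (Deg-bexp dA) (Deg-liftU (Dser t)) n ⟩
      mul (ev (bexp A)) (ev (liftU (Dser t))) n
        ≡⟨ mul-cong (λ i → trans (ev-bexp dA i) (expS-cong ev-A i)) (ev-liftU (Dser t)) n ⟩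
      mul (expS t) (Dser t) n                ≡⟨ euler-unique t P t₀ P₀ P-δ n ⟨
      P n                                    ∎
      where
      open ≡-Reasoning
      A = shiftZU Φ
      dA : Deg A
      dA = Deg-shiftZU Φ-deg

  Φ-solution : Φ ≐ bmul (bexp (shiftZU Φ)) (liftU (Dser t))
  Φ-solution = ∂u-unique (shiftZU Φ) Φ Ψ (λ _ → refl) Φ-∂ Ψ-∂ (λ n → trans (Φ-ev n) (sym (Ψ-ev n)))

  Φ-0 : ∀ n → Φ n 0 ≡ Dser t n
  Φ-0 n = begin
    Φ n 0                                         ≡⟨ Φ-solution n 0 ⟩
    Ψ n 0                                         ≡⟨ bmul-0 (bexp (shiftZU Φ)) (liftU (Dser t)) n ⟩
    mul (λ i → bexp (shiftZU Φ) i 0) (Dser t) n   ≡⟨ mul-cong {B = Dser t} (bexp-0 A-0) (λ _ → refl) n ⟩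
    mul one (Dser t) n                            ≡⟨ mul-cauchy one (Dser t) n ⟩
    C₁.cauchy one (Dser t) n                      ≡⟨ unit (Dser t) n ⟩
    Dser t n                                      ∎
    where
    open ≡-Reasoning
    A-0 : ∀ n → shiftZU Φ n 0 ≡ 0ℚ
    A-0 zero    = refl
    A-0 (suc n) = refl
    zeros : ∀ B n → C₁.cauchy (λ _ → 0ℚ) B n ≡ 0ℚ
    zeros B zero    = ℚP.*-zeroˡ (B 0)
    zeros B (suc n) = trans (cong₂ _+_ (ℚP.*-zeroˡ (B (suc n))) (zeros B n)) refl
    unit : ∀ B n → C₁.cauchy one B n ≡ B n
    unit B zero    = ℚP.*-identityˡ (B 0)
    unit B (suc n) = trans (cong₂ _+_ (ℚP.*-identityˡ (B (suc n))) (zeros B n)) (ℚP.+-identityʳ (B (suc n)))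

  -- Because of the factor z, the coefficient of z^(n+1) on the right side depends on `tc` only up
  -- to z^n.
  solution-unique : ∀ tc → SolvesTc t tc → tc ≐ shiftZU Φ
  solution-unique tc sol = <-strong _ step
    where
    step : ∀ n → (∀ i → i < n → ∀ m → tc i m ≡ shiftZU Φ i m) → ∀ m → tc n m ≡ shiftZU Φ n m
    step zero    ih m       = sol 0 m
    step (suc n) ih zero    = sol (suc n) 0
    step (suc n) ih (suc m) = trans (sol (suc n) (suc m)) (trans
      (bmul-cong-≤ {B = liftU (Dser t)} n (λ i i≤n → bexp-cong-≤ n (λ l l≤n → ih l (s≤s l≤n)) i i≤n) (λ _ _ _ → refl) m)
      (sym (Φ-solution n m)))

-- Isomorphisms of structures given by a parent map

-- One equation between parent maps composes and inverts more easily than conditions on adjacency;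
-- for labelled forests both notions coincide (`IsIso⇒Iso`, `Iso⇒IsIso`). The vertex types may
-- differ, so that labelled and plane forests can be compared.
record Iso {X Y : Set} (p : X → Maybe X) (q : Y → Maybe Y) (f : X → Y) : Set where
  field
    inj  : ∀ {x x′} → f x ≡ f x′ → x ≡ x′
    surj : ∀ y → ∃ λ x → f x ≡ y
    comm : ∀ x → q (f x) ≡ Maybe.map f (p x)

open Iso public

variable
  X Y Z X′ Y′ : Set
  p : X → Maybe X
  q : Y → Maybe Y
  r : Z → Maybe Z
  p′ : X′ → Maybe X′
  q′ : Y′ → Maybe Y′

Iso-id : Iso p p id
Iso-id {p = p} = record { inj = id ; surj = λ y → y , refl ; comm = λ x → sym (MaybeP.map-id (p x)) }

Iso-∘ : {f : X → Y} {g : Y → Z} → Iso q r g → Iso p q f → Iso p r (g ∘ f)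
Iso-∘ {p = p} {f = f} {g = g} G F = record
  { inj  = inj F ∘ inj G
  ; surj = λ z → let (y , gy) = surj G z ; (x , fx) = surj F y in x , trans (cong g fx) gy
  ; comm = λ x → trans (comm G (f x)) (trans (cong (Maybe.map g) (comm F x)) (sym (MaybeP.map-∘ (p x))))
  }

Iso-resp : {f g : X → Y} → f ≗ g → Iso p q f → Iso p q g
Iso-resp {p = p} {q = q} {f} {g} eq F = record
  { inj  = λ {x} {x′} e → inj F (trans (eq x) (trans e (sym (eq x′))))
  ; surj = λ y → let (x , fx) = surj F y in x , trans (sym (eq x)) fx
  ; comm = λ x → trans (cong q (sym (eq x))) (trans (comm F x) (MaybeP.map-cong eq (p x)))
  }

inverse : {f : X → Y} → Iso p q f → Y → X
inverse F y = proj₁ (surj F y)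

inverseʳ : {f : X → Y} (F : Iso p q f) → ∀ y → f (inverse F y) ≡ y
inverseʳ F y = proj₂ (surj F y)

inverseˡ : {f : X → Y} (F : Iso p q f) → ∀ x → inverse F (f x) ≡ x
inverseˡ {f = f} F x = inj F (inverseʳ F (f x))

Iso-inverse : {f : X → Y} (F : Iso p q f) → Iso q p (inverse F)
Iso-inverse {p = p} {q = q} {f = f} F = record
  { inj  = λ {y} {y′} e → trans (sym (inverseʳ F y)) (trans (cong f e) (inverseʳ F y′))
  ; surj = λ x → f x , inverseˡ F x
  ; comm = λ y → sym (trans (cong (Maybe.map (inverse F)) (trans (cong q (sym (inverseʳ F y))) (comm F (inverse F y))))
             (trans (sym (MaybeP.map-∘ (p (inverse F y)))) (trans (MaybeP.map-cong (inverseˡ F) (p (inverse F y)))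
               (MaybeP.map-id (p (inverse F y))))))
  }

-- Lists of all isomorphisms

Distinct : List (X → Y) → Set
Distinct = AllPairs (λ f g → ¬ f ≗ g)

-- Functions are identified pointwise, propositional equality being too fine for them without
-- extensionality.
record Enum {X Y : Set} (p : X → Maybe X) (q : Y → Maybe Y) (fs : List (X → Y)) : Set where
  field
    sound    : All (Iso p q) fs
    complete : ∀ {f} → Iso p q f → Any (f ≗_) fs
    distinct : Distinct fs

open Enum public

-- The map f ↦ j f i⁻¹ matches the two enumerations. The relation is written g i = j f to keep the
-- inverse out of the hypothesis on `h` and `k`.
∑-transport : {i : X → X′} {j : Y → Y′} → Iso p p′ i → Iso q q′ j →
              {fs : List (X → Y)} {gs : List (X′ → Y′)} → Enum p q fs → Enum p′ q′ gs →
              {h : (X → Y) → ℚ} {k : (X′ → Y′) → ℚ} →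
              (∀ f g → Iso p q f → (∀ x → g (i x) ≡ j (f x)) → h f ≡ k g) → ∑ fs h ≡ ∑ gs k
∑-transport {p = p} {q = q} {i = i} {j = j} I J {fs} {gs} F G eq = ∑-match
  (λ f g → Iso p q f × (∀ x → g (i x) ≡ j (f x))) fs gs
  (All.map (λ {f} If → Any.map (λ e → If , λ x → trans (sym (e (i x))) (cong (j ∘ f) (inverseˡ I x)))
                (complete G (Iso-∘ J (Iso-∘ If (Iso-inverse I))))) (sound F))
  (All.map (λ {g} Ig → Any.map (λ {f} e → Iso-resp e (Iso-∘ (Iso-inverse J) (Iso-∘ Ig I)) ,
                          λ x → trans (sym (inverseʳ J (g (i x)))) (cong j (e x)))
                (complete F (Iso-∘ (Iso-inverse J) (Iso-∘ Ig I)))) (sound G))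
  (AllPairs.map (λ f≠f′ g (_ , e) (_ , e′) → f≠f′ λ x → inj J (trans (sym (e x)) (e′ x))) (distinct F))
  (AllPairs.map (λ {g} {g′} g≠g′ f (_ , e) (_ , e′) → g≠g′ λ x → trans (cong g (sym (inverseʳ I x)))
      (trans (e (inverse I x)) (trans (sym (e′ (inverse I x))) (cong g′ (inverseʳ I x))))) (distinct G))
  (λ f g (If , e) → eq f g If e)

Any-filter : {P Q : S → Set} (Q? : ∀ x → Dec (Q x)) {xs : List S} → (∀ {x} → P x → Q x) →
             Any P xs → Any P (filter Q? xs)
Any-filter Q? {xs} f i with AnyP.filter⁺ Q? i
... | inj₁ j  = j
... | inj₂ ¬q = contradiction (f (AnyP.lookup-result i)) ¬q

Enum-filter : {Q : (X → Y) → Set} (Q? : ∀ f → Dec (Q f)) → (∀ {f} → Q f → Iso p q f) → (∀ {f} → Iso p q f → Q f) →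
              {fs : List (X → Y)} → (∀ f → Any (f ≗_) fs) → Distinct fs → Enum p q (filter Q? fs)
Enum-filter Q? to from {fs} comp dist = record
  { sound    = All.map to (AllP.all-filter Q? fs)
  ; complete = λ {f} F → Any-filter Q? (λ eq → from (Iso-resp eq F)) (comp f)
  ; distinct = AllPairsP.filter⁺ Q? dist
  }

-- `cons` is a variable characterised by two equations because the function of that name in `maps`
-- is local there.
cons-complete : ∀ {n k} (cons : Fin n → (Fin k → Fin n) → Fin (suc k) → Fin n) →
                (∀ i f → cons i f fzero ≡ i) → (∀ i f j → cons i f (fsuc j) ≡ f j) →
                ∀ fs → (∀ g → Any (g ≗_) fs) →
                ∀ f → Any (f ≗_) (concatMap (λ i → map (cons i) fs) (allFin n))
cons-complete cons eq₀ eqₛ fs comp f = AnyP.concatMap⁺ (λ i → map (cons i) fs) (AnyP.tabulate⁺ (f fzero)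
  (AnyP.map⁺ (Any.map (λ {g} e → λ { fzero → sym (eq₀ (f fzero) g) ; (fsuc j) → trans (e j) (sym (eqₛ (f fzero) g j)) })
    (comp (f ∘ fsuc)))))

cons-distinct : ∀ {n k} (cons : Fin n → (Fin k → Fin n) → Fin (suc k) → Fin n) →
                (∀ i f → cons i f fzero ≡ i) → (∀ i f j → cons i f (fsuc j) ≡ f j) →
                ∀ fs → Distinct fs → Distinct (concatMap (λ i → map (cons i) fs) (allFin n))
cons-distinct cons eq₀ eqₛ fs dist = AllPairsP.concat⁺
  (AllP.map⁺ (AllP.tabulate⁺ λ i → AllPairsP.map⁺ (AllPairs.map (λ {f} {g} f≠g e → f≠g λ j →
    trans (sym (eqₛ i f j)) (trans (e (fsuc j)) (eqₛ i g j))) dist)))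
  (AllPairsP.map⁺ (AllPairsP.tabulate⁺ λ {i} {j} i≢j → AllP.map⁺ (All.universal (λ f → AllP.map⁺
    (All.universal (λ g e → i≢j (trans (sym (eq₀ i f)) (trans (e fzero) (eq₀ j g)))) fs)) fs)))

maps-complete : ∀ n k f → Any (f ≗_) (maps n k)
maps-complete n zero    f = here λ ()
maps-complete n (suc k) f = cons-complete _ (λ _ _ → refl) (λ _ _ _ → refl) (maps n k) (maps-complete n k) f

maps-distinct : ∀ n k → Distinct (maps n k)
maps-distinct n zero    = [] ∷ []
maps-distinct n (suc k) = cons-distinct _ (λ _ _ → refl) (λ _ _ _ → refl) (maps n k) (maps-distinct n k)

-- Plane forests: a ◃ s is a first tree, whose root carries the forest a, followed by the forest s.

infixr 5 _◃_
data Forest : Set where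
  ∅   : Forest
  _◃_ : Forest → Forest → Forest

variable
  F G a b s t : Forest

size : Forest → ℕ
size ∅       = 0
size (a ◃ s) = suc (size a ℕ.+ size s)

len : Forest → ℕ
len ∅       = 0
len (a ◃ s) = suc (len s)

data V : Forest → Set where
  root : V (a ◃ s)
  down : V a → V (a ◃ s)
  next : V s → V (a ◃ s)

par : V F → Maybe (V F)
par root     = nothing
par (down x) = just (maybe′ down root (par x))
par (next y) = Maybe.map next (par y)

down-injective : {x y : V a} → down {s = s} x ≡ down y → x ≡ y
down-injective refl = refl

next-injective : {x y : V s} → next {a = a} x ≡ next y → x ≡ y
next-injective refl = refl

infix 4 _≟ⱽ_
_≟ⱽ_ : (x y : V F) → Dec (x ≡ y)
root   ≟ⱽ root   = yes refl
root   ≟ⱽ down y = no λ ()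
root   ≟ⱽ next y = no λ ()
down x ≟ⱽ root   = no λ ()
down x ≟ⱽ down y = map′ (cong down) down-injective (x ≟ⱽ y)
down x ≟ⱽ next y = no λ ()
next x ≟ⱽ root   = no λ ()
next x ≟ⱽ down y = no λ ()
next x ≟ⱽ next y = map′ (cong next) next-injective (x ≟ⱽ y)

verts : ∀ F → List (V F)
verts ∅       = []
verts (a ◃ s) = root ∷ map down (verts a) ++ map next (verts s)

verts-complete : (v : V F) → v ∈ verts F
verts-complete root                 = here refl
verts-complete (down x)             = there (AnyP.++⁺ˡ (AnyP.map⁺ (Any.map (cong down) (verts-complete x))))
verts-complete {F = a ◃ s} (next y) = there (AnyP.++⁺ʳ (map down (verts a))
  (AnyP.map⁺ (Any.map (cong next) (verts-complete y))))

verts-distinct : ∀ F → AllPairs _≢_ (verts F)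
verts-distinct ∅       = []
verts-distinct (a ◃ s) =
  AllP.++⁺ (AllP.map⁺ (All.universal (λ _ ()) (verts a))) (AllP.map⁺ (All.universal (λ _ ()) (verts s))) ∷
  AllPairsP.++⁺ (AllPairsP.map⁺ (AllPairs.map (_∘ down-injective) (verts-distinct a)))
                (AllPairsP.map⁺ (AllPairs.map (_∘ next-injective) (verts-distinct s)))
                (AllP.map⁺ (All.universal (λ _ → AllP.map⁺ (All.universal (λ _ ()) (verts s))) (verts a)))

allV? : {P : V F → Set} → (∀ v → Dec (P v)) → Dec (∀ v → P v)
allV? {F} P? = map′ (λ all v → All.lookup all (verts-complete v)) (λ f → All.universal f (verts F)) (All.all? P? (verts F))

anyV? : {P : V F → Set} → (∀ v → Dec (P v)) → Dec (∃ P)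
anyV? {F} P? = map′ Any.satisfied (λ (v , pv) → Any.map (λ { refl → pv }) (verts-complete v)) (Any.any? P? (verts F))

Isoⱽ : (F G : Forest) → (V F → V G) → Set
Isoⱽ F G = Iso (par {F}) (par {G})

Isoⱽ? : (f : V F → V G) → Dec (Isoⱽ F G f)
Isoⱽ? {F} {G} f = map′
  (λ (i , s , c) → record { inj = λ {x} {x′} → i x x′ ; surj = s ; comm = c })
  (λ I → (λ x x′ → inj I) , surj I , comm I)
  ((allV? λ x → allV? λ x′ → (f x ≟ⱽ f x′) →-dec (x ≟ⱽ x′))
   ×-dec (allV? λ y → anyV? λ x → f x ≟ⱽ y)
   ×-dec (allV? λ x → MaybeP.≡-dec _≟ⱽ_ (par (f x)) (Maybe.map f (par x))))

toFin : V F → Fin (size F)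
toFin root                 = fzero
toFin {a ◃ s} (down x)     = fsuc (toFin x Fin.↑ˡ size s)
toFin {a ◃ s} (next y)     = fsuc (size a Fin.↑ʳ toFin y)

fromFin : ∀ {F} → Fin (size F) → V F
fromFin {a ◃ s} fzero    = root
fromFin {a ◃ s} (fsuc i) = Sum.[ down ∘ fromFin , next ∘ fromFin ]′ (Fin.splitAt (size a) i)

fromFin-toFin : (v : V F) → fromFin (toFin v) ≡ v
fromFin-toFin root = refl
fromFin-toFin {a ◃ s} (down x) rewrite FinP.splitAt-↑ˡ (size a) (toFin x) (size s) = cong down (fromFin-toFin x)
fromFin-toFin {a ◃ s} (next y) rewrite FinP.splitAt-↑ʳ (size a) (size s) (toFin y) = cong next (fromFin-toFin y)

toFin-fromFin : ∀ {F} (i : Fin (size F)) → toFin (fromFin {F} i) ≡ i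
toFin-fromFin {a ◃ s} fzero    = refl
toFin-fromFin {a ◃ s} (fsuc i) = trans (go (Fin.splitAt (size a) i)) (cong fsuc (FinP.join-splitAt (size a) (size s) i))
  where
  go : ∀ x → toFin {a ◃ s} (Sum.[ down ∘ fromFin , next ∘ fromFin ]′ x) ≡ fsuc (Fin.join (size a) (size s) x)
  go (inj₁ j) = cong (λ k → fsuc (k Fin.↑ˡ size s)) (toFin-fromFin j)
  go (inj₂ j) = cong (λ k → fsuc (size a Fin.↑ʳ k)) (toFin-fromFin j)

toFin-injective : {x y : V F} → toFin x ≡ toFin y → x ≡ y
toFin-injective {x = x} {y} e = trans (sym (fromFin-toFin x)) (trans (cong fromFin e) (fromFin-toFin y))

fromFin-injective : ∀ {F} {i j : Fin (size F)} → fromFin {F} i ≡ fromFin j → i ≡ j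
fromFin-injective {i = i} {j} e = trans (sym (toFin-fromFin i)) (trans (cong toFin e) (toFin-fromFin j))

opaque
  -- Brute force over all maps between the vertex sets; afterwards everything goes through
  -- `isos-enum` and `∑-isos-∅`.
  isos : ∀ F G → List (V F → V G)
  isos F G = filter Isoⱽ? (map (λ h → fromFin ∘ h ∘ toFin) (maps (size G) (size F)))

  isos-enum : ∀ F G → Enum (par {F}) (par {G}) (isos F G)
  isos-enum F G = Enum-filter Isoⱽ? id id
    (λ f → AnyP.map⁺ (Any.map (λ e v → trans (sym (fromFin-toFin (f v)))
       (cong fromFin (trans (cong (toFin ∘ f) (sym (fromFin-toFin v))) (e (toFin v)))))
       (maps-complete (size G) (size F) (toFin ∘ f ∘ fromFin))))
    (AllPairsP.map⁺ (AllPairs.map (λ {f} {g} f≠g e → f≠g λ i → trans (cong f (sym (toFin-fromFin i)))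
       (trans (fromFin-injective (e (fromFin i))) (cong g (toFin-fromFin i)))) (maps-distinct (size G) (size F))))

  ∑-isos-∅ : ∀ x → ∑ (isos ∅ ∅) (λ _ → x) ≡ x
  ∑-isos-∅ x = ℚP.+-identityʳ x

-- Induction from the roots downwards: isomorphisms are given by their compatibility with parents,
-- so their properties spread in this direction.
par-induction : (Q : V F → Set) → (∀ x → (∀ y → par x ≡ just y → Q y) → Q x) → ∀ x → Q x
par-induction Q step root     = step root λ y ()
par-induction Q step (down x) = par-induction (Q ∘ down) (λ x ih → step (down x) (at x ih)) x
  where
  at : ∀ x → (∀ y → par x ≡ just y → Q (down y)) → ∀ y → just (maybe′ down root (par x)) ≡ just y → Q y
  at x ih y e with par x
  at x ih y refl | nothing = step root λ y ()
  at x ih y refl | just z  = ih z refl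
par-induction Q step (next x) = par-induction (Q ∘ next) (λ x ih → step (next x) (at x ih)) x
  where
  at : ∀ x → (∀ y → par x ≡ just y → Q (next y)) → ∀ y → Maybe.map next (par x) ≡ just y → Q y
  at x ih y e with par x
  at x ih y refl | just z = ih z refl

top : V F → V F
top root     = root
top (down x) = root
top (next y) = next (top y)

top-par : (x y : V F) → par x ≡ just y → top x ≡ top y
top-par (down x) y e with par x
top-par (down x) y refl | nothing = refl
top-par (down x) y refl | just z  = refl
top-par (next x) y e with par x in eq
top-par (next x) y refl | just z = cong next (top-par x z eq)

top-root : (x : V F) → par x ≡ nothing → top x ≡ x
top-root root     _ = refl
top-root (next x) e with par x in eq
top-root (next x) e | nothing = cong next (top-root x eq)

-- `top` is constant along edges and the identity on roots, and `f` preserves edges and roots.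
top-iso : {f : V F → V G} → Isoⱽ F G f → ∀ x → top (f x) ≡ f (top x)
top-iso {F = F} {f = f} I = par-induction (λ x → top (f x) ≡ f (top x)) step
  where
  step : ∀ x → (∀ y → par x ≡ just y → top (f y) ≡ f (top y)) → top (f x) ≡ f (top x)
  step x ih with par x in eq
  ... | nothing = trans (top-root (f x) (trans (comm I x) (cong (Maybe.map f) eq))) (cong f (sym (top-root x eq)))
  ... | just y  = trans (top-par (f x) (f y) (trans (comm I x) (cong (Maybe.map f) eq)))
                        (trans (ih y refl) (cong f (sym (top-par x y eq))))

join : (V a → V b) → (V s → V t) → V (a ◃ s) → V (b ◃ t)
join α β root     = root
join α β (down x) = down (α x)
join α β (next y) = next (β y)

join-iso : {α : V a → V b} {β : V s → V t} → Isoⱽ a b α → Isoⱽ s t β → Isoⱽ (a ◃ s) (b ◃ t) (join α β)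
join-iso {a} {b} {s} {t} {α} {β} I J = record { inj = λ {x} {x′} → i x x′ ; surj = sj ; comm = cm }
  where
  i : ∀ x x′ → join α β x ≡ join α β x′ → x ≡ x′
  i root     root      e = refl
  i (down x) (down x′) e = cong down (inj I (down-injective e))
  i (next x) (next x′) e = cong next (inj J (next-injective e))
  sj : ∀ y → ∃ λ x → join α β x ≡ y
  sj root     = root , refl
  sj (down y) = let (x , e) = surj I y in down x , cong down e
  sj (next y) = let (x , e) = surj J y in next x , cong next e
  cm : ∀ x → par (join α β x) ≡ Maybe.map (join α β) (par x)
  cm root = refl
  cm (down x) = cong just (trans (cong (maybe′ down root) (comm I x)) (lem (par x)))
    where
    lem : ∀ m → maybe′ down root (Maybe.map α m) ≡ join α β (maybe′ down root m)
    lem nothing  = refl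
    lem (just _) = refl
  cm (next x) = trans (cong (Maybe.map next) (comm J x)) (lem (par x))
    where
    lem : ∀ m → Maybe.map next (Maybe.map β m) ≡ Maybe.map (join α β) (Maybe.map next m)
    lem nothing  = refl
    lem (just _) = refl

-- Since ψ commutes with `top` and preserves the first root, it takes the first tree to the first
-- tree and the other trees to the other trees.
unjoin : {ψ : V (a ◃ s) → V (b ◃ t)} → Isoⱽ (a ◃ s) (b ◃ t) ψ → ψ root ≡ root →
         ∃ λ α → ∃ λ β → Isoⱽ a b α × Isoⱽ s t β × ψ ≗ join α β
unjoin {a} {s} {b} {t} {ψ} I ψr = α , β , Iα , Iβ , ψ-join
  where
  ψ-down : ∀ x → ∃ λ y → ψ (down x) ≡ down y
  ψ-down x with ψ (down x) in eq | top-iso I (down x)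
  ... | root   | _ with () ← inj I (trans eq (sym ψr))
  ... | down y | _ = y , refl
  ... | next y | e with () ← trans e ψr
  ψ-next : ∀ x → ∃ λ y → ψ (next x) ≡ next y
  ψ-next x with ψ (next x) in eq | top-iso I (next x)
  ... | root   | e with () ← inj I (trans (sym e) (sym ψr))
  ... | down y | e with () ← inj I (trans (sym e) (sym ψr))
  ... | next y | _ = y , refl
  α : V a → V b
  α x = proj₁ (ψ-down x)
  β : V s → V t
  β x = proj₁ (ψ-next x)
  ψ-join : ψ ≗ join α β
  ψ-join root     = ψr
  ψ-join (down x) = proj₂ (ψ-down x)
  ψ-join (next x) = proj₂ (ψ-next x)
  J : Isoⱽ (a ◃ s) (b ◃ t) (join α β)
  J = Iso-resp ψ-join I
  Iα : Isoⱽ a b α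
  Iα = record
    { inj  = λ e → down-injective (inj J (cong down e))
    ; surj = λ y → sj y (surj J (down y))
    ; comm = λ x → lem (par (α x)) (par x) (MaybeP.just-injective (comm J (down x)))
    }
    where
    sj : ∀ y → (∃ λ x → join α β x ≡ down y) → ∃ λ x → α x ≡ y
    sj y (down x , e) = x , down-injective e
    lem : ∀ m n → maybe′ down root m ≡ join α β (maybe′ down root n) → m ≡ Maybe.map α n
    lem nothing  nothing  e = refl
    lem (just x) (just y) e = cong just (down-injective e)
  Iβ : Isoⱽ s t β
  Iβ = record
    { inj  = λ e → next-injective (inj J (cong next e))
    ; surj = λ y → sj y (surj J (next y))
    ; comm = λ x → lem (par (β x)) (par x) (comm J (next x))
    }
    where
    sj : ∀ y → (∃ λ x → join α β x ≡ next y) → ∃ λ x → β x ≡ y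
    sj y (next x , e) = x , next-injective e
    lem : ∀ m n → Maybe.map next m ≡ Maybe.map (join α β) (Maybe.map next n) → m ≡ Maybe.map β n
    lem nothing  nothing  e = refl
    lem (just x) (just y) e = cong just (next-injective (MaybeP.just-injective e))

-- Removing a tree from a plane forest

-- Pick F a s: removing one tree, with root forest a, from F leaves s.
data Pick : Forest → Forest → Forest → Set where
  here  : Pick (a ◃ s) a s
  there : Pick s b t → Pick (a ◃ s) b (a ◃ t)

emb : Pick F a s → V (a ◃ s) → V F
emb here      v               = v
emb (there π) root            = next (emb π root)
emb (there π) (down x)        = next (emb π (down x))
emb (there π) (next root)     = root
emb (there π) (next (down x)) = down x
emb (there π) (next (next y)) = next (emb π (next y))

private
  swap : V (a ◃ b ◃ s) → V (b ◃ a ◃ s)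
  swap root            = next root
  swap (down x)        = next (down x)
  swap (next root)     = root
  swap (next (down x)) = down x
  swap (next (next y)) = next (next y)

  swap-swap : (x : V (a ◃ b ◃ s)) → swap (swap x) ≡ x
  swap-swap root            = refl
  swap-swap (down x)        = refl
  swap-swap (next root)     = refl
  swap-swap (next (down x)) = refl
  swap-swap (next (next y)) = refl

  swap-iso : Isoⱽ (a ◃ b ◃ s) (b ◃ a ◃ s) swap
  swap-iso = record
    { inj  = λ {x} {x′} e → trans (sym (swap-swap x)) (trans (cong swap e) (swap-swap x′))
    ; surj = λ y → swap y , swap-swap y
    ; comm = cm
    }
    where
    cm : ∀ x → par (swap x) ≡ Maybe.map swap (par x)
    cm root = refl
    cm (down x) with par x
    ... | nothing = refl
    ... | just _  = refl
    cm (next root) = refl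
    cm (next (down x)) with par x
    ... | nothing = refl
    ... | just _  = refl
    cm (next (next y)) with par y
    ... | nothing = refl
    ... | just _  = refl

emb-there : (π : Pick s b t) → join id (emb π) ∘ swap ≗ emb (there {a = a} π)
emb-there π root            = refl
emb-there π (down x)        = refl
emb-there π (next root)     = refl
emb-there π (next (down x)) = refl
emb-there π (next (next y)) = refl

-- The picked tree is brought to the front by exchanging neighbouring trees, one `swap` for each
-- `there`.
emb-iso : (π : Pick F a s) → Isoⱽ (a ◃ s) F (emb π)
emb-iso here      = Iso-id
emb-iso (there π) = Iso-resp (emb-there π) (Iso-∘ (join-iso Iso-id (emb-iso π)) swap-iso)

Picks : Forest → Set
Picks F = ∃ λ a → ∃ λ s → Pick F a s

picks : ∀ F → List (Picks F)
picks ∅       = []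
picks (a ◃ s) = (a , s , here) ∷ map (λ (b , t , π) → b , a ◃ t , there π) (picks s)

∑-verts : (f : V (a ◃ s) → ℚ) → ∑ (verts (a ◃ s)) f ≡ f root + ∑ (verts a) (f ∘ down) + ∑ (verts s) (f ∘ next)
∑-verts {a} {s} f = trans (cong (f root +_) (trans (∑-++ (map down (verts a)) (map next (verts s)) f)
  (cong₂ _+_ (∑-map down (verts a) f) (∑-map next (verts s) f))))
  (sym (ℚP.+-assoc (f root) (∑ (verts a) (f ∘ down)) (∑ (verts s) (f ∘ next))))

∑-verts-emb : (π : Pick F a s) (f : V F → ℚ) → ∑ (verts F) f ≡ ∑ (verts (a ◃ s)) (f ∘ emb π)
∑-verts-emb here f = refl
∑-verts-emb {F = b ◃ F′} {a} {.(b ◃ s)} (there {t = s} π) f = begin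
  ∑ (verts (b ◃ F′)) f
    ≡⟨ ∑-verts f ⟩
  f root + ∑ (verts b) (f ∘ down) + ∑ (verts F′) (f ∘ next)
    ≡⟨ cong (λ x → f root + ∑ (verts b) (f ∘ down) + x) (trans (∑-verts-emb π (f ∘ next)) (∑-verts (f ∘ next ∘ emb π))) ⟩
  f root + ∑ (verts b) (f ∘ down) + (g root + ∑ (verts a) (g ∘ down) + ∑ (verts s) (g ∘ next ∘ next))
    ≡⟨ solve 5 (λ x y u v w → x :+ y :+ (u :+ v :+ w) := u :+ v :+ (x :+ y :+ w)) refl
         (f root) (∑ (verts b) (f ∘ down)) (g root) (∑ (verts a) (g ∘ down)) (∑ (verts s) (g ∘ next ∘ next)) ⟩
  g root + ∑ (verts a) (g ∘ down) + (f root + ∑ (verts b) (f ∘ down) + ∑ (verts s) (g ∘ next ∘ next))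
    ≡⟨ cong (g root + ∑ (verts a) (g ∘ down) +_) (∑-verts (g ∘ next)) ⟨
  g root + ∑ (verts a) (g ∘ down) + ∑ (verts (b ◃ s)) (g ∘ next)
    ≡⟨ ∑-verts g ⟨
  ∑ (verts (a ◃ b ◃ s)) g ∎
  where
  open ≡-Reasoning
  open +-*-Solver
  g : V (a ◃ b ◃ s) → ℚ
  g = f ∘ emb (there π)

∑-picks : (f : Picks (a ◃ s) → ℚ) →
  ∑ (picks (a ◃ s)) f ≡ f (a , s , here) + ∑ (picks s) (λ (b , t , π) → f (b , a ◃ t , there π))
∑-picks {a} {s} f = cong (f (a , s , here) +_) (∑-map _ (picks s) f)

-- There is one pick for each tree of `F`, and each vertex lies in exactly one tree, either as its
-- root or below it.
∑-verts-picks : ∀ F (f : V F → ℚ) →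
  ∑ (verts F) f ≡ ∑ (picks F) (λ (a , s , π) → f (emb π root) + ∑ (verts a) (f ∘ emb π ∘ down))
∑-verts-picks ∅       f = refl
∑-verts-picks (a ◃ s) f = trans (∑-verts f) (trans
  (cong (f root + ∑ (verts a) (f ∘ down) +_) (∑-verts-picks s (f ∘ next)))
  (sym (∑-picks {a} {s} (λ (a , s , π) → f (emb π root) + ∑ (verts a) (f ∘ emb π ∘ down)))))

-- Serves to sort isomorphisms by the tree to which they send a given root: exactly one indicator is
-- 1.
∑-picks-root : (v : V F) → par v ≡ nothing → ∑ (picks F) (λ (a , s , π) → ind (v ≟ⱽ emb π root)) ≡ 1ℚ
∑-picks-root {a ◃ s} root e = trans (∑-picks {a} {s} (λ (a , s , π) → ind (root ≟ⱽ emb π root)))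
  (trans (cong (1ℚ +_) (∑-zero (picks s) λ _ → refl)) (ℚP.+-identityʳ 1ℚ))
∑-picks-root {a ◃ s} (next v) e with par v in eq
... | nothing = trans (∑-picks {a} {s} (λ (a , s , π) → ind (next v ≟ⱽ emb π root)))
  (trans (ℚP.+-identityˡ _) (trans (∑-cong (picks s) λ (_ , _ , π) →
    ind-iff (next {a = a} v ≟ⱽ next (emb π root)) (v ≟ⱽ emb π root) next-injective (cong next)) (∑-picks-root v eq)))

cartesian-distinct : {fs : List (X → Y)} {gs : List (X′ → Y′)} → Distinct fs → Distinct gs →
  AllPairs (λ (α , β) (α′ , β′) → ¬ (α ≗ α′ × β ≗ β′)) (cartesianProduct fs gs)
cartesian-distinct [] _ = []
cartesian-distinct {gs = gs} (f≠ ∷ fs≠) gs≠ = AllPairsP.++⁺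
  (AllPairsP.map⁺ (AllPairs.map (λ g≠g′ (_ , e) → g≠g′ e) gs≠))
  (cartesian-distinct fs≠ gs≠)
  (AllP.map⁺ (All.universal (λ _ → All.tabulate λ {x} x∈ (e , _) →
     All.lookup f≠ (proj₁ (∈P.∈-cartesianProduct⁻ _ gs x∈)) e) gs))

-- Isomorphisms that send the one picked tree to the other correspond to pairs of isomorphisms a → b
-- and s → t, by `unjoin` in one direction and `join-iso` in the other.
∑-split : (π : Pick F a s) (ρ : Pick G b t)
  {h : (V F → V G) → ℚ} {k : (V a → V b) → (V s → V t) → ℚ} →
  (∀ φ α β → (∀ v → φ (emb π v) ≡ emb ρ (join α β v)) → h φ ≡ k α β) →
  ∑ (isos F G) (λ φ → ind (φ (emb π root) ≟ⱽ emb ρ root) * h φ) ≡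
  ∑ (isos a b) (λ α → ∑ (isos s t) (k α))
∑-split {F} {a} {s} {G} {b} {t} π ρ {h} {k} eq = trans (sym (∑-filter root? (isos F G) h)) (trans
  (∑-match R (filter root? (isos F G)) (cartesianProduct (isos a b) (isos s t))
    (All.map to (All.zip (AllP.all-filter root? (isos F G) , AllP.filter⁺ root? (sound (isos-enum F G)))))
    (All.tabulate λ {(α , β)} αβ∈ → let (α∈ , β∈) = ∈P.∈-cartesianProduct⁻ (isos a b) (isos s t) αβ∈ in
       from (All.lookup (sound (isos-enum a b)) α∈) (All.lookup (sound (isos-enum s t)) β∈))
    (AllPairs.map distinct₁ (AllPairsP.filter⁺ root? (distinct (isos-enum F G))))
    (AllPairs.map distinct₂ (cartesian-distinct (distinct (isos-enum a b)) (distinct (isos-enum s t))))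
    λ φ (α , β) → eq φ α β)
  (∑-cartesian (isos a b) (isos s t) (uncurry k)))
  where
  root? : ∀ φ → Dec (φ (emb π root) ≡ emb ρ root)
  root? φ = φ (emb π root) ≟ⱽ emb ρ root

  R : (V F → V G) → (V a → V b) × (V s → V t) → Set
  R φ (α , β) = ∀ v → φ (emb π v) ≡ emb ρ (join α β v)

  to : ∀ {φ} → φ (emb π root) ≡ emb ρ root × Isoⱽ F G φ → Any (R φ) (cartesianProduct (isos a b) (isos s t))
  to {φ} (φr , Iφ) with unjoin (Iso-∘ (Iso-inverse (emb-iso ρ)) (Iso-∘ Iφ (emb-iso π)))
                          (trans (cong (inverse (emb-iso ρ)) φr) (inverseˡ (emb-iso ρ) root))
  ... | α , β , Iα , Iβ , e = Any.map rel (AnyP.cartesianProduct⁺ (complete (isos-enum a b) Iα) (complete (isos-enum s t) Iβ))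
    where
    rel : ∀ {αβ} → (α ≗ proj₁ αβ) × (β ≗ proj₂ αβ) → R φ αβ
    rel {α′ , β′} (eα , eβ) v = trans (sym (inverseʳ (emb-iso ρ) (φ (emb π v))))
      (cong (emb ρ) (trans (e v) (join-cong v)))
      where
      join-cong : ∀ v → join α β v ≡ join α′ β′ v
      join-cong root     = refl
      join-cong (down x) = cong down (eα x)
      join-cong (next x) = cong next (eβ x)

  from : ∀ {α β} → Isoⱽ a b α → Isoⱽ s t β → Any (λ φ → R φ (α , β)) (filter root? (isos F G))
  from {α} {β} Iα Iβ = Any.map rel (Any-filter root? (λ e → trans (sym (e (emb π root)))
      (cong (emb ρ ∘ join α β) (inverseˡ (emb-iso π) root)))
    (complete (isos-enum F G) (Iso-∘ (Iso-∘ (emb-iso ρ) (join-iso Iα Iβ)) (Iso-inverse (emb-iso π)))))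
    where
    rel : ∀ {φ} → (emb ρ ∘ join α β ∘ inverse (emb-iso π)) ≗ φ → R φ (α , β)
    rel e v = trans (sym (e (emb π v))) (cong (emb ρ ∘ join α β) (inverseˡ (emb-iso π) v))

  distinct₁ : ∀ {φ φ′} → ¬ φ ≗ φ′ → ∀ αβ → R φ αβ → ¬ R φ′ αβ
  distinct₁ {φ} {φ′} φ≠φ′ (α , β) e e′ = φ≠φ′ λ v → trans (cong φ (sym (inverseʳ (emb-iso π) v)))
    (trans (e (inverse (emb-iso π) v)) (trans (sym (e′ (inverse (emb-iso π) v)))
      (cong φ′ (inverseʳ (emb-iso π) v))))

  distinct₂ : ∀ {αβ αβ′} → ¬ (proj₁ αβ ≗ proj₁ αβ′ × proj₂ αβ ≗ proj₂ αβ′) → ∀ φ → R φ αβ → ¬ R φ αβ′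
  distinct₂ ≠ φ e e′ = ≠
    ( (λ x → down-injective (inj (emb-iso ρ) (trans (sym (e (down x))) (e′ (down x)))))
    , (λ x → next-injective (inj (emb-iso ρ) (trans (sym (e (next x))) (e′ (next x))))))

N : Forest → Forest → ℕ
N F G = length (isos F G)

c-N : ∀ F G → c (N F G) ≡ ∑ (isos F G) (λ _ → 1ℚ)
c-N F G = c-length (isos F G)

-- Sort the isomorphisms by the tree of `G` that receives the first tree.
N-◃ : ∀ a s G → c (N (a ◃ s) G) ≡ ∑ (picks G) (λ (b , t , _) → c (N a b) * c (N s t))
N-◃ a s G = begin
  c (N (a ◃ s) G)
    ≡⟨ c-N (a ◃ s) G ⟩
  ∑ (isos (a ◃ s) G) (λ _ → 1ℚ)
    ≡⟨ ∑-All (All.map (λ {φ} I → sym (∑-picks-root (φ root) (comm I root))) (sound (isos-enum (a ◃ s) G))) ⟩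
  ∑ (isos (a ◃ s) G) (λ φ → ∑ (picks G) λ (b , t , ρ) → ind (φ root ≟ⱽ emb ρ root))
    ≡⟨ ∑-swap (isos (a ◃ s) G) (picks G) _ ⟩
  ∑ (picks G) (λ (b , t , ρ) → ∑ (isos (a ◃ s) G) λ φ → ind (φ root ≟ⱽ emb ρ root))
    ≡⟨ ∑-cong (picks G) (λ (b , t , ρ) → trans
         (∑-cong (isos (a ◃ s) G) λ φ → sym (ℚP.*-identityʳ (ind (φ root ≟ⱽ emb ρ root))))
         (trans (∑-split (here {a} {s}) ρ {λ _ → 1ℚ} {λ _ _ → 1ℚ * 1ℚ} (λ _ _ _ _ → refl))
           (trans (∑-* (isos a b) (isos s t) (λ _ → 1ℚ) (λ _ → 1ℚ))
             (cong₂ _*_ (sym (c-N a b)) (sym (c-N s t)))))) ⟩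
  ∑ (picks G) (λ (b , t , _) → c (N a b) * c (N s t)) ∎
  where open ≡-Reasoning

-- Counting automorphisms by fixed vertices

fix : (V F → V F) → ℕ
fix {F} φ = length (filter (λ v → φ v ≟ⱽ v) (verts F))

c-fix : (φ : V F → V F) → c (fix φ) ≡ ∑ (verts F) (λ v → ind (φ v ≟ⱽ v))
c-fix {F} φ = c-count (λ v → φ v ≟ⱽ v) (verts F)

module _ (π : Pick F a s) (φ : V F → V F) (α : V a → V a) (β : V s → V s)
         (e : ∀ v → φ (emb π v) ≡ emb π (join α β v)) where

  fix-emb : ∀ v → ind (φ (emb π v) ≟ⱽ emb π v) ≡ ind (join α β v ≟ⱽ v)
  fix-emb v = ind-iff (φ (emb π v) ≟ⱽ emb π v) (join α β v ≟ⱽ v)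
    (λ fx → inj (emb-iso π) (trans (sym (e v)) fx)) (λ jv → trans (e v) (cong (emb π) jv))

  fix-down : ∑ (verts a) (λ x → ind (φ (emb π (down x)) ≟ⱽ emb π (down x))) ≡ c (fix α)
  fix-down = trans (∑-cong (verts a) λ x → trans (fix-emb (down x))
    (ind-iff (down {s = s} (α x) ≟ⱽ down x) (α x ≟ⱽ x) down-injective (cong down))) (sym (c-fix α))

  fix-join : fix φ ≡ suc (fix α ℕ.+ fix β)
  fix-join = c-injective (begin
    c (fix φ)
      ≡⟨ trans (c-fix φ) (trans (∑-verts-emb π _) (trans (∑-cong (verts (a ◃ s)) fix-emb) (∑-verts (λ v → ind (join α β v ≟ⱽ v))))) ⟩
    1ℚ + ∑ (verts a) (λ x → ind (down {s = s} (α x) ≟ⱽ down x)) + ∑ (verts s) (λ x → ind (next {a = a} (β x) ≟ⱽ next x))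
      ≡⟨ cong₂ (λ x y → 1ℚ + x + y)
           (trans (∑-cong (verts a) λ x → ind-iff (down {s = s} (α x) ≟ⱽ down x) (α x ≟ⱽ x) down-injective (cong down)) (sym (c-fix α)))
           (trans (∑-cong (verts s) λ x → ind-iff (next {a = a} (β x) ≟ⱽ next x) (β x ≟ⱽ x) next-injective (cong next)) (sym (c-fix β))) ⟩
    1ℚ + c (fix α) + c (fix β)
      ≡⟨ trans (ℚP.+-assoc 1ℚ (c (fix α)) (c (fix β))) (trans (cong (1ℚ +_) (sym (c-+ (fix α) (fix β))))
           (sym (c-suc (fix α ℕ.+ fix β)))) ⟩
    c (suc (fix α ℕ.+ fix β)) ∎)
    where open ≡-Reasoning

aut : Forest → ℕ → ℚ
aut F m = ∑ (isos F F) (λ σ → ind (fix σ ℕ.≟ m))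

-- The analogue of `aut` for the tree whose root carries `a`. The root is always fixed, whence the
-- successor; see `aut-tree`.
treeAut : Forest → ℕ → ℚ
treeAut a i = ∑ (isos a a) (λ α → ind (suc (fix α) ℕ.≟ i))

-- Sorting pairs by the value i of `g` turns the sum into a convolution. It is applied to the
-- exponent of u with automorphisms and to the exponent of z with forests.
∑-conv : (xs : List S) (ys : List T) (g : S → ℕ) (h : T → ℕ) (G : S → ℚ) (H : T → ℚ) (n : ℕ) →
  ∑ xs (λ x → ∑ ys λ y → ind (g x ℕ.+ h y ℕ.≟ n) * (G x * H y)) ≡
  mul (λ i → ∑ xs λ x → ind (g x ℕ.≟ i) * G x) (λ j → ∑ ys λ y → ind (h y ℕ.≟ j) * H y) n
∑-conv xs ys g h G H n = begin
  ∑ xs (λ x → ∑ ys λ y → ind (g x ℕ.+ h y ℕ.≟ n) * (G x * H y))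
    ≡⟨ ∑-cong xs (λ x → ∑-cong ys λ y → term x y) ⟩
  ∑ xs (λ x → ∑ ys λ y → Σ< (suc n) λ i → ind (g x ℕ.≟ i) * G x * (ind (h y ℕ.≟ n ∸ i) * H y))
    ≡⟨ trans (∑-cong xs λ x → ∑-Σ<-swap ys (suc n) _) (∑-Σ<-swap xs (suc n) _) ⟩
  (Σ< (suc n) λ i → ∑ xs λ x → ∑ ys λ y → ind (g x ℕ.≟ i) * G x * (ind (h y ℕ.≟ n ∸ i) * H y))
    ≡⟨ (Σ<-ext (suc n) λ i → ∑-* xs ys (λ x → ind (g x ℕ.≟ i) * G x) (λ y → ind (h y ℕ.≟ n ∸ i) * H y)) ⟩
  mul (λ i → ∑ xs λ x → ind (g x ℕ.≟ i) * G x) (λ j → ∑ ys λ y → ind (h y ℕ.≟ j) * H y) n ∎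
  where
  open ≡-Reasoning
  open +-*-Solver
  term : ∀ x y → ind (g x ℕ.+ h y ℕ.≟ n) * (G x * H y) ≡
         Σ< (suc n) (λ i → ind (g x ℕ.≟ i) * G x * (ind (h y ℕ.≟ n ∸ i) * H y))
  term x y with g x ℕ.≤? n
  ... | yes gx≤n = sym (trans (Σ<-single {g x} {suc n} _ (s≤s gx≤n) (off x y)) (begin
    ind (g x ℕ.≟ g x) * G x * (ind (h y ℕ.≟ n ∸ g x) * H y)
      ≡⟨ cong₂ (λ a b → a * G x * (b * H y)) (ind-yes (g x ℕ.≟ g x) refl)
           (ind-iff (h y ℕ.≟ n ∸ g x) (g x ℕ.+ h y ℕ.≟ n)
             (λ e → trans (cong (g x ℕ.+_) e) (ℕP.m+[n∸m]≡n gx≤n))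
             (λ e → trans (sym (ℕP.m+n∸m≡n (g x) (h y))) (cong (_∸ g x) e))) ⟩
    1ℚ * G x * (ind (g x ℕ.+ h y ℕ.≟ n) * H y)
      ≡⟨ solve 3 (λ a b i → con 1ℚ :* a :* (i :* b) := i :* (a :* b)) refl (G x) (H y) (ind (g x ℕ.+ h y ℕ.≟ n)) ⟩
    ind (g x ℕ.+ h y ℕ.≟ n) * (G x * H y) ∎))
    where
    off : ∀ x y i → i ≢ g x → ind (g x ℕ.≟ i) * G x * (ind (h y ℕ.≟ n ∸ i) * H y) ≡ 0ℚ
    off x y i i≢ = trans (cong (λ a → a * G x * (ind (h y ℕ.≟ n ∸ i) * H y)) (ind-no (g x ℕ.≟ i) (i≢ ∘ sym)))
      (trans (cong (_* (ind (h y ℕ.≟ n ∸ i) * H y)) (ℚP.*-zeroˡ (G x))) (ℚP.*-zeroˡ (ind (h y ℕ.≟ n ∸ i) * H y)))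
  ... | no gx≰n = trans
    (trans (cong (_* (G x * H y)) (ind-no (g x ℕ.+ h y ℕ.≟ n) λ e → gx≰n (subst (g x ≤_) e (ℕP.m≤m+n (g x) (h y)))))
           (ℚP.*-zeroˡ (G x * H y)))
    (sym (Σ<-zero (suc n) λ i i≤n → trans
      (cong (λ a → a * G x * (ind (h y ℕ.≟ n ∸ i) * H y)) (ind-no (g x ℕ.≟ i) λ { refl → gx≰n (ℕP.≤-pred i≤n) }))
      (trans (cong (_* (ind (h y ℕ.≟ n ∸ i) * H y)) (ℚP.*-zeroˡ (G x))) (ℚP.*-zeroˡ (ind (h y ℕ.≟ n ∸ i) * H y)))))

-- Mark a fixed vertex: the tree containing it is mapped to itself.
aut-∂ : ∀ F m → c m * aut F m ≡ ∑ (picks F) (λ (a , s , _) → mul (λ i → c i * treeAut a i) (aut s) m)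
aut-∂ F m = begin
  c m * aut F m
    ≡⟨ ∑-*ˡ (isos F F) (c m) _ ⟨
  ∑ (isos F F) (λ σ → c m * ind (fix σ ℕ.≟ m))
    ≡⟨ ∑-All (All.map (λ {σ} I → marked σ I) (sound (isos-enum F F))) ⟩
  ∑ (isos F F) (λ σ → ∑ (picks F) λ (a , s , π) → ind (σ (emb π root) ≟ⱽ emb π root) * h σ π)
    ≡⟨ ∑-swap (isos F F) (picks F) _ ⟩
  ∑ (picks F) (λ (a , s , π) → ∑ (isos F F) λ σ → ind (σ (emb π root) ≟ⱽ emb π root) * h σ π)
    ≡⟨ ∑-cong (picks F) (λ (a , s , π) → trans (∑-split π π (split π)) (component a s)) ⟩
  ∑ (picks F) (λ (a , s , _) → mul (λ i → c i * treeAut a i) (aut s) m) ∎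
  where
  open ≡-Reasoning
  open +-*-Solver
  h : ∀ {a s} → (V F → V F) → Pick F a s → ℚ
  h {a} σ π = ind (fix σ ℕ.≟ m) * (1ℚ + ∑ (verts a) λ x → ind (σ (emb π (down x)) ≟ⱽ emb π (down x)))

  -- If a vertex is fixed, so is the root of its tree, because σ commutes with `top`.
  top-fixed : ∀ {a s σ} → Isoⱽ F F σ → (π : Pick F a s) → ∀ x →
              σ (emb π (down x)) ≡ emb π (down x) → σ (emb π root) ≡ emb π root
  top-fixed {σ = σ} I π x fx = trans (cong σ (sym (top-iso (emb-iso π) (down x))))
    (trans (sym (top-iso I (emb π (down x)))) (trans (cong top fx) (top-iso (emb-iso π) (down x))))

  -- When the root of the tree is moved, so is every vertex of the tree, and both sides are zero.
  factor : ∀ {a s σ} → Isoⱽ F F σ → (π : Pick F a s) →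
    ind (σ (emb π root) ≟ⱽ emb π root) + ∑ (verts a) (λ x → ind (σ (emb π (down x)) ≟ⱽ emb π (down x))) ≡
    ind (σ (emb π root) ≟ⱽ emb π root) * (1ℚ + ∑ (verts a) λ x → ind (σ (emb π (down x)) ≟ⱽ emb π (down x)))
  factor {a} {σ = σ} I π with σ (emb π root) ≟ⱽ emb π root
  ... | yes _ = sym (ℚP.*-identityˡ _)
  ... | no ≢r = trans (cong (0ℚ +_) (∑-zero (verts a) λ x →
                  ind-no (σ (emb π (down x)) ≟ⱽ emb π (down x)) (≢r ∘ top-fixed I π x)))
                (sym (ℚP.*-zeroˡ (1ℚ + ∑ (verts a) λ x → ind (σ (emb π (down x)) ≟ⱽ emb π (down x)))))

  marked : ∀ σ → Isoⱽ F F σ → c m * ind (fix σ ℕ.≟ m) ≡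
           ∑ (picks F) (λ (a , s , π) → ind (σ (emb π root) ≟ⱽ emb π root) * h σ π)
  marked σ I = begin
    c m * ind (fix σ ℕ.≟ m)
      ≡⟨ ℚP.*-comm (c m) (ind (fix σ ℕ.≟ m)) ⟩
    ind (fix σ ℕ.≟ m) * c m
      ≡⟨ ind-cong (fix σ ℕ.≟ m) (λ e → cong c (sym e)) ⟩
    ind (fix σ ℕ.≟ m) * c (fix σ)
      ≡⟨ cong (ind (fix σ ℕ.≟ m) *_) (trans (c-fix σ) (∑-verts-picks F (λ v → ind (σ v ≟ⱽ v)))) ⟩
    ind (fix σ ℕ.≟ m) * ∑ (picks F) (λ (a , s , π) →
      ind (σ (emb π root) ≟ⱽ emb π root) + ∑ (verts a) λ x → ind (σ (emb π (down x)) ≟ⱽ emb π (down x)))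
      ≡⟨ ∑-*ˡ (picks F) (ind (fix σ ℕ.≟ m)) _ ⟨
    ∑ (picks F) (λ (a , s , π) → ind (fix σ ℕ.≟ m) *
      (ind (σ (emb π root) ≟ⱽ emb π root) + ∑ (verts a) λ x → ind (σ (emb π (down x)) ≟ⱽ emb π (down x))))
      ≡⟨ ∑-cong (picks F) (λ (a , s , π) → trans (cong (ind (fix σ ℕ.≟ m) *_) (factor I π))
           (solve 3 (λ x y z → x :* (y :* z) := y :* (x :* z)) refl (ind (fix σ ℕ.≟ m)) (ind (σ (emb π root) ≟ⱽ emb π root))
             (1ℚ + ∑ (verts a) λ x → ind (σ (emb π (down x)) ≟ⱽ emb π (down x))))) ⟩
    ∑ (picks F) (λ (a , s , π) → ind (σ (emb π root) ≟ⱽ emb π root) * h σ π) ∎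

  split : ∀ {a s} (π : Pick F a s) σ α β → (∀ v → σ (emb π v) ≡ emb π (join α β v)) →
          h σ π ≡ ind (suc (fix α) ℕ.+ fix β ℕ.≟ m) * (c (suc (fix α)) * 1ℚ)
  split π σ α β e = cong₂ (λ k x → ind (k ℕ.≟ m) * x) (fix-join π σ α β e)
    (trans (cong (1ℚ +_) (fix-down π σ α β e)) (trans (sym (c-suc (fix α))) (sym (ℚP.*-identityʳ (c (suc (fix α)))))))

  component : ∀ a s → ∑ (isos a a) (λ α → ∑ (isos s s) λ β → ind (suc (fix α) ℕ.+ fix β ℕ.≟ m) * (c (suc (fix α)) * 1ℚ)) ≡
              mul (λ i → c i * treeAut a i) (aut s) m
  component a s = trans (∑-conv (isos a a) (isos s s) (suc ∘ fix) fix (c ∘ suc ∘ fix) (λ _ → 1ℚ) m)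
    (mul-cong (λ i → trans (∑-cong (isos a a) λ α → trans (ind-cong (suc (fix α) ℕ.≟ i) (cong c))
                                                      (ℚP.*-comm (ind (suc (fix α) ℕ.≟ i)) (c i)))
                           (∑-*ˡ (isos a a) (c i) _))
              (λ j → ∑-cong (isos s s) λ β → ℚP.*-identityʳ (ind (fix β ℕ.≟ j))) m)

-- The only root is fixed by every automorphism, so `∑-split` applies to all of them, with an empty
-- remaining forest.
aut-tree : ∀ a m → aut (a ◃ ∅) m ≡ treeAut a m
aut-tree a m = begin
  ∑ (isos (a ◃ ∅) (a ◃ ∅)) (λ σ → ind (fix σ ℕ.≟ m))
    ≡⟨ ∑-All (All.map (λ {σ} I → trans (sym (ℚP.*-identityˡ (ind (fix σ ℕ.≟ m))))
         (cong (_* ind (fix σ ℕ.≟ m)) (sym (ind-yes (σ root ≟ⱽ root) (only-root (σ root) (comm I root))))))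
         (sound (isos-enum (a ◃ ∅) (a ◃ ∅)))) ⟩
  ∑ (isos (a ◃ ∅) (a ◃ ∅)) (λ σ → ind (σ root ≟ⱽ root) * ind (fix σ ℕ.≟ m))
    ≡⟨ ∑-split {a ◃ ∅} {a} {∅} here (here {a} {∅}) (λ σ α β e → cong (λ k → ind (k ℕ.≟ m)) (trans (fix-join here σ α β e)
         (cong suc (ℕP.+-identityʳ (fix α))))) ⟩
  ∑ (isos a a) (λ α → ∑ (isos ∅ ∅) λ β → ind (suc (fix α) ℕ.≟ m))
    ≡⟨ ∑-cong (isos a a) (λ α → ∑-isos-∅ (ind (suc (fix α) ℕ.≟ m))) ⟩
  treeAut a m ∎
  where
  open ≡-Reasoning
  only-root : (x : V (a ◃ ∅)) → par x ≡ nothing → x ≡ root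
  only-root root _ = refl

-- Isomorphism of plane forests and its invariants

Enum-nonempty : {fs : List (X → Y)} → Enum p q fs → ∃ (Iso p q) → length fs ≢ 0
Enum-nonempty {fs = []}    E (f , I) _ with () ← complete E I
Enum-nonempty {fs = _ ∷ _} E _       ()

Enum-inhabited : {fs : List (X → Y)} → Enum p q fs → length fs ≢ 0 → ∃ (Iso p q)
Enum-inhabited {fs = []}    E ≢0 = contradiction refl ≢0
Enum-inhabited {fs = f ∷ _} E _  = f , All.head (sound E)

infix 4 _≅_ _≅?_
_≅_ : Forest → Forest → Set
F ≅ G = ∃ (Isoⱽ F G)

≅-refl : F ≅ F
≅-refl = id , Iso-id

≅-sym : F ≅ G → G ≅ F
≅-sym (_ , I) = _ , Iso-inverse I

≅-trans : F ≅ G → G ≅ a → F ≅ a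
≅-trans (_ , I) (_ , J) = _ , Iso-∘ J I

≅-◃ : a ≅ b → s ≅ t → a ◃ s ≅ b ◃ t
≅-◃ (_ , I) (_ , J) = _ , join-iso I J

≅-emb : Pick F a s → a ◃ s ≅ F
≅-emb π = emb π , emb-iso π

_≅?_ : ∀ F G → Dec (F ≅ G)
F ≅? G with N F G ℕ.≟ 0
... | yes e = no λ iso → Enum-nonempty (isos-enum F G) iso e
... | no ≢0 = yes (Enum-inhabited (isos-enum F G) ≢0)

N-¬≅ : ∀ F G → ¬ F ≅ G → N F G ≡ 0
N-¬≅ F G ≇ with N F G ℕ.≟ 0
... | yes e = e
... | no ≢0 = contradiction (Enum-inhabited (isos-enum F G) ≢0) ≇

N-resp : F ≅ a → G ≅ b → N F G ≡ N a b
N-resp {F} {a} {G} {b} (_ , I) (_ , J) = c-injective (trans (c-N F G) (trans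
  (∑-transport I J (isos-enum F G) (isos-enum a b) λ _ _ _ _ → refl) (sym (c-N a b))))

∑-bijection : {f : X → Y} → Iso p q f → {xs : List X} {ys : List Y} →
              (∀ x → x ∈ xs) → AllPairs _≢_ xs → (∀ y → y ∈ ys) → AllPairs _≢_ ys →
              (g : Y → ℚ) → ∑ xs (g ∘ f) ≡ ∑ ys g
∑-bijection {f = f} I {xs} {ys} x∈ x≢ y∈ y≢ g = ∑-match (λ x y → f x ≡ y) xs ys
  (All.universal (λ x → y∈ (f x)) xs)
  (All.universal (λ y → Any.map (λ e → trans (cong f (sym e)) (inverseʳ I y)) (x∈ (inverse I y))) ys)
  (AllPairs.map (λ ≢ y e e′ → ≢ (inj I (trans e (sym e′)))) x≢)
  (AllPairs.map (λ ≢ x e e′ → ≢ (trans (sym e) e′)) y≢)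
  (λ x y e → cong g e)

∑-verts-≅ : {f : V F → V G} → Isoⱽ F G f → (g : V G → ℚ) → ∑ (verts F) (g ∘ f) ≡ ∑ (verts G) g
∑-verts-≅ {F} {G} I = ∑-bijection I verts-complete (verts-distinct F) verts-complete (verts-distinct G)

-- Written as sums over vertices, here and in `c-len`, `size` and `len` become invariant under
-- isomorphism by `∑-verts-≅`.
c-size : ∀ F → c (size F) ≡ ∑ (verts F) (λ _ → 1ℚ)
c-size ∅       = c-0
c-size (a ◃ s) = trans (c-suc (size a ℕ.+ size s)) (trans (cong (1ℚ +_) (trans (c-+ (size a) (size s))
  (cong₂ _+_ (c-size a) (c-size s)))) (trans (sym (ℚP.+-assoc 1ℚ (∑ (verts a) λ _ → 1ℚ) (∑ (verts s) λ _ → 1ℚ))) (sym (∑-verts {a} {s} λ _ → 1ℚ))))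

isRoot? : (v : V F) → Dec (par v ≡ nothing)
isRoot? v = MaybeP.≡-dec _≟ⱽ_ (par v) nothing

c-len : ∀ F → c (len F) ≡ ∑ (verts F) (λ v → ind (isRoot? v))
c-len ∅       = c-0
c-len (a ◃ s) = trans (c-suc (len s)) (sym (trans (∑-verts {a} {s} λ v → ind (isRoot? v)) (cong₂ _+_
  (trans (cong (1ℚ +_) (∑-zero (verts a) λ x → ind-no (isRoot? (down {s = s} x)) λ ())) (ℚP.+-identityʳ 1ℚ))
  (trans (∑-cong (verts s) λ y → ind-iff (isRoot? (next {a = a} y)) (isRoot? y) (unmap (par y)) (cong (Maybe.map next)))
         (sym (c-len s))))))
  where
  unmap : (m : Maybe (V s)) → Maybe.map (next {a = a}) m ≡ nothing → m ≡ nothing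
  unmap nothing _ = refl

size-≅ : F ≅ G → size F ≡ size G
size-≅ {F} {G} (_ , I) = c-injective (trans (c-size F) (trans (∑-verts-≅ I λ _ → 1ℚ) (sym (c-size G))))

len-≅ : F ≅ G → len F ≡ len G
len-≅ {F} {G} (f , I) = c-injective (trans (c-len F) (trans
  (∑-cong (verts F) λ v → ind-iff (isRoot? v) (isRoot? (f v)) (λ e → trans (comm I v) (cong (Maybe.map f) e))
     (λ e → unmap (par v) (trans (sym (comm I v)) e)))
  (trans (∑-verts-≅ I (ind ∘ isRoot?)) (sym (c-len G)))))
  where
  unmap : (m : Maybe (V F)) → Maybe.map f m ≡ nothing → m ≡ nothing
  unmap nothing _ = refl

size-Pick : Pick F a s → size F ≡ suc (size a ℕ.+ size s)
size-Pick π = sym (size-≅ (≅-emb π))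

fix≤size : (σ : V F → V F) → fix σ ≤ size F
fix≤size {F} σ = subst (fix σ ≤_) (c-injective (trans (c-length (verts F)) (sym (c-size F))))
  (ListP.length-filter (λ v → σ v ≟ⱽ v) (verts F))

-- The weight of a plane forest

-- The product of the factorials of all numbers of children, including those of a virtual root.
-- By ∑-N, it is |Aut F| times the number of plane forests isomorphic to F.
w : Forest → ℕ
w ∅       = 1
w (a ◃ s) = suc (len s) ℕ.* (w a ℕ.* w s)

w≢0 : ∀ F → w F ≢ 0
w≢0 ∅       ()
w≢0 (a ◃ s) = m*n≢0 {suc (len s)} (λ ()) (m*n≢0 (w≢0 a) (w≢0 s))

-- `w` is a product over all vertices, so any tree may play the part of the first one; with it the
-- virtual root has `len s` + 1 children and contributes (len s + 1)! = (len s + 1) (len s)!.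
w-Pick : Pick F a s → w F ≡ suc (len s) ℕ.* (w a ℕ.* w s)
w-Pick here = refl
w-Pick {F = b ◃ F} {a = a} (there {t = s} π) = begin
  suc (len F) ℕ.* (w b ℕ.* w F)
    ≡⟨ cong₂ (λ k x → suc k ℕ.* (w b ℕ.* x)) (sym (len-≅ (≅-emb π))) (w-Pick π) ⟩
  suc (suc (len s)) ℕ.* (w b ℕ.* (suc (len s) ℕ.* (w a ℕ.* w s)))
    ≡⟨ cong (suc (suc (len s)) ℕ.*_) (trans (lc (w b) (suc (len s)) (w a ℕ.* w s))
         (trans (cong (suc (len s) ℕ.*_) (lc (w b) (w a) (w s))) (lc (suc (len s)) (w a) (w b ℕ.* w s)))) ⟩
  suc (suc (len s)) ℕ.* (w a ℕ.* (suc (len s) ℕ.* (w b ℕ.* w s))) ∎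
  where
  open ≡-Reasoning
  lc : ∀ x y z → x ℕ.* (y ℕ.* z) ≡ y ℕ.* (x ℕ.* z)
  lc x y z = trans (sym (ℕP.*-assoc x y z)) (trans (cong (ℕ._* z) (ℕP.*-comm x y)) (ℕP.*-assoc y x z))

inv-w-Pick : Pick F a s → inv (w F) ≡ inv (suc (len s)) * (inv (w a) * inv (w s))
inv-w-Pick {a = a} {s = s} π = trans (cong inv (w-Pick π)) (trans
  (inv-* {suc (len s)} (λ ()) (m*n≢0 (w≢0 a) (w≢0 s))) (cong (inv (suc (len s)) *_) (inv-* (w≢0 a) (w≢0 s))))

-- allF k contains every plane forest of size at most k.
allF : ℕ → List Forest
allF zero    = ∅ ∷ []
allF (suc k) = ∅ ∷ map (uncurry _◃_) (cartesianProduct (allF k) (allF k))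

∑-allF : ∀ k (f : Forest → ℚ) → ∑ (allF (suc k)) f ≡ f ∅ + ∑ (allF k) (λ a → ∑ (allF k) λ s → f (a ◃ s))
∑-allF k f = cong (f ∅ +_) (trans (∑-map (uncurry _◃_) (cartesianProduct (allF k) (allF k)) f)
  (∑-cartesian (allF k) (allF k) (f ∘ uncurry _◃_)))

-- `allF k` contains each forest of size at most `k`, along with some larger ones; passing to
-- `allF (suc k)` adds only forests on which `f` vanishes.
∑-allF-suc : ∀ k (f : Forest → ℚ) → (∀ F → k < size F → f F ≡ 0ℚ) → ∑ (allF (suc k)) f ≡ ∑ (allF k) f
∑-allF-suc zero    f z = cong (f ∅ +_) (trans (ℚP.+-identityʳ (f (∅ ◃ ∅))) (z (∅ ◃ ∅) (s≤s z≤n)))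
∑-allF-suc (suc k) f z = trans (∑-allF (suc k) f) (trans (cong (f ∅ +_) (trans
  (∑-allF-suc k _ λ a k<a → ∑-zero (allF (suc k)) λ s → z (a ◃ s) (s≤s (ℕP.<-≤-trans k<a (ℕP.m≤m+n (size a) (size s)))))
  (∑-cong (allF k) λ a → ∑-allF-suc k _ λ s k<s → z (a ◃ s) (s≤s (ℕP.<-≤-trans k<s (ℕP.m≤n+m (size s) (size a)))))))
  (sym (∑-allF k f)))

∑-allF-≤ : ∀ {k l} → k ≤ l → (f : Forest → ℚ) → (∀ F → k < size F → f F ≡ 0ℚ) → ∑ (allF l) f ≡ ∑ (allF k) f
∑-allF-≤ {k} k≤l f z with ℕP.m≤n⇒∃[o]m+o≡n k≤l
... | d , refl = go d
  where
  go : ∀ d → ∑ (allF (k ℕ.+ d)) f ≡ ∑ (allF k) f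
  go zero    = cong (λ n → ∑ (allF n) f) (ℕP.+-identityʳ k)
  go (suc d) = trans (cong (λ n → ∑ (allF n) f) (ℕP.+-suc k d))
    (trans (∑-allF-suc (k ℕ.+ d) f λ F lt → z F (ℕP.≤-<-trans (ℕP.m≤m+n k d) lt)) (go d))

-- A tree a can be inserted at len s + 1 places into the plane forest s.
∑-insert : ∀ k (H : Forest → Forest → ℚ) → (∀ a s → k < suc (size a ℕ.+ size s) → H a s ≡ 0ℚ) →
  ∑ (allF k) (λ F → ∑ (picks F) λ (a , s , _) → H a s) ≡
  ∑ (allF k) (λ a → ∑ (allF k) λ s → c (suc (len s)) * H a s)
∑-insert zero    H z = sym (trans (ℚP.+-identityʳ _) (trans (ℚP.+-identityʳ _)
  (trans (cong (c 1 *_) (z ∅ ∅ (s≤s z≤n))) (ℚP.*-zeroʳ (c 1)))))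
∑-insert (suc k) H z = begin
  ∑ (allF (suc k)) (λ F → ∑ (picks F) λ (a , s , _) → H a s)
    ≡⟨ ∑-allF k (λ F → ∑ (picks F) λ (a , s , _) → H a s) ⟩
  0ℚ + ∑A (λ a → ∑A λ s → ∑ (picks (a ◃ s)) λ (b , t , _) → H b t)
    ≡⟨ ℚP.+-identityˡ _ ⟩
  ∑A (λ a → ∑A λ s → ∑ (picks (a ◃ s)) λ (b , t , _) → H b t)
    ≡⟨ ∑-cong (allF k) (λ a → ∑-cong (allF k) λ s → ∑-picks {a} {s} (λ (b , t , _) → H b t)) ⟩
  ∑A (λ a → ∑A λ s → H a s + ∑ (picks s) λ (b , t , _) → H b (a ◃ t))
    ≡⟨ ∑-cong (allF k) (λ a → ∑-+ (allF k) (H a) (λ s → ∑ (picks s) λ (b , t , _) → H b (a ◃ t))) ⟩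
  ∑A (λ a → ∑A (H a) + ∑A λ s → ∑ (picks s) λ (b , t , _) → H b (a ◃ t))
    ≡⟨ ∑-+ (allF k) (λ a → ∑A (H a)) (λ a → ∑A λ s → ∑ (picks s) λ (b , t , _) → H b (a ◃ t)) ⟩
  ∑A (λ a → ∑A (H a)) + ∑A (λ a → ∑A λ s → ∑ (picks s) λ (b , t , _) → H b (a ◃ t))
    ≡⟨ cong₂ _+_ (∑-cong (allF k) λ a → trans (sym (∑-allF-suc k (H a) (small a))) (∑-allF k (H a)))
         (∑-cong (allF k) λ a → ∑-insert k (λ b t → H b (a ◃ t)) λ b t lt → z b (a ◃ t)
            (s≤s (ℕP.≤-trans lt (ℕP.≤-trans (ℕP.≤-reflexive (sym (ℕP.+-suc (size b) (size t))))
              (ℕP.+-monoʳ-≤ (size b) (s≤s (ℕP.m≤n+m (size t) (size a)))))))) ⟩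
  ∑A (λ a → H a ∅ + ∑A λ b → ∑A λ t → H a (b ◃ t)) + ∑A (λ a → ∑A λ b → ∑A λ t → c (suc (len t)) * H b (a ◃ t))
    -- Exchange the names of the inserted tree and the first tree. Then `a` occurs once in front of
    -- b ◃ t and in `len t` + 1 places behind b, which makes `len (b ◃ t)` + 1 in all.
    ≡⟨ cong (∑A (λ a → H a ∅ + ∑A λ b → ∑A λ t → H a (b ◃ t)) +_)
         (∑-swap (allF k) (allF k) λ a b → ∑A λ t → c (suc (len t)) * H b (a ◃ t)) ⟩
  ∑A (λ a → H a ∅ + ∑A λ b → ∑A λ t → H a (b ◃ t)) + ∑A (λ a → ∑A λ b → ∑A λ t → c (suc (len t)) * H a (b ◃ t))
    ≡⟨ ∑-+ (allF k) _ _ ⟨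
  ∑A (λ a → H a ∅ + ∑A (λ b → ∑A λ t → H a (b ◃ t)) + ∑A (λ b → ∑A λ t → c (suc (len t)) * H a (b ◃ t)))
    ≡⟨ ∑-cong (allF k) collect ⟩
  ∑A (λ a → ∑ (allF (suc k)) λ s → c (suc (len s)) * H a s)
    ≡⟨ ∑-allF-suc k _ (λ a k<a → ∑-zero (allF (suc k)) λ s → trans
         (cong (c (suc (len s)) *_) (z a s (s≤s (ℕP.<-≤-trans k<a (ℕP.m≤m+n (size a) (size s))))))
         (ℚP.*-zeroʳ (c (suc (len s))))) ⟨
  ∑ (allF (suc k)) (λ a → ∑ (allF (suc k)) λ s → c (suc (len s)) * H a s) ∎
  where
  open ≡-Reasoning
  ∑A : (Forest → ℚ) → ℚ
  ∑A = ∑ (allF k)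
  small : ∀ a s → k < size s → H a s ≡ 0ℚ
  small a s k<s = z a s (s≤s (ℕP.<-≤-trans k<s (ℕP.m≤n+m (size s) (size a))))
  collect : ∀ a → H a ∅ + ∑A (λ b → ∑A λ t → H a (b ◃ t)) + ∑A (λ b → ∑A λ t → c (suc (len t)) * H a (b ◃ t)) ≡
            ∑ (allF (suc k)) (λ s → c (suc (len s)) * H a s)
  collect a = trans (ℚP.+-assoc (H a ∅) _ _) (trans
    (cong₂ _+_ (trans (sym (ℚP.*-identityˡ (H a ∅))) (cong (_* H a ∅) (sym c-1)))
      (trans (sym (∑-+ (allF k) _ _)) (∑-cong (allF k) λ b → trans (sym (∑-+ (allF k) _ _))
        (∑-cong (allF k) λ t → trans
          (solve 2 (λ x l → x :+ l :* x := (con 1ℚ :+ l) :* x) refl (H a (b ◃ t)) (c (suc (len t))))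
          (cong (_* H a (b ◃ t)) (sym (c-suc (suc (len t)))))))))
    (sym (∑-allF k (λ s → c (suc (len s)) * H a s))))
    where open +-*-Solver

-- Induction on `F`. By `N-◃` the first tree goes to some tree b of G, leaving t; by insertion the
-- pair (b, t) arises `len t` + 1 times, and `len t` = `len s` whenever the summand is nonzero.
∑-N : ∀ F {k} → size F ≤ k → ∑ (allF k) (λ G → c (N F G)) ≡ c (w F)
∑-N ∅ {k} _ = trans
  (∑-allF-≤ {0} {k} z≤n (λ G → c (N ∅ G)) λ G 0<G → trans
    (cong c (N-¬≅ ∅ G λ iso → ℕP.<-irrefl (size-≅ iso) 0<G)) c-0)
  (trans (ℚP.+-identityʳ (c (N ∅ ∅))) (trans (c-N ∅ ∅) (trans (∑-isos-∅ 1ℚ) (sym c-1))))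
∑-N (a ◃ s) {k} (s≤s {n = k′} le) = begin
  ∑ (allF k) (λ G → c (N (a ◃ s) G))
    ≡⟨ ∑-cong (allF k) (N-◃ a s) ⟩
  ∑ (allF k) (λ G → ∑ (picks G) λ (b , t , _) → c (N a b) * c (N s t))
    ≡⟨ ∑-insert k (λ b t → c (N a b) * c (N s t)) vanish ⟩
  ∑ (allF k) (λ b → ∑ (allF k) λ t → c (suc (len t)) * (c (N a b) * c (N s t)))
    ≡⟨ ∑-cong (allF k) (λ b → ∑-cong (allF k) λ t → same-len b t) ⟩
  ∑ (allF k) (λ b → ∑ (allF k) λ t → c (suc (len s)) * (c (N a b) * c (N s t)))
    ≡⟨ trans (∑-cong (allF k) λ b → ∑-*ˡ (allF k) (c (suc (len s))) _) (∑-*ˡ (allF k) (c (suc (len s))) _) ⟩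
  c (suc (len s)) * ∑ (allF k) (λ b → ∑ (allF k) λ t → c (N a b) * c (N s t))
    ≡⟨ cong (c (suc (len s)) *_) (∑-* (allF k) (allF k) (λ b → c (N a b)) (λ t → c (N s t))) ⟩
  c (suc (len s)) * (∑ (allF k) (λ b → c (N a b)) * ∑ (allF k) (λ t → c (N s t)))
    ≡⟨ cong (c (suc (len s)) *_) (cong₂ _*_
         (∑-N a (ℕP.≤-trans (ℕP.m≤m+n (size a) (size s)) (ℕP.m≤n⇒m≤1+n le)))
         (∑-N s (ℕP.≤-trans (ℕP.m≤n+m (size s) (size a)) (ℕP.m≤n⇒m≤1+n le)))) ⟩
  c (suc (len s)) * (c (w a) * c (w s))
    ≡⟨ trans (c-* (suc (len s)) (w a ℕ.* w s)) (cong (c (suc (len s)) *_) (c-* (w a) (w s))) ⟨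
  c (w (a ◃ s)) ∎
  where
  open ≡-Reasoning
  zeroˡ : ∀ {a b} x → ¬ a ≅ b → c (N a b) * x ≡ 0ℚ
  zeroˡ {a} {b} x ≇ = trans (cong (_* x) (trans (cong c (N-¬≅ a b ≇)) c-0)) (ℚP.*-zeroˡ x)
  zeroʳ : ∀ x {s t} → ¬ s ≅ t → x * c (N s t) ≡ 0ℚ
  zeroʳ x {s} {t} ≇ = trans (ℚP.*-comm x (c (N s t))) (zeroˡ x ≇)
  vanish : ∀ b t → k < suc (size b ℕ.+ size t) → c (N a b) * c (N s t) ≡ 0ℚ
  vanish b t lt with a ≅? b | s ≅? t
  ... | no a≇b | _       = zeroˡ (c (N s t)) a≇b
  ... | yes _  | no s≇t  = zeroʳ (c (N a b)) s≇t
  ... | yes ab | yes st  = contradiction (ℕP.<-≤-trans lt (s≤s (subst₂-≤ (size-≅ ab) (size-≅ st) le))) (ℕP.<-irrefl refl)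
    where
    subst₂-≤ : ∀ {x y u v} → x ≡ u → y ≡ v → x ℕ.+ y ≤ k′ → u ℕ.+ v ≤ k′
    subst₂-≤ refl refl h = h
  same-len : ∀ b t → c (suc (len t)) * (c (N a b) * c (N s t)) ≡ c (suc (len s)) * (c (N a b) * c (N s t))
  same-len b t with s ≅? t
  ... | yes st = cong (λ l → c (suc l) * (c (N a b) * c (N s t))) (sym (len-≅ st))
  ... | no s≇t = trans (kill (c (suc (len t)))) (sym (kill (c (suc (len s)))))
    where
    kill : ∀ x → x * (c (N a b) * c (N s t)) ≡ 0ℚ
    kill x = trans (cong (x *_) (zeroʳ (c (N a b)) s≇t)) (ℚP.*-zeroʳ x)

-- By `∑-N` the weight is a sum of numbers of isomorphisms, and these depend only on the class of
-- `F`.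
w-≅ : F ≅ G → w F ≡ w G
w-≅ {F} {G} F≅G = c-injective (trans (sym (∑-N F {size F} ℕP.≤-refl)) (trans
  (∑-cong (allF (size F)) λ a → cong c (N-resp F≅G ≅-refl))
  (∑-N G (ℕP.≤-reflexive (sym (size-≅ F≅G))))))

∑ₙ : ℕ → (Forest → ℚ) → ℚ
∑ₙ n f = ∑ (allF n) (λ F → ind (size F ℕ.≟ n) * f F)

ind-zero : {Q : Set} (Q? : Dec Q) (x : ℚ) → ¬ Q → ind Q? * x ≡ 0ℚ
ind-zero Q? x ¬q = trans (cong (_* x) (ind-no Q? ¬q)) (ℚP.*-zeroˡ x)

∑ₙ-≤ : ∀ {n k} → n ≤ k → (f : Forest → ℚ) → ∑ (allF k) (λ F → ind (size F ℕ.≟ n) * f F) ≡ ∑ₙ n f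
∑ₙ-≤ {n} n≤k f = ∑-allF-≤ n≤k _ λ F n<F → ind-zero (size F ℕ.≟ n) (f F) (ℕP.>⇒≢ n<F)

-- Generating functions

Φ : BS
Φ n m = ∑ₙ n λ F → aut F m * inv (w F)

aut-high : ∀ F m → size F < m → aut F m ≡ 0ℚ
aut-high F m lt = ∑-zero (isos F F) λ σ → ind-no (fix σ ℕ.≟ m) λ { refl → ℕP.<⇒≱ lt (fix≤size σ) }

Φ-deg : Deg Φ
Φ-deg n m n<m = ∑-zero (allF n) λ F → trans
  (ind-cong (size F ℕ.≟ n) λ { refl → trans (cong (_* inv (w F)) (aut-high F m n<m)) (ℚP.*-zeroˡ (inv (w F))) })
  (ℚP.*-zeroʳ (ind (size F ℕ.≟ n)))

treeAut-suc : ∀ a m → treeAut a (suc m) ≡ aut a m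
treeAut-suc a m = ∑-cong (isos a a) λ α → ind-iff (suc (fix α) ℕ.≟ suc m) (fix α ℕ.≟ m) ℕP.suc-injective (cong suc)

-- The factor z u adds a root below which the forest `a` hangs: one more vertex, and one that every
-- automorphism fixes.
shiftZU-Φ : ∀ n i j → i ≤ suc n → shiftZU Φ i j ≡
            ∑ (allF n) (λ a → ind (suc (size a) ℕ.≟ i) * (treeAut a j * inv (w a)))
shiftZU-Φ n zero    j       _   = sym (∑-zero (allF n) λ a → ℚP.*-zeroˡ (treeAut a j * inv (w a)))
shiftZU-Φ n (suc i) zero    _   = sym (∑-zero (allF n) λ a → trans
  (cong (λ x → ind (suc (size a) ℕ.≟ suc i) * (x * inv (w a))) (∑-zero (isos a a) λ _ → refl))
  (trans (cong (ind (suc (size a) ℕ.≟ suc i) *_) (ℚP.*-zeroˡ (inv (w a)))) (ℚP.*-zeroʳ (ind (suc (size a) ℕ.≟ suc i)))))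
shiftZU-Φ n (suc i) (suc j) (s≤s i≤n) = trans (sym (∑ₙ-≤ i≤n λ a → aut a j * inv (w a)))
  (∑-cong (allF n) λ a → cong₂ _*_
    (ind-iff (size a ℕ.≟ i) (suc (size a) ℕ.≟ suc i) (cong suc) ℕP.suc-injective)
    (cong (_* inv (w a)) (sym (treeAut-suc a j))))

-- ∑-insert for summands weighted by 1/w, where the number of insertion places cancels
∑ₙ-insert : ∀ n (g : Forest → ℚ) (K : Forest → Forest → ℚ) →
  (∀ F → g F ≡ ∑ (picks F) (λ (a , s , _) → K a s)) →
  ∑ₙ n (λ F → g F * inv (w F)) ≡
  ∑ (allF n) (λ a → ∑ (allF n) λ s → ind (suc (size a) ℕ.+ size s ℕ.≟ n) * (K a s * (inv (w a) * inv (w s))))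
∑ₙ-insert n g K eq = begin
  ∑ₙ n (λ F → g F * inv (w F))
    ≡⟨ ∑-cong (allF n) distribute ⟩
  ∑ (allF n) (λ F → ∑ (picks F) λ (a , s , _) → H a s)
    ≡⟨ ∑-insert n H (λ a s lt → ind-zero (suc (size a) ℕ.+ size s ℕ.≟ n) _ (ℕP.>⇒≢ lt)) ⟩
  ∑ (allF n) (λ a → ∑ (allF n) λ s → c (suc (len s)) * H a s)
    ≡⟨ ∑-cong (allF n) (λ a → ∑-cong (allF n) λ s → cancel a s) ⟩
  ∑ (allF n) (λ a → ∑ (allF n) λ s → ind (suc (size a) ℕ.+ size s ℕ.≟ n) * (K a s * (inv (w a) * inv (w s)))) ∎
  where
  open ≡-Reasoning
  open +-*-Solver
  H : Forest → Forest → ℚ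
  H a s = ind (suc (size a) ℕ.+ size s ℕ.≟ n) * (K a s * (inv (suc (len s)) * (inv (w a) * inv (w s))))
  distribute : ∀ F → ind (size F ℕ.≟ n) * (g F * inv (w F)) ≡ ∑ (picks F) (λ (a , s , _) → H a s)
  distribute F = begin
    ind (size F ℕ.≟ n) * (g F * inv (w F))
      ≡⟨ cong (λ x → ind (size F ℕ.≟ n) * (x * inv (w F))) (eq F) ⟩
    ind (size F ℕ.≟ n) * (∑ (picks F) (λ (a , s , _) → K a s) * inv (w F))
      ≡⟨ cong (ind (size F ℕ.≟ n) *_) (∑-*ʳ (picks F) (inv (w F)) _) ⟨
    ind (size F ℕ.≟ n) * ∑ (picks F) (λ (a , s , _) → K a s * inv (w F))
      ≡⟨ ∑-*ˡ (picks F) (ind (size F ℕ.≟ n)) _ ⟨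
    ∑ (picks F) (λ (a , s , _) → ind (size F ℕ.≟ n) * (K a s * inv (w F)))
      ≡⟨ ∑-cong (picks F) (λ (a , s , π) → cong₂ (λ k x → ind (k ℕ.≟ n) * (K a s * x)) (size-Pick π) (inv-w-Pick π)) ⟩
    ∑ (picks F) (λ (a , s , _) → H a s) ∎
  cancel : ∀ a s → c (suc (len s)) * H a s ≡ ind (suc (size a) ℕ.+ size s ℕ.≟ n) * (K a s * (inv (w a) * inv (w s)))
  cancel a s = trans
    (solve 5 (λ l i k m x → l :* (i :* (k :* (m :* x))) := m :* (l :* (i :* (k :* x)))) refl
      (c (suc (len s))) (ind (suc (size a) ℕ.+ size s ℕ.≟ n)) (K a s) (inv (suc (len s))) (inv (w a) * inv (w s)))
    (inv-c-cancel {suc (len s)} _ λ ())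

Φ-∂ : ∂u.∂ Φ ≐ bmul (∂u.∂ (shiftZU Φ)) Φ
Φ-∂ n m = begin
  c m * ∑ₙ n (λ F → aut F m * inv (w F))
    ≡⟨ ∑-*ˡ (allF n) (c m) _ ⟨
  ∑ (allF n) (λ F → c m * (ind (size F ℕ.≟ n) * (aut F m * inv (w F))))
    ≡⟨ ∑-cong (allF n) (λ F → solve 4 (λ x i y z → x :* (i :* (y :* z)) := i :* (x :* y :* z)) refl
         (c m) (ind (size F ℕ.≟ n)) (aut F m) (inv (w F))) ⟩
  ∑ₙ n (λ F → c m * aut F m * inv (w F))
    ≡⟨ ∑ₙ-insert n (λ F → c m * aut F m) (λ a s → mul (θ a) (aut s) m) (λ F → aut-∂ F m) ⟩
  ∑ (allF n) (λ a → ∑ (allF n) λ s → ind (suc (size a) ℕ.+ size s ℕ.≟ n) * (mul (θ a) (aut s) m * (inv (w a) * inv (w s))))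
    ≡⟨ ∑-cong (allF n) (λ a → ∑-cong (allF n) λ s → expand a s) ⟩
  ∑ (allF n) (λ a → ∑ (allF n) λ s → Σ< (suc m) λ j →
    ind (suc (size a) ℕ.+ size s ℕ.≟ n) * (θ a j * inv (w a) * (aut s (m ∸ j) * inv (w s))))
    ≡⟨ trans (∑-cong (allF n) λ a → ∑-Σ<-swap (allF n) (suc m) _) (∑-Σ<-swap (allF n) (suc m) _) ⟩
  (Σ< (suc m) λ j → ∑ (allF n) λ a → ∑ (allF n) λ s →
    ind (suc (size a) ℕ.+ size s ℕ.≟ n) * (θ a j * inv (w a) * (aut s (m ∸ j) * inv (w s))))
    ≡⟨ (Σ<-ext (suc m) λ j → ∑-conv (allF n) (allF n) (suc ∘ size) size
         (λ a → θ a j * inv (w a)) (λ s → aut s (m ∸ j) * inv (w s)) n) ⟩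
  (Σ< (suc m) λ j → Σ< (suc n) λ i →
    ∑ (allF n) (λ a → ind (suc (size a) ℕ.≟ i) * (θ a j * inv (w a))) *
    ∑ (allF n) (λ s → ind (size s ℕ.≟ n ∸ i) * (aut s (m ∸ j) * inv (w s))))
    ≡⟨ Σ<-swap (suc m) (suc n) _ ⟩
  (Σ< (suc n) λ i → Σ< (suc m) λ j →
    ∑ (allF n) (λ a → ind (suc (size a) ℕ.≟ i) * (θ a j * inv (w a))) *
    ∑ (allF n) (λ s → ind (size s ℕ.≟ n ∸ i) * (aut s (m ∸ j) * inv (w s))))
    ≡⟨ (Σ<-cong (suc n) λ i i≤n → Σ<-ext (suc m) λ j → cong₂ _*_ (left i j (ℕP.≤-pred i≤n))
         (∑ₙ-≤ (ℕP.m∸n≤m n i) λ s → aut s (m ∸ j) * inv (w s))) ⟩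
  bmul (∂u.∂ (shiftZU Φ)) Φ n m ∎
  where
  open ≡-Reasoning
  open +-*-Solver
  θ : Forest → ℕ → ℚ
  θ a j = c j * treeAut a j
  expand : ∀ a s → ind (suc (size a) ℕ.+ size s ℕ.≟ n) * (mul (θ a) (aut s) m * (inv (w a) * inv (w s))) ≡
    Σ< (suc m) (λ j → ind (suc (size a) ℕ.+ size s ℕ.≟ n) * (θ a j * inv (w a) * (aut s (m ∸ j) * inv (w s))))
  expand a s = trans
    (cong (ind (suc (size a) ℕ.+ size s ℕ.≟ n) *_) (trans (sym (Σ<-*ʳ (suc m) (inv (w a) * inv (w s)) _))
      (Σ<-ext (suc m) λ j → solve 4 (λ x y u v → x :* y :* (u :* v) := x :* u :* (y :* v)) refl
         (θ a j) (aut s (m ∸ j)) (inv (w a)) (inv (w s)))))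
    (sym (Σ<-*ˡ (suc m) (ind (suc (size a) ℕ.+ size s ℕ.≟ n)) _))
  left : ∀ i j → i ≤ n → ∑ (allF n) (λ a → ind (suc (size a) ℕ.≟ i) * (θ a j * inv (w a))) ≡ c j * shiftZU Φ i j
  left i j i≤n = trans
    (∑-cong (allF n) λ a → solve 4 (λ k x y z → k :* (x :* y :* z) := x :* (k :* (y :* z))) refl
      (ind (suc (size a) ℕ.≟ i)) (c j) (treeAut a j) (inv (w a)))
    (trans (∑-*ˡ (allF n) (c j) _) (cong (c j *_) (sym (shiftZU-Φ n i j (ℕP.m≤n⇒m≤1+n i≤n)))))

-- Isomorphism classes of forests: the series at u = 1

-- One over the number of plane forests isomorphic to F
ρ : Forest → ℚ
ρ F = c (N F F) * inv (w F)

-- Each isomorphism class contributes 1 in total, so this is the number of unlabelled forests of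
-- size n.
forestCount : PS
forestCount n = ∑ₙ n ρ

aut-total : ∀ F {n} → size F ≡ n → Σ< (suc n) (aut F) ≡ c (N F F)
aut-total F {n} refl = trans (sym (∑-Σ<-swap (isos F F) (suc n) _)) (trans
  (∑-cong (isos F F) λ σ → trans (Σ<-single {fix σ} {suc n} _ (s≤s (fix≤size σ)) λ m m≢ → ind-no (fix σ ℕ.≟ m) (m≢ ∘ sym))
                            (ind-yes (fix σ ℕ.≟ fix σ) refl))
  (sym (c-N F F)))

Φ-ev : ev Φ ≗ forestCount
Φ-ev n = trans (sym (∑-Σ<-swap (allF n) (suc n) _)) (∑-cong (allF n) λ F → trans
  (Σ<-*ˡ (suc n) (ind (size F ℕ.≟ n)) _) (ind-cong (size F ℕ.≟ n) λ e → trans (Σ<-*ʳ (suc n) (inv (w F)) _)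
    (cong (_* inv (w F)) (aut-total F e))))

forestCount-0 : forestCount 0 ≡ 1ℚ
forestCount-0 = trans (ℚP.+-identityʳ (1ℚ * ρ ∅)) (trans (ℚP.*-identityˡ (ρ ∅)) (trans
  (cong₂ _*_ (trans (c-N ∅ ∅) (∑-isos-∅ 1ℚ)) inv-1) (ℚP.*-identityˡ 1ℚ)))

-- The multiplicity in F of the tree whose root carries a.
mult : Forest → Forest → ℚ
mult a F = ∑ (picks F) λ (b , _ , _) → ind (a ≅? b)

-- The first tree may go to itself or to any copy of it in `s`. In each case what remains on both
-- sides is isomorphic to `s`, so all 1 + `mult a s` choices give the same count.
N-self : ∀ a s → c (N (a ◃ s) (a ◃ s)) ≡ c (N a a) * c (N s s) * (1ℚ + mult a s)
N-self a s = begin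
  c (N (a ◃ s) (a ◃ s))
    ≡⟨ trans (N-◃ a s (a ◃ s)) (∑-picks {a} {s} (λ (b , t , _) → c (N a b) * c (N s t))) ⟩
  x + ∑ (picks s) (λ (b , t , _) → c (N a b) * c (N s (a ◃ t)))
    ≡⟨ cong (x +_) (∑-cong (picks s) λ (b , t , π) → term b t π) ⟩
  x + ∑ (picks s) (λ (b , t , _) → x * ind (a ≅? b))
    ≡⟨ cong (x +_) (∑-*ˡ (picks s) x _) ⟩
  x + x * mult a s
    ≡⟨ solve 2 (λ x y → x :+ x :* y := x :* (con 1ℚ :+ y)) refl x (mult a s) ⟩
  x * (1ℚ + mult a s) ∎
  where
  open ≡-Reasoning
  open +-*-Solver
  x = c (N a a) * c (N s s)
  term : ∀ b t → Pick s b t → c (N a b) * c (N s (a ◃ t)) ≡ x * ind (a ≅? b)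
  term b t π with a ≅? b
  ... | yes ab = trans (cong₂ (λ k l → c k * c l) (N-resp ≅-refl (≅-sym ab))
                   (N-resp ≅-refl (≅-trans (≅-◃ ab ≅-refl) (≅-emb π))))
                 (sym (ℚP.*-identityʳ x))
  ... | no a≇b = trans (cong (_* c (N s (a ◃ t))) (trans (cong c (N-¬≅ a b a≇b)) c-0))
                   (trans (ℚP.*-zeroˡ (c (N s (a ◃ t)))) (sym (ℚP.*-zeroʳ x)))

-- [z^n] of Σ_F ρ(F) mult(a, F) z^|F|, by inserting a tree isomorphic to a (see ∑ₙ-mult)
M : Forest → PS
M a n = ∑ (allF n) λ s → ind (suc (size a) ℕ.+ size s ℕ.≟ n) * (ρ s * (1ℚ + mult a s))

-- Mark a tree of each forest and sort by it. Inserting `N-self` for the automorphisms leaves the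
-- factor `ρ a` and the summands of `M a`.
∑ₙ-ρ : ∀ n (K : Forest → ℚ) →
  ∑ₙ n (λ F → ρ F * ∑ (picks F) λ (b , _ , _) → K b) ≡ ∑ (allF n) (λ a → K a * ρ a * M a n)
∑ₙ-ρ n K = begin
  ∑ₙ n (λ F → ρ F * ∑ (picks F) λ (b , _ , _) → K b)
    ≡⟨ ∑-cong (allF n) (λ F → cong (ind (size F ℕ.≟ n) *_)
         (solve 3 (λ x i y → x :* i :* y := x :* y :* i) refl (c (N F F)) (inv (w F)) (∑ (picks F) λ (b , _ , _) → K b))) ⟩
  ∑ₙ n (λ F → c (N F F) * ∑ (picks F) (λ (b , _ , _) → K b) * inv (w F))
    ≡⟨ ∑ₙ-insert n _ (λ a s → c (N (a ◃ s) (a ◃ s)) * K a) (λ F → trans (sym (∑-*ˡ (picks F) (c (N F F)) _))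
         (∑-cong (picks F) λ (a , s , π) → cong (λ k → c k * K a) (N-resp (≅-sym (≅-emb π)) (≅-sym (≅-emb π))))) ⟩
  ∑ (allF n) (λ a → ∑ (allF n) λ s →
    ind (suc (size a) ℕ.+ size s ℕ.≟ n) * (c (N (a ◃ s) (a ◃ s)) * K a * (inv (w a) * inv (w s))))
    ≡⟨ ∑-cong (allF n) (λ a → trans (∑-cong (allF n) λ s → term a s) (∑-*ˡ (allF n) (K a * ρ a) _)) ⟩
  ∑ (allF n) (λ a → K a * ρ a * M a n) ∎
  where
  open ≡-Reasoning
  open +-*-Solver
  term : ∀ a s → ind (suc (size a) ℕ.+ size s ℕ.≟ n) * (c (N (a ◃ s) (a ◃ s)) * K a * (inv (w a) * inv (w s))) ≡
         K a * ρ a * (ind (suc (size a) ℕ.+ size s ℕ.≟ n) * (ρ s * (1ℚ + mult a s)))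
  term a s = trans (cong (λ x → ind (suc (size a) ℕ.+ size s ℕ.≟ n) * (x * K a * (inv (w a) * inv (w s)))) (N-self a s))
    (solve 7 (λ i x y m k u v → i :* (x :* y :* m :* k :* (u :* v)) := k :* (x :* u) :* (i :* (y :* v :* m))) refl
      (ind (suc (size a) ℕ.+ size s ℕ.≟ n)) (c (N a a)) (c (N s s)) (1ℚ + mult a s) (K a) (inv (w a)) (inv (w s)))

∑-ρ-class : ∀ a {k} → size a ≤ k → ∑ (allF k) (λ b → ind (a ≅? b) * ρ b) ≡ 1ℚ
∑-ρ-class a {k} le = begin
  ∑ (allF k) (λ b → ind (a ≅? b) * ρ b)         ≡⟨ ∑-cong (allF k) term ⟩
  ∑ (allF k) (λ b → inv (w a) * c (N a b))      ≡⟨ ∑-*ˡ (allF k) (inv (w a)) _ ⟩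
  inv (w a) * ∑ (allF k) (λ b → c (N a b))      ≡⟨ cong (inv (w a) *_) (∑-N a le) ⟩
  inv (w a) * c (w a)                           ≡⟨ trans (ℚP.*-comm (inv (w a)) (c (w a))) (c-inv (w≢0 a)) ⟩
  1ℚ                                            ∎
  where
  open ≡-Reasoning
  term : ∀ b → ind (a ≅? b) * ρ b ≡ inv (w a) * c (N a b)
  term b with a ≅? b
  ... | yes ab = trans (ℚP.*-identityˡ (ρ b)) (trans (ℚP.*-comm (c (N b b)) (inv (w b)))
                   (cong₂ (λ k l → inv k * c l) (sym (w-≅ ab)) (N-resp (≅-sym ab) ≅-refl)))
  ... | no a≇b = trans (ℚP.*-zeroˡ (ρ b)) (sym (trans (cong (λ k → inv (w a) * c k) (N-¬≅ a b a≇b))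
                   (trans (cong (inv (w a) *_) c-0) (ℚP.*-zeroʳ (inv (w a))))))

mult-≅ : a ≅ b → ∀ F → mult a F ≡ mult b F
mult-≅ {a} {b} ab F = ∑-cong (picks F) λ (x , _ , _) → ind-iff (a ≅? x) (b ≅? x) (≅-trans (≅-sym ab)) (≅-trans ab)

M-small : ∀ a n → n ≤ size a → M a n ≡ 0ℚ
M-small a n n≤a = ∑-zero (allF n) λ s → ind-zero (suc (size a) ℕ.+ size s ℕ.≟ n) (ρ s * (1ℚ + mult a s))
  λ e → ℕP.<⇒≱ (s≤s n≤a) (subst (suc (size a) ≤_) e (ℕP.m≤m+n (suc (size a)) (size s)))

-- By `∑ₙ-ρ` only forests b isomorphic to `a` contribute; for these `M b` agrees with `M a`, and
-- their weights `ρ b` add up to 1.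
∑ₙ-mult : ∀ a n → ∑ₙ n (λ F → ρ F * mult a F) ≡ M a n
∑ₙ-mult a n = begin
  ∑ₙ n (λ F → ρ F * mult a F)
    ≡⟨ ∑ₙ-ρ n (λ b → ind (a ≅? b)) ⟩
  ∑ (allF n) (λ b → ind (a ≅? b) * ρ b * M b n)
    ≡⟨ ∑-cong (allF n) (λ b → trans (ℚP.*-assoc (ind (a ≅? b)) (ρ b) (M b n)) (trans
         (ind-cong (a ≅? b) λ ab → cong (ρ b *_) (∑-cong (allF n) λ s → cong₂ (λ k x → ind (suc k ℕ.+ size s ℕ.≟ n) * (ρ s * (1ℚ + x)))
            (sym (size-≅ ab)) (mult-≅ (≅-sym ab) s)))
         (sym (ℚP.*-assoc (ind (a ≅? b)) (ρ b) (M a n))))) ⟩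
  ∑ (allF n) (λ b → ind (a ≅? b) * ρ b * M a n)
    ≡⟨ ∑-*ʳ (allF n) (M a n) _ ⟩
  ∑ (allF n) (λ b → ind (a ≅? b) * ρ b) * M a n
    ≡⟨ class ⟩
  M a n ∎
  where
  open ≡-Reasoning
  class : ∑ (allF n) (λ b → ind (a ≅? b) * ρ b) * M a n ≡ M a n
  class with size a ℕ.≤? n
  ... | yes a≤n = trans (cong (_* M a n) (∑-ρ-class a a≤n)) (ℚP.*-identityˡ (M a n))
  -- Here `allF n` may miss part of the class of `a`, but the tree is too large to occur and `M a n`
  -- is zero.
  ... | no  a≰n = trans (cong (x *_) z) (trans (ℚP.*-zeroʳ x) (sym z))
    where
    x = ∑ (allF n) (λ b → ind (a ≅? b) * ρ b)
    z = M-small a n (ℕP.<⇒≤ (ℕP.≰⇒> a≰n))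

-- By definition `M a` is z^(size a + 1) times the sum of the series of all forests and of the
-- series weighted by `mult a`; the latter is `M a` again by `∑ₙ-mult`.
M-step : ∀ a n → M a (suc (size a) ℕ.+ n) ≡ forestCount n + M a n
M-step a n = begin
  M a (k ℕ.+ n)
    ≡⟨ ∑-cong (allF (k ℕ.+ n)) (λ s → cong (_* (ρ s * (1ℚ + mult a s)))
         (ind-iff (k ℕ.+ size s ℕ.≟ k ℕ.+ n) (size s ℕ.≟ n) (ℕP.+-cancelˡ-≡ k (size s) n) (cong (k ℕ.+_)))) ⟩
  ∑ (allF (k ℕ.+ n)) (λ s → ind (size s ℕ.≟ n) * (ρ s * (1ℚ + mult a s)))
    ≡⟨ ∑ₙ-≤ (ℕP.m≤n+m n k) (λ s → ρ s * (1ℚ + mult a s)) ⟩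
  ∑ₙ n (λ s → ρ s * (1ℚ + mult a s))
    ≡⟨ trans (∑-cong (allF n) λ s → solve 3 (λ i r x → i :* (r :* (con 1ℚ :+ x)) := i :* r :+ i :* (r :* x)) refl
               (ind (size s ℕ.≟ n)) (ρ s) (mult a s)) (∑-+ (allF n) _ _) ⟩
  forestCount n + ∑ₙ n (λ s → ρ s * mult a s)
    ≡⟨ cong (forestCount n +_) (∑ₙ-mult a n) ⟩
  forestCount n + M a n ∎
  where
  open ≡-Reasoning
  open +-*-Solver
  k = suc (size a)

-- The series z^l Φ(z,1), as an indicator sum that later merges with the indicators in `eulerE`.
shifted : ℕ → PS
shifted l n = Σ< (suc n) λ j → ind (l ℕ.≟ j) * forestCount (n ∸ j)

shifted-< : ∀ l n → n < l → shifted l n ≡ 0ℚ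
shifted-< l n n<l = Σ<-zero (suc n) λ j j≤n → ind-zero (l ℕ.≟ j) (forestCount (n ∸ j))
  λ { refl → ℕP.<⇒≱ n<l (ℕP.≤-pred j≤n) }

shifted-+ : ∀ l n → shifted l (l ℕ.+ n) ≡ forestCount n
shifted-+ l n = trans
  (Σ<-single {l} {suc (l ℕ.+ n)} _ (s≤s (ℕP.m≤m+n l n)) λ j j≢l → ind-zero (l ℕ.≟ j) (forestCount (l ℕ.+ n ∸ j)) (j≢l ∘ sym))
  (trans (cong (_* forestCount (l ℕ.+ n ∸ l)) (ind-yes (l ℕ.≟ l) refl)) (trans (ℚP.*-identityˡ (forestCount (l ℕ.+ n ∸ l)))
    (cong forestCount (ℕP.m+n∸m≡n l n))))

shifted-shift : ∀ k l n → shifted (k ℕ.+ l) (k ℕ.+ n) ≡ shifted l n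
shifted-shift k l n with l ℕ.≤? n
... | no l≰n = trans (shifted-< (k ℕ.+ l) (k ℕ.+ n) (ℕP.+-monoʳ-< k (ℕP.≰⇒> l≰n))) (sym (shifted-< l n (ℕP.≰⇒> l≰n)))
... | yes l≤n with ℕP.m≤n⇒∃[o]m+o≡n l≤n
... | d , refl = trans (cong (shifted (k ℕ.+ l)) (sym (ℕP.+-assoc k l d)))
                   (trans (shifted-+ (k ℕ.+ l) d) (sym (shifted-+ l d)))

-- The geometric series from iterating `M-step`. Trees have at least one vertex, so `L` ≥ `n` terms
-- reach every multiple of the tree size up to `n`.
M-shifted : ∀ a L n → n ≤ L → M a n ≡ Σ< L (λ i → shifted (suc i ℕ.* suc (size a)) n)
M-shifted a zero    zero    _   = M-small a 0 z≤n
M-shifted a (suc L) n       n≤L with suc (size a) ℕ.≤? n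
... | no k≰n = trans (M-small a n (ℕP.≤-pred (ℕP.≰⇒> k≰n)))
       (sym (Σ<-zero (suc L) λ i _ → shifted-< (suc i ℕ.* suc (size a)) n
         (ℕP.<-≤-trans (ℕP.≰⇒> k≰n) (ℕP.m≤m+n (suc (size a)) (i ℕ.* suc (size a))))))
... | yes k≤n with ℕP.m≤n⇒∃[o]m+o≡n k≤n
... | d , refl = begin
  M a (k ℕ.+ d)
    ≡⟨ M-step a d ⟩
  forestCount d + M a d
    ≡⟨ cong₂ _+_ (sym (trans (cong (λ l → shifted l (k ℕ.+ d)) (ℕP.*-identityˡ k)) (shifted-+ k d)))
         (M-shifted a L d (ℕP.≤-trans (ℕP.m≤n+m d (size a)) (ℕP.≤-pred n≤L))) ⟩
  shifted (1 ℕ.* k) (k ℕ.+ d) + Σ< L (λ i → shifted (suc i ℕ.* k) d)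
    ≡⟨ cong (shifted (1 ℕ.* k) (k ℕ.+ d) +_) (Σ<-ext L λ i → shifted-shift k (suc i ℕ.* k) d) ⟨
  shifted (1 ℕ.* k) (k ℕ.+ d) + Σ< L (λ i → shifted (suc (suc i) ℕ.* k) (k ℕ.+ d))
    ≡⟨ Σ<-front L (λ i → shifted (suc i ℕ.* k) (k ℕ.+ d)) ⟨
  Σ< (suc L) (λ i → shifted (suc i ℕ.* k) (k ℕ.+ d)) ∎
  where
  open ≡-Reasoning
  k = suc (size a)

-- Euler's transform: both sides of forestCount-δ count the vertices of all unlabelled forests of size n.
module _ (t : PS) (t₀ : t 0 ≡ 0ℚ) (t-suc : ∀ n → t (suc n) ≡ forestCount n) where

  t-∑ : ∀ n k → k ≤ n → t k ≡ ∑ (allF n) (λ a → ind (suc (size a) ℕ.≟ k) * ρ a)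
  t-∑ n zero    _   = trans t₀ (sym (∑-zero (allF n) λ a → ℚP.*-zeroˡ (ρ a)))
  t-∑ n (suc k) k<n = trans (t-suc k) (trans (sym (∑ₙ-≤ (ℕP.<⇒≤ k<n) ρ)) (∑-cong (allF n) λ a →
    cong (_* ρ a) (ind-iff (size a ℕ.≟ k) (suc (size a) ℕ.≟ suc k) (cong suc) ℕP.suc-injective)))

  -- A range independent of `j` is required for interchanging sums. From i k = j and i ≥ 1 follows k
  -- ≤ j; also i ≤ j unless k = 0, and there the summand vanishes by `t₀`.
  eulerE-bound : ∀ n j → j ≤ n → eulerE t j ≡
    Σ< (suc n) (λ i → Σ< (suc n) λ k → ind ((1 ℕ.≤? i) ×-dec (i ℕ.* k ℕ.≟ j)) * (c k * t k))
  eulerE-bound n j j≤n = sym (trans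
    (Σ<-ext (suc n) λ i → Σ<-extend _ (s≤s j≤n) λ k j<k → ind-zero ((1 ℕ.≤? i) ×-dec (i ℕ.* k ℕ.≟ j)) (c k * t k)
      λ (1≤i , e) → ℕP.<⇒≱ j<k (ℕP.≤-trans (ℕP.≤-trans (ℕP.≤-reflexive (sym (ℕP.*-identityˡ k)))
        (ℕP.*-monoˡ-≤ k 1≤i)) (ℕP.≤-reflexive e)))
    (Σ<-extend _ (s≤s j≤n) λ i j<i → Σ<-zero (suc j) λ k _ → large i j<i k))
    where
    large : ∀ i → j < i → ∀ k → ind ((1 ℕ.≤? i) ×-dec (i ℕ.* k ℕ.≟ j)) * (c k * t k) ≡ 0ℚ
    large i j<i zero = trans (cong (λ x → ind ((1 ℕ.≤? i) ×-dec (i ℕ.* 0 ℕ.≟ j)) * (c 0 * x)) t₀)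
      (trans (cong (ind ((1 ℕ.≤? i) ×-dec (i ℕ.* 0 ℕ.≟ j)) *_) (ℚP.*-zeroʳ (c 0)))
             (ℚP.*-zeroʳ (ind ((1 ℕ.≤? i) ×-dec (i ℕ.* 0 ℕ.≟ j)))))
    large i j<i (suc k) = ind-zero ((1 ℕ.≤? i) ×-dec (i ℕ.* suc k ℕ.≟ j)) (c (suc k) * t (suc k))
      λ (_ , e) → ℕP.<⇒≱ j<i (subst (i ≤_) e (ℕP.m≤m*n i (suc k)))

  forestCount-δ : δ forestCount ≗ mul (eulerE t) forestCount
  forestCount-δ n = begin
    c n * forestCount n
      ≡⟨ ∑-*ˡ (allF n) (c n) _ ⟨
    ∑ (allF n) (λ F → c n * (ind (size F ℕ.≟ n) * ρ F))
      -- The factor n is the number of vertices of F, now counted tree by tree.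
      ≡⟨ ∑-cong (allF n) by-size ⟩
    ∑ₙ n (λ F → ρ F * ∑ (picks F) λ (b , _ , _) → c (suc (size b)))
      ≡⟨ ∑ₙ-ρ n (λ b → c (suc (size b))) ⟩
    ∑ (allF n) (λ a → c (suc (size a)) * ρ a * M a n)
      ≡⟨ ∑-cong (allF n) (λ a → by-tree-size a) ⟩
    ∑ (allF n) (λ a → Σ< (suc n) λ k → ind (suc (size a) ℕ.≟ k) * ρ a * (c k * U k))
      ≡⟨ ∑-Σ<-swap (allF n) (suc n) _ ⟩
    (Σ< (suc n) λ k → ∑ (allF n) λ a → ind (suc (size a) ℕ.≟ k) * ρ a * (c k * U k))
      ≡⟨ (Σ<-cong (suc n) λ k k≤n → trans (∑-*ʳ (allF n) (c k * U k) _)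
           (trans (cong (_* (c k * U k)) (sym (t-∑ n k (ℕP.≤-pred k≤n))))
             (solve 3 (λ x y z → x :* (y :* z) := y :* x :* z) refl (t k) (c k) (U k)))) ⟩
    (Σ< (suc n) λ k → c k * t k * U k)
      ≡⟨ (Σ<-ext (suc n) λ k → trans (sym (Σ<-*ˡ n (c k * t k) _)) (add-zero k)) ⟩
    (Σ< (suc n) λ k → Σ< (suc n) λ i → c k * t k * W i k)
      ≡⟨ Σ<-swap (suc n) (suc n) _ ⟩
    (Σ< (suc n) λ i → Σ< (suc n) λ k → c k * t k * W i k)
      ≡⟨ (Σ<-ext (suc n) λ i → Σ<-ext (suc n) λ k → trans (sym (Σ<-*ˡ (suc n) (c k * t k) _))
           (Σ<-ext (suc n) λ j → solve 3 (λ x y z → x :* (y :* z) := y :* x :* z) refl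
              (c k * t k) (ind ((1 ℕ.≤? i) ×-dec (i ℕ.* k ℕ.≟ j))) (forestCount (n ∸ j)))) ⟩
    (Σ< (suc n) λ i → Σ< (suc n) λ k → Σ< (suc n) λ j →
      ind ((1 ℕ.≤? i) ×-dec (i ℕ.* k ℕ.≟ j)) * (c k * t k) * forestCount (n ∸ j))
      ≡⟨ trans (Σ<-ext (suc n) λ i → Σ<-swap (suc n) (suc n) _) (Σ<-swap (suc n) (suc n) _) ⟩
    (Σ< (suc n) λ j → Σ< (suc n) λ i → Σ< (suc n) λ k →
      ind ((1 ℕ.≤? i) ×-dec (i ℕ.* k ℕ.≟ j)) * (c k * t k) * forestCount (n ∸ j))
      ≡⟨ (Σ<-cong (suc n) λ j j≤n → trans
           (trans (Σ<-ext (suc n) λ i → Σ<-*ʳ (suc n) (forestCount (n ∸ j)) _) (Σ<-*ʳ (suc n) (forestCount (n ∸ j)) _))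
           (cong (_* forestCount (n ∸ j)) (sym (eulerE-bound n j (ℕP.≤-pred j≤n))))) ⟩
    mul (eulerE t) forestCount n ∎
    where
    open ≡-Reasoning
    open +-*-Solver
    U : ℕ → ℚ
    U k = Σ< n λ i → shifted (suc i ℕ.* k) n
    W : ℕ → ℕ → ℚ
    W i k = Σ< (suc n) λ j → ind ((1 ℕ.≤? i) ×-dec (i ℕ.* k ℕ.≟ j)) * forestCount (n ∸ j)

    by-size : ∀ F → c n * (ind (size F ℕ.≟ n) * ρ F) ≡
              ind (size F ℕ.≟ n) * (ρ F * ∑ (picks F) λ (b , _ , _) → c (suc (size b)))
    by-size F = trans (solve 3 (λ x i r → x :* (i :* r) := i :* (r :* x)) refl (c n) (ind (size F ℕ.≟ n)) (ρ F))
      (ind-cong (size F ℕ.≟ n) λ { refl → cong (ρ F *_) (trans (c-size F) (trans (∑-verts-picks F λ _ → 1ℚ)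
        (∑-cong (picks F) λ (b , _ , _) → trans (cong (1ℚ +_) (sym (c-size b))) (sym (c-suc (size b)))))) })

    by-tree-size : ∀ a → c (suc (size a)) * ρ a * M a n ≡
                   Σ< (suc n) (λ k → ind (suc (size a) ℕ.≟ k) * ρ a * (c k * U k))
    by-tree-size a with suc (size a) ℕ.≤? n
    ... | yes k≤n = sym (trans
      (Σ<-single {suc (size a)} {suc n} _ (s≤s k≤n) λ k k≢ → trans
        (cong (λ x → x * ρ a * (c k * U k)) (ind-no (suc (size a) ℕ.≟ k) (k≢ ∘ sym)))
        (trans (cong (_* (c k * U k)) (ℚP.*-zeroˡ (ρ a))) (ℚP.*-zeroˡ (c k * U k))))
      (trans (cong₂ (λ x y → x * ρ a * (c (suc (size a)) * y)) (ind-yes (suc (size a) ℕ.≟ suc (size a)) refl)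
               (sym (M-shifted a n n ℕP.≤-refl)))
        (solve 3 (λ r x m → con 1ℚ :* r :* (x :* m) := x :* r :* m) refl (ρ a) (c (suc (size a))) (M a n))))
    ... | no k≰n = trans
      (trans (cong (c (suc (size a)) * ρ a *_) (M-small a n (ℕP.≤-pred (ℕP.≰⇒> k≰n)))) (ℚP.*-zeroʳ (c (suc (size a)) * ρ a)))
      (sym (Σ<-zero (suc n) λ k k≤n → trans
        (cong (λ x → x * ρ a * (c k * U k)) (ind-no (suc (size a) ℕ.≟ k) λ { refl → k≰n (ℕP.≤-pred k≤n) }))
        (trans (cong (_* (c k * U k)) (ℚP.*-zeroˡ (ρ a))) (ℚP.*-zeroˡ (c k * U k)))))

    -- The indicator of 1 ≤ i is zero at i = 0, so the range can start at 0 as it does in `eulerE`.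
    add-zero : ∀ k → Σ< n (λ i → c k * t k * shifted (suc i ℕ.* k) n) ≡ Σ< (suc n) (λ i → c k * t k * W i k)
    add-zero k = sym (trans (Σ<-front n _) (trans
      (cong₂ _+_ (trans (cong (c k * t k *_) (Σ<-zero (suc n) λ j _ → ℚP.*-zeroˡ (forestCount (n ∸ j)))) (ℚP.*-zeroʳ (c k * t k)))
        (Σ<-ext n λ i → cong (c k * t k *_) (Σ<-ext (suc n) λ j → cong (_* forestCount (n ∸ j))
          (ind-iff ((1 ℕ.≤? suc i) ×-dec (suc i ℕ.* k ℕ.≟ j)) (suc i ℕ.* k ℕ.≟ j) proj₂ λ e → s≤s z≤n , e))))
      (ℚP.+-identityˡ _)))

-- Forests on Fin n

module _ {n : ℕ} (p : Parent n) where

  iter-nothing : ∀ k → iter p k nothing ≡ nothing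
  iter-nothing zero    = refl
  iter-nothing (suc k) = iter-nothing k

  iter-+ : ∀ i j x → iter p (i ℕ.+ j) x ≡ iter p j (iter p i x)
  iter-+ zero    j x = refl
  iter-+ (suc i) j x = iter-+ i j (up p x)

  iter-suc : ∀ i x → iter p (suc i) x ≡ up p (iter p i x)
  iter-suc i x = trans (cong (λ k → iter p k x) (ℕP.+-comm 1 i)) (iter-+ i 1 x)

  module _ (p-forest : IsForest p) where

    forest-induction : (Q : Fin n → Set) → (∀ x → (∀ y → p x ≡ just y → Q y) → Q x) → ∀ x → Q x
    forest-induction Q step x = go n x (p-forest x)
      where
      go : ∀ k x → iter p k (just x) ≡ nothing → Q x
      go (suc k) x e = step x λ y px → go k y (trans (cong (iter p k) (sym px)) e)

    -- A cycle through z also passes through the parent of z; induction from the roots excludes it.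
    acyclic : ∀ z e → iter p (suc e) (just z) ≢ just z
    acyclic = forest-induction (λ z → ∀ e → iter p (suc e) (just z) ≢ just z) step
      where
      step : ∀ z → (∀ y → p z ≡ just y → ∀ e → iter p (suc e) (just y) ≢ just y) →
             ∀ e → iter p (suc e) (just z) ≢ just z
      step z ih e eq with p z in pz
      ... | nothing with () ← trans (sym (iter-nothing e)) eq
      ... | just y = ih y refl e (trans (iter-suc e (just y)) (trans (cong (up p) eq) pz))

    -- From `w` at least one step leads to `w′`. The first of these steps ends at p w = p w′, so
    -- `w′` would lie on a cycle.
    no-chain : ∀ {u w w′} i j → i < j → p w ≡ p w′ →
               iter p i (just u) ≡ just w → iter p j (just u) ≢ just w′
    no-chain {u} {w} {w′} i j i<j pww′ ei ej with ℕP.m≤n⇒∃[o]m+o≡n i<j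
    ... | d , refl = acyclic w′ d (trans (cong (iter p d) (sym pww′)) (trans (sym (cong (iter p (suc d)) ei))
           (trans (sym (iter-+ i (suc d) (just u))) (trans (cong (λ k → iter p k (just u)) (ℕP.+-suc i d)) ej))))

    ancestor-unique : ∀ {u w w′} i j → p w ≡ p w′ →
      iter p i (just u) ≡ just w → iter p j (just u) ≡ just w′ → w ≡ w′
    ancestor-unique i j pww′ ei ej with ℕP.<-cmp i j
    ... | tri≈ _ refl _ = MaybeP.just-injective (trans (sym ei) ej)
    ... | tri< i<j _ _  = ⊥-elim (no-chain i j i<j pww′ ei ej)
    ... | tri> _ _ j<i  = ⊥-elim (no-chain j i j<i (sym pww′) ej ei)

allFin-complete : ∀ {n} (i : Fin n) → i ∈ allFin n
allFin-complete i = AnyP.tabulate⁺ i refl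

allFin-distinct : ∀ n → AllPairs _≢_ (allFin n)
allFin-distinct n = AllPairsP.tabulate⁺ id

module _ {n : ℕ} {p q : Parent n} {σ : Fin n → Fin n} where

  Iso⇒IsIso : Iso p q σ → IsIso p q σ
  Iso⇒IsIso I = ((λ i j → inj I) , surj I) , adj , λ v → (λ pv → trans (comm I v) (cong (Maybe.map σ) pv)) ,
    λ qv → unmap (p v) (trans (sym (comm I v)) qv)
    where
    unmap : ∀ m → Maybe.map σ m ≡ nothing → m ≡ nothing
    unmap nothing _ = refl
    unmap-just : ∀ m {v} → Maybe.map σ m ≡ just (σ v) → m ≡ just v
    unmap-just (just u) e = cong just (inj I (MaybeP.just-injective e))
    edge : ∀ u v → p u ≡ just v → q (σ u) ≡ just (σ v)
    edge u v pu = trans (comm I u) (cong (Maybe.map σ) pu)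
    edge⁻ : ∀ u v → q (σ u) ≡ just (σ v) → p u ≡ just v
    edge⁻ u v qu = unmap-just (p u) (trans (sym (comm I u)) qu)
    adj : ∀ u v → Iff (Adj p u v) (Adj q (σ u) (σ v))
    adj u v = Sum.map (edge u v) (edge v u) , Sum.map (edge⁻ u v) (edge⁻ v u)

  -- By induction on the depth of v: σ cannot reverse the edge from v to its parent w,
  -- because the parent edge of w is already known to be preserved.
  IsIso⇒Iso : IsForest p → IsIso p q σ → Iso p q σ
  IsIso⇒Iso forest ((i , s) , adj , rt) = record { inj = λ {x} {x′} → i x x′ ; surj = s ; comm = commutes }
    where
    step : ∀ v → (∀ w → p v ≡ just w → q (σ w) ≡ Maybe.map σ (p w)) → q (σ v) ≡ Maybe.map σ (p v)
    step v ih with p v in pv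
    ... | nothing = proj₁ (rt v) pv
    ... | just w with proj₁ (adj v w) (inj₁ pv)
    ...   | inj₁ e = e
    ...   | inj₂ e = ⊥-elim (reversed (p w) refl (trans (sym (ih w refl)) e))
      where
      reversed : ∀ m → p w ≡ m → Maybe.map σ m ≢ just (σ v)
      reversed (just v′) pw e′ = acyclic p forest v 1 (trans (cong (up p) pv)
        (trans pw (cong just (i v′ v (MaybeP.just-injective e′)))))
    commutes : ∀ v → q (σ v) ≡ Maybe.map σ (p v)
    commutes = forest-induction p forest _ step

autList-enum : ∀ {n} {p : Parent n} → IsForest p → Enum p p (autList p)
autList-enum {n} {p} forest = Enum-filter (isIso? p p) (IsIso⇒Iso forest) Iso⇒IsIso (maps-complete n n) (maps-distinct n n)

-- The plane forest of a labelled forest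

module _ {n : ℕ} (p : Parent n) where

  children : Maybe (Fin n) → List (Fin n)
  children x = filter (λ w → MaybeP.≡-dec FinP._≟_ (p w) x) (allFin n)

  -- The plane forest hanging from the siblings `ws`, cut off after `k` levels. In a forest on n
  -- vertices `IsForest` puts every vertex within n levels.
  build : ℕ → List (Fin n) → Forest
  build zero    ws       = ∅
  build (suc k) []       = ∅
  build (suc k) (w ∷ ws) = build k (children (just w)) ◃ build (suc k) ws

  shape : Forest
  shape = build n (children nothing)

  place : ∀ k ws → V (build k ws) → Fin n
  place (suc k) (w ∷ ws) root     = w
  place (suc k) (w ∷ ws) (down x) = place k (children (just w)) x
  place (suc k) (w ∷ ws) (next y) = place (suc k) ws y

  children-parent : ∀ x → All (λ w → p w ≡ x) (children x)
  children-parent x = AllP.all-filter (λ w → MaybeP.≡-dec FinP._≟_ (p w) x) (allFin n)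

  children-complete : ∀ {w x} → p w ≡ x → w ∈ children x
  children-complete {w} {x} e = ∈P.∈-filter⁺ (λ w → MaybeP.≡-dec FinP._≟_ (p w) x) (allFin-complete w) e

  children-distinct : ∀ x → AllPairs _≢_ (children x)
  children-distinct x = AllPairsP.filter⁺ (λ w → MaybeP.≡-dec FinP._≟_ (p w) x) (allFin-distinct n)

  place-par : ∀ k ws y → All (λ w → p w ≡ y) ws → ∀ x → p (place k ws x) ≡ maybe′ (just ∘ place k ws) y (par x)
  place-par (suc k) (w ∷ ws) y (e ∷ es) root     = e
  place-par (suc k) (w ∷ ws) y (e ∷ es) (down x)
    with par x | place-par k (children (just w)) (just w) (children-parent (just w)) x
  ... | nothing | ih = ih
  ... | just _  | ih = ih
  place-par (suc k) (w ∷ ws) y (e ∷ es) (next x) with par x | place-par (suc k) ws y es x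
  ... | nothing | ih = ih
  ... | just _  | ih = ih

  place-ancestor : ∀ k ws x → ∃ λ w → w ∈ ws × ∃ λ j → iter p j (just (place k ws x)) ≡ just w
  place-ancestor (suc k) (w ∷ ws) root     = w , here refl , 0 , refl
  place-ancestor (suc k) (w ∷ ws) (down x) with place-ancestor k (children (just w)) x
  ... | c , c∈ , j , e = w , here refl , suc j , trans (iter-suc p j _) (trans (cong (up p) e)
          (All.lookup (children-parent (just w)) c∈))
  place-ancestor (suc k) (w ∷ ws) (next x) with place-ancestor (suc k) ws x
  ... | w′ , w′∈ , j , e = w′ , there w′∈ , j , e

  place-surj : ∀ k ws v w j → j < k → iter p j (just v) ≡ just w → w ∈ ws → ∃ λ x → place k ws x ≡ v
  place-surj (suc k) (w ∷ ws) v w′ j       lt e (there w′∈)  =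
    let (x , ex) = place-surj (suc k) ws v w′ j lt e w′∈ in next x , ex
  place-surj (suc k) (w ∷ ws) v .w zero    lt e (here refl) = root , sym (MaybeP.just-injective e)
  place-surj (suc k) (w ∷ ws) v .w (suc j) (s≤s lt) e (here refl)
    with iter p j (just v) in eq | trans (sym (iter-suc p j (just v))) e
  ... | just u | pu = let (x , ex) = place-surj k (children (just w)) v u j lt eq (children-complete pu) in down x , ex

  module _ (forest : IsForest p) where

    -- A vertex placed twice would either lie strictly below itself, against `acyclic`, or descend
    -- from two distinct siblings, against `ancestor-unique`.
    place-inj : ∀ k ws y → All (λ w → p w ≡ y) ws → AllPairs _≢_ ws →
                ∀ x x′ → place k ws x ≡ place k ws x′ → x ≡ x′
    place-inj (suc k) (w ∷ ws) y (e ∷ es) (w≢ ∷ ≢s) = go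
      where
      child-loop : ∀ x → w ≢ place k (children (just w)) x
      child-loop x eq with place-ancestor k (children (just w)) x
      ... | c , c∈ , j , a = acyclic p forest w j (trans (iter-suc p j (just w)) (trans
              (cong (up p) (trans (cong (λ v → iter p j (just v)) eq) a)) (All.lookup (children-parent (just w)) c∈)))
      separate : ∀ v j x → iter p j (just v) ≡ just w → v ≢ place (suc k) ws x
      separate v j x a eq with place-ancestor (suc k) ws x
      ... | w′ , w′∈ , j′ , a′ = All.lookup w≢ w′∈ (ancestor-unique p forest j j′ (trans e (sym (All.lookup es w′∈))) a
              (trans (cong (λ v → iter p j′ (just v)) eq) a′))
      below : ∀ x → ∃ λ j → iter p j (just (place k (children (just w)) x)) ≡ just w
      below x with place-ancestor k (children (just w)) x
      ... | c , c∈ , j , a = suc j , trans (iter-suc p j _) (trans (cong (up p) a) (All.lookup (children-parent (just w)) c∈))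
      go : ∀ x x′ → place (suc k) (w ∷ ws) x ≡ place (suc k) (w ∷ ws) x′ → x ≡ x′
      go root     root      eq = refl
      go root     (down x′) eq = ⊥-elim (child-loop x′ eq)
      go root     (next x′) eq = ⊥-elim (separate w 0 x′ refl eq)
      go (down x) root      eq = ⊥-elim (child-loop x (sym eq))
      go (down x) (down x′) eq = cong down (place-inj k (children (just w)) (just w) (children-parent (just w))
                                   (children-distinct (just w)) x x′ eq)
      go (down x) (next x′) eq = ⊥-elim (separate _ (proj₁ (below x)) x′ (proj₂ (below x)) eq)
      go (next x) root      eq = ⊥-elim (separate w 0 x refl (sym eq))
      go (next x) (down x′) eq = ⊥-elim (separate _ (proj₁ (below x′)) x (proj₂ (below x′)) (sym eq))
      go (next x) (next x′) eq = cong next (place-inj (suc k) ws y es ≢s x x′ eq)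

    root-above : ∀ k v → iter p k (just v) ≡ nothing → ∃ λ r → p r ≡ nothing × ∃ λ j → j < k × iter p j (just v) ≡ just r
    root-above (suc k) v e with p v in pv
    ... | nothing = v , pv , 0 , s≤s z≤n , refl
    ... | just u with root-above k u e
    ...   | r , pr , j , j<k , a = r , pr , suc j , s≤s j<k , trans (cong (iter p j) pv) a

    shape-iso : Iso (par {shape}) p (place n (children nothing))
    shape-iso = record
      { inj  = λ {x} {x′} → place-inj n (children nothing) nothing (children-parent nothing) (children-distinct nothing) x x′
      ; surj = λ v → let (r , pr , j , j<n , a) = root-above n v (forest v) in
                 place-surj n (children nothing) v r j j<n a (children-complete pr)
      ; comm = λ x → trans (place-par n (children nothing) nothing (children-parent nothing) x) (maybe-map (par x))
      }
      where
      maybe-map : ∀ m → maybe′ (just ∘ place n (children nothing)) nothing m ≡ Maybe.map (place n (children nothing)) m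
      maybe-map nothing  = refl
      maybe-map (just _) = refl

    shape-inverse : Iso p (par {shape}) (inverse shape-iso)
    shape-inverse = Iso-inverse shape-iso

Isomorphic⇒≅ : ∀ {n} {p q : Parent n} → IsForest p → {g : V G → Fin n} → Iso par q g → Isomorphic p q → shape p ≅ G
Isomorphic⇒≅ {p = p} forest J (σ , I) = _ , Iso-∘ (Iso-inverse J) (Iso-∘ (IsIso⇒Iso forest I) (shape-iso p forest))

≅⇒Isomorphic : ∀ {n} {p q : Parent n} {f : V F → Fin n} {g : V G → Fin n} →
               Iso par p f → Iso par q g → F ≅ G → Isomorphic p q
≅⇒Isomorphic I J (_ , K) = _ , Iso⇒IsIso (Iso-∘ J (Iso-∘ K (Iso-inverse I)))

-- The labelled forest of a plane forest

depth : V F → ℕ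
depth root     = 0
depth (down x) = suc (depth x)
depth (next y) = depth y

depth-par : (x y : V F) → par x ≡ just y → depth y < depth x
depth-par (down x) y e with par x in eq
depth-par (down x) y refl | nothing = s≤s z≤n
depth-par (down x) y refl | just z  = s≤s (depth-par x z eq)
depth-par (next x) y e with par x in eq
depth-par (next x) y refl | just z  = depth-par x z eq

depth<size : (x : V F) → depth x < size F
depth<size root = s≤s z≤n
depth<size {a ◃ s} (down x) = s≤s (ℕP.<-≤-trans (depth<size x) (ℕP.m≤m+n (size a) (size s)))
depth<size {a ◃ s} (next y) = ℕP.m<n⇒m<1+n (ℕP.<-≤-trans (depth<size y) (ℕP.m≤n+m (size s) (size a)))

-- `RepSystem` speaks of labelled forests, so a plane forest has to be labelled before the class can
-- be tested on it, as happens in `∑-rep`.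
labelled : ∀ G → ∃ λ (p : Parent (size G)) → IsForest p × ∃ (Iso (par {G}) p)
labelled G = lab , (λ v → forest (size G) v (depth<size (fromFin v))) , toFin , record
  { inj = toFin-injective ; surj = λ i → fromFin i , toFin-fromFin i
  ; comm = λ x → cong (Maybe.map toFin ∘ par) (fromFin-toFin x) }
  where
  lab : Parent (size G)
  lab i = Maybe.map toFin (par (fromFin {G} i))
  forest : ∀ k v → depth (fromFin {G} v) < k → iter lab k (just v) ≡ nothing
  forest (suc k) v lt with par (fromFin {G} v) in eq
  ... | nothing = iter-nothing lab k
  ... | just y  = forest k (toFin y) (subst (_< k) (cong depth (sym (fromFin-toFin y)))
                    (ℕP.<-≤-trans (depth-par (fromFin v) y eq) (ℕP.≤-pred lt)))

labelledₙ : ∀ G {n} → size G ≡ n → ∃ λ (p : Parent n) → IsForest p × ∃ (Iso (par {G}) p)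
labelledₙ G refl = labelled G

-- Transfer of sums over representatives to plane forests

aut-≅ : F ≅ G → ∀ m → aut F m ≡ aut G m
aut-≅ {F} {G} (f , I) m = ∑-transport I I (isos-enum F F) (isos-enum G G) λ σ τ _ e →
  cong (λ k → ind (k ℕ.≟ m)) (c-injective (trans (c-fix σ) (trans
    (∑-cong (verts F) λ v → ind-iff (σ v ≟ⱽ v) (τ (f v) ≟ⱽ f v) (λ e′ → trans (e v) (cong f e′)) (λ e′ → inj I (trans (sym (e v)) e′)))
    (trans (∑-verts-≅ I λ v → ind (τ v ≟ⱽ v)) (sym (c-fix τ))))))

c-fixCount : ∀ {n} (σ : Fin n → Fin n) → c (fixCount σ) ≡ ∑ (allFin n) (λ v → ind (σ v FinP.≟ v))
c-fixCount {n} σ = c-count (λ v → σ v FinP.≟ v) (allFin n)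

module _ {n : ℕ} {p : Parent n} (forest : IsForest p) where

  fixCount-fix : {σ : Fin n → Fin n} {τ : V (shape p) → V (shape p)} →
    (∀ v → τ (inverse (shape-iso p forest) v) ≡ inverse (shape-iso p forest) (σ v)) → fixCount σ ≡ fix τ
  fixCount-fix {σ} {τ} e = c-injective (trans (c-fixCount σ) (trans
    (∑-cong (allFin n) λ v → ind-iff (σ v FinP.≟ v) (τ (β v) ≟ⱽ β v) (λ e′ → trans (e v) (cong β e′))
       (λ e′ → inj B (trans (sym (e v)) e′)))
    (trans (∑-bijection B allFin-complete (allFin-distinct n) verts-complete (verts-distinct (shape p)) λ v → ind (τ v ≟ⱽ v))
      (sym (c-fix τ)))))
    where
    B = shape-inverse p forest
    β = inverse (shape-iso p forest)

  length-autList : length (autList p) ≡ N (shape p) (shape p)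
  length-autList = c-injective (trans (c-length (autList p)) (trans
    (∑-transport B B (autList-enum forest) (isos-enum (shape p) (shape p)) λ _ _ _ _ → refl) (sym (c-N (shape p) (shape p)))))
    where B = shape-inverse p forest

  autWeight-shape : ∀ m → autWeight p m ≡ aut (shape p) m * inv (N (shape p) (shape p))
  autWeight-shape m = trans (frac-c (length (filter (λ σ → fixCount σ ℕ.≟ m) (autList p))) (length (autList p))) (cong₂ _*_
    (trans (c-count (λ σ → fixCount σ ℕ.≟ m) (autList p)) (∑-transport B B (autList-enum forest) (isos-enum (shape p) (shape p))
      λ σ τ _ e → cong (λ k → ind (k ℕ.≟ m)) (fixCount-fix e)))
    (cong inv length-autList))
    where B = shape-inverse p forest

N≢0 : ∀ F → N F F ≢ 0
N≢0 F = Enum-nonempty (isos-enum F F) ≅-refl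

-- The plane forests isomorphic to F have total weight 1/|Aut F|.
aut-class : ∀ F m → ∑ (allF (size F)) (λ G → ind (F ≅? G) * (aut G m * inv (w G))) ≡ aut F m * inv (N F F)
aut-class F m = begin
  ∑ (allF (size F)) (λ G → ind (F ≅? G) * (aut G m * inv (w G)))
    ≡⟨ ∑-cong (allF (size F)) term ⟩
  ∑ (allF (size F)) (λ G → aut F m * inv (w F) * (inv (N F F) * c (N F G)))
    ≡⟨ trans (∑-*ˡ (allF (size F)) (aut F m * inv (w F)) _) (cong (aut F m * inv (w F) *_) (∑-*ˡ (allF (size F)) (inv (N F F)) _)) ⟩
  aut F m * inv (w F) * (inv (N F F) * ∑ (allF (size F)) (λ G → c (N F G)))
    ≡⟨ cong (λ x → aut F m * inv (w F) * (inv (N F F) * x)) (∑-N F ℕP.≤-refl) ⟩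
  aut F m * inv (w F) * (inv (N F F) * c (w F))
    ≡⟨ solve 4 (λ x i j y → x :* i :* (j :* y) := i :* (y :* (x :* j))) refl (aut F m) (inv (w F)) (inv (N F F)) (c (w F)) ⟩
  inv (w F) * (c (w F) * (aut F m * inv (N F F)))
    ≡⟨ inv-c-cancel (aut F m * inv (N F F)) (w≢0 F) ⟩
  aut F m * inv (N F F) ∎
  where
  open ≡-Reasoning
  open +-*-Solver
  term : ∀ G → ind (F ≅? G) * (aut G m * inv (w G)) ≡ aut F m * inv (w F) * (inv (N F F) * c (N F G))
  term G with F ≅? G
  ... | yes FG = trans (ℚP.*-identityˡ (aut G m * inv (w G))) (trans
          (cong₂ (λ x k → x * inv k) (sym (aut-≅ FG m)) (sym (w-≅ FG)))
          (sym (trans (cong (λ k → aut F m * inv (w F) * (inv (N F F) * c k)) (N-resp ≅-refl (≅-sym FG)))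
            (trans (cong (aut F m * inv (w F) *_) (trans (ℚP.*-comm (inv (N F F)) (c (N F F))) (c-inv (N≢0 F))))
              (ℚP.*-identityʳ (aut F m * inv (w F)))))))
  ... | no F≇G = trans (ℚP.*-zeroˡ (aut G m * inv (w G))) (sym (trans
          (cong (λ k → aut F m * inv (w F) * (inv (N F F) * k)) (trans (cong c (N-¬≅ F G F≇G)) c-0))
          (trans (cong (aut F m * inv (w F) *_) (ℚP.*-zeroʳ (inv (N F F)))) (ℚP.*-zeroʳ (aut F m * inv (w F))))))

shape-size : ∀ {n} {p : Parent n} → IsForest p → size (shape p) ≡ n
shape-size {n} {p} forest = c-injective (trans (c-size (shape p)) (trans
  (sym (∑-bijection (shape-inverse p forest) allFin-complete (allFin-distinct n) verts-complete (verts-distinct (shape p)) λ _ → 1ℚ))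
  (trans (sym (c-length (allFin n))) (cong c (ListP.length-tabulate id)))))

-- χ must be 1 on the class P, and outside of P may be nonzero only where aut vanishes; so P need not
-- be decidable.
∑-rep : ∀ {n} {P : Parent n → Set} {L : List (Parent n)} (χ : Forest → ℚ) (m : ℕ) →
  (∀ {p} → P p → IsForest p) → RepSystem P L →
  (∀ {G p} {g : V G → Fin n} → Iso par p g → P p → χ G ≡ 1ℚ) →
  (∀ {G p} {g : V G → Fin n} → Iso par p g → IsForest p → ¬ P p → χ G * (aut G m * inv (w G)) ≡ 0ℚ) →
  ∑ L (λ p → autWeight p m) ≡ ∑ₙ n (λ G → χ G * (aut G m * inv (w G)))
∑-rep {n} {P} {L} χ m forest (allP , reps) χ-in χ-out = begin
  ∑ L (λ p → autWeight p m)
    ≡⟨ ∑-All (All.map weight allP) ⟩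
  ∑ L (λ p → ∑ (allF n) λ G → ind (shape p ≅? G) * (aut G m * inv (w G)))
    ≡⟨ ∑-swap L (allF n) _ ⟩
  ∑ (allF n) (λ G → ∑ L λ p → ind (shape p ≅? G) * (aut G m * inv (w G)))
    ≡⟨ ∑-cong (allF n) (λ G → trans (∑-*ʳ L (aut G m * inv (w G)) _) (by-size G (size G ℕ.≟ n))) ⟩
  ∑ₙ n (λ G → χ G * (aut G m * inv (w G))) ∎
  where
  open ≡-Reasoning
  weight : ∀ {p} → P p → autWeight p m ≡ ∑ (allF n) (λ G → ind (shape p ≅? G) * (aut G m * inv (w G)))
  weight {p} Pp = trans (autWeight-shape (forest Pp) m) (trans (sym (aut-class (shape p) m))
    (cong (λ k → ∑ (allF k) λ G → ind (shape p ≅? G) * (aut G m * inv (w G))) (shape-size (forest Pp))))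

  P-lookup : ∀ i → P (lookup L i)
  P-lookup i = All.lookup allP (∈P.∈-lookup i)

  representative : ∀ {G q} {g : V G → Fin n} → Iso par q g → P q → ∑ L (λ p → ind (shape p ≅? G)) ≡ 1ℚ
  representative {G} {q} J Pq with reps q Pq
  ... | i , iso , uniq = trans
    (∑-single L (λ p → ind (shape p ≅? G)) i λ j j≢i → ind-no (shape (lookup L j) ≅? G) λ sG → j≢i (uniq j
      (≅⇒Isomorphic J (shape-iso (lookup L j) (forest (P-lookup j))) (≅-sym sG))))
    (ind-yes (shape (lookup L i) ≅? G) (≅-trans
      (≅-sym (Isomorphic⇒≅ (forest Pq) (shape-iso (lookup L i) (forest (P-lookup i))) iso))
      (Isomorphic⇒≅ (forest Pq) J (id , Iso⇒IsIso Iso-id))))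

  by-size : ∀ G → (size? : Dec (size G ≡ n)) →
    ∑ L (λ p → ind (shape p ≅? G)) * (aut G m * inv (w G)) ≡ ind size? * (χ G * (aut G m * inv (w G)))
  by-size G (no ≢n) = trans
    (cong (_* (aut G m * inv (w G))) (trans (∑-All (All.map (λ {p} Pp → ind-no (shape p ≅? G)
        λ sG → ≢n (trans (sym (size-≅ sG)) (shape-size (forest Pp)))) allP)) (∑-zero L λ _ → refl)))
    (trans (ℚP.*-zeroˡ (aut G m * inv (w G))) (sym (ℚP.*-zeroˡ (χ G * (aut G m * inv (w G))))))
  by-size G (yes e) = trans value (sym (ℚP.*-identityˡ (χ G * (aut G m * inv (w G)))))
    where
    value : ∑ L (λ p → ind (shape p ≅? G)) * (aut G m * inv (w G)) ≡ χ G * (aut G m * inv (w G))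
    -- Whether `G` is isomorphic to an entry of `L` is decidable and stands in for membership in
    -- `P`. If there is no such entry, `P` fails for a labelling of `G`, since `representative`
    -- would turn a zero sum into 1.
    value with Any.any? (λ p → shape p ≅? G) L
    ... | yes found = let (i , sG) = index found in
            let Pp = P-lookup i ; J = Iso-∘ (shape-iso (lookup L i) (forest Pp)) (proj₂ (≅-sym sG)) in
            cong (_* (aut G m * inv (w G))) (trans (representative J Pp) (sym (χ-in J Pp)))
      where
      index : ∀ {Ps} → Any (λ p → shape p ≅ G) Ps → ∃ λ i → shape (lookup Ps i) ≅ G
      index (here sG) = fzero , sG
      index (there a) = let (i , sG) = index a in fsuc i , sG
    ... | no none = let (q , q-forest , g , J) = labelledₙ G e in trans
            (trans (cong (_* (aut G m * inv (w G))) (zero-sum L none)) (ℚP.*-zeroˡ (aut G m * inv (w G))))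
            (sym (χ-out J q-forest λ Pq → 1≢0 (trans (sym (representative J Pq)) (zero-sum L none))))
      where
      zero-sum : ∀ Ps → ¬ Any (λ p → shape p ≅ G) Ps → ∑ Ps (λ p → ind (shape p ≅? G)) ≡ 0ℚ
      zero-sum []       _ = refl
      zero-sum (p ∷ Ps) ¬a = trans (cong₂ _+_ (ind-no (shape p ≅? G) (¬a ∘ here)) (zero-sum Ps (¬a ∘ there))) refl
      1≢0 : 1ℚ ≢ 0ℚ
      1≢0 ()

-- Trees

χ-tree : Forest → ℚ
χ-tree (a ◃ ∅) = 1ℚ
χ-tree _       = 0ℚ

χ-tree-in : ∀ {n} {p : Parent n} {g : V G → Fin n} → Iso par p g → IsTree p → χ-tree G ≡ 1ℚ
χ-tree-in {∅}         J (_ , r , _) with () ← proj₁ (surj J r)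
χ-tree-in {a ◃ ∅}     J _ = refl
χ-tree-in {a ◃ b ◃ s} {p = p} {g} J (_ , r , _ , uniq)
  with () ← inj J (trans (uniq (g root) (comm J root)) (sym (uniq (g (next root)) (comm J (next root)))))

χ-tree-out : ∀ {n} {p : Parent n} {g : V G → Fin n} (x : ℚ) → Iso par p g → IsForest p → ¬ IsTree p → χ-tree G * x ≡ 0ℚ
χ-tree-out {∅}         x J forest ¬tree = ℚP.*-zeroˡ x
χ-tree-out {a ◃ b ◃ s} x J forest ¬tree = ℚP.*-zeroˡ x
χ-tree-out {a ◃ ∅} {p = p} {g} x J forest ¬tree = contradiction (forest , g root , comm J root , unique-root) ¬tree
  where
  unique-root : ∀ v → p v ≡ nothing → v ≡ g root
  unique-root v e with inverse J v in eq | trans (comm (Iso-inverse J) v) (cong (Maybe.map (inverse J)) e)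
  ... | root | _ = trans (sym (inverseʳ J v)) (cong g eq)

∑-allF-∅ : ∀ k (f : Forest → ℚ) → (∀ b t → f (b ◃ t) ≡ 0ℚ) → ∑ (allF k) f ≡ f ∅
∑-allF-∅ zero    f z = ℚP.+-identityʳ (f ∅)
∑-allF-∅ (suc k) f z = trans (∑-allF k f) (trans
  (cong (f ∅ +_) (∑-zero (allF k) λ b → ∑-zero (allF k) λ t → z b t)) (ℚP.+-identityʳ (f ∅)))

-- The virtual root of a tree a ◃ ∅ has one child and contributes 1! = 1, so the tree has weight
-- `w a`; its automorphisms are counted by `aut-tree`.
∑ₙ-tree : ∀ n m → ∑ₙ n (λ G → χ-tree G * (aut G m * inv (w G))) ≡ shiftZU Φ n m
∑ₙ-tree zero    m = trans (ℚP.+-identityʳ _) (trans (ℚP.*-identityˡ _) (ℚP.*-zeroˡ (aut ∅ m * inv (w ∅))))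
∑ₙ-tree (suc n) m = begin
  ∑ₙ (suc n) (λ G → χ-tree G * (aut G m * inv (w G)))
    ≡⟨ ∑-allF n f ⟩
  f ∅ + ∑ (allF n) (λ a → ∑ (allF n) λ s → f (a ◃ s))
    ≡⟨ trans (cong (_+ ∑ (allF n) λ a → ∑ (allF n) λ s → f (a ◃ s)) (ℚP.*-zeroˡ (χ-tree ∅ * (aut ∅ m * inv (w ∅)))))
         (ℚP.+-identityˡ _) ⟩
  ∑ (allF n) (λ a → ∑ (allF n) λ s → f (a ◃ s))
    ≡⟨ ∑-cong (allF n) (λ a → trans (∑-allF-∅ n (λ s → f (a ◃ s)) λ b t → trans
         (cong (ind (size (a ◃ b ◃ t) ℕ.≟ suc n) *_) (ℚP.*-zeroˡ (aut (a ◃ b ◃ t) m * inv (w (a ◃ b ◃ t)))))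
         (ℚP.*-zeroʳ (ind (size (a ◃ b ◃ t) ℕ.≟ suc n)))) (tree a)) ⟩
  ∑ (allF n) (λ a → ind (suc (size a) ℕ.≟ suc n) * (treeAut a m * inv (w a)))
    ≡⟨ shiftZU-Φ n (suc n) m ℕP.≤-refl ⟨
  shiftZU Φ (suc n) m ∎
  where
  open ≡-Reasoning
  f : Forest → ℚ
  f G = ind (size G ℕ.≟ suc n) * (χ-tree G * (aut G m * inv (w G)))
  tree : ∀ a → f (a ◃ ∅) ≡ ind (suc (size a) ℕ.≟ suc n) * (treeAut a m * inv (w a))
  tree a = cong₂ _*_ (cong (λ k → ind (suc k ℕ.≟ suc n)) (ℕP.+-identityʳ (size a)))
    (trans (ℚP.*-identityˡ (aut (a ◃ ∅) m * inv (w (a ◃ ∅)))) (cong₂ (λ x k → x * inv k) (aut-tree a m)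
      (trans (ℕP.*-identityˡ (w a ℕ.* 1)) (ℕP.*-identityʳ (w a)))))

∑-trees : ∀ n {L} → RepSystem (IsTree {n}) L → ∀ m → ∑ L (λ p → autWeight p m) ≡ shiftZU Φ n m
∑-trees n rep m = trans
  (∑-rep {n} {IsTree} χ-tree m proj₁ rep χ-tree-in λ {G} → χ-tree-out (aut G m * inv (w G))) (∑ₙ-tree n m)

autWeight-total : ∀ {n} {p : Parent n} → IsForest p → Σ< (suc n) (autWeight p) ≡ 1ℚ
autWeight-total {n} {p} forest = begin
  Σ< (suc n) (autWeight p)                                   ≡⟨ Σ<-ext (suc n) (autWeight-shape forest) ⟩
  Σ< (suc n) (λ m → aut G₀ m * inv (N G₀ G₀))                   ≡⟨ Σ<-*ʳ (suc n) (inv (N G₀ G₀)) (aut G₀) ⟩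
  Σ< (suc n) (aut G₀) * inv (N G₀ G₀)                           ≡⟨ cong (_* inv (N G₀ G₀)) (aut-total G₀ (shape-size forest)) ⟩
  c (N G₀ G₀) * inv (N G₀ G₀)                                    ≡⟨ c-inv (N≢0 G₀) ⟩
  1ℚ                                                         ∎
  where
  open ≡-Reasoning
  G₀ = shape p

-- As t_T(1) = 1 for each tree, evaluation at u = 1 counts representatives.
c-trees : ∀ {n L} → RepSystem (IsTree {n}) L → c (length L) ≡ ev (shiftZU Φ) n
c-trees {n} {L} rep = begin
  c (length L)                                     ≡⟨ c-length L ⟩
  ∑ L (λ _ → 1ℚ)                                   ≡⟨ ∑-All (All.map (λ tree → sym (autWeight-total (proj₁ tree))) (proj₁ rep)) ⟩
  ∑ L (λ p → Σ< (suc n) (autWeight p))             ≡⟨ ∑-Σ<-swap L (suc n) autWeight ⟩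
  Σ< (suc n) (λ m → ∑ L λ p → autWeight p m)       ≡⟨ Σ<-ext (suc n) (∑-trees n rep) ⟩
  ev (shiftZU Φ) n                                 ∎
  where open ≡-Reasoning

-- Fixed-point-free automorphisms

module _ {n : ℕ} {p : Parent n} {σ : Fin n → Fin n} (I : Iso p p σ) where

  iter-comm : ∀ k x → iter p k (Maybe.map σ x) ≡ Maybe.map σ (iter p k x)
  iter-comm zero    x        = refl
  iter-comm (suc k) nothing  = iter-comm k nothing
  iter-comm (suc k) (just v) = trans (cong (iter p k) (comm I v)) (iter-comm k (p v))

  -- A root r is moved to a different root, and σ itself restricts to an isomorphism between the two
  -- trees.
  fixedPointFree⇒IsMset2 : IsForest p → (∀ v → σ v ≢ v) → IsMset2 p
  fixedPointFree⇒IsMset2 forest free = forest , λ r root-r → σ r ,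
    trans (comm I r) (cong (Maybe.map σ) root-r) , free r , σ , refl ,
    (λ v (k , e) → k , desc r k v e) , (λ u v _ _ → inj I) ,
    (λ u (k , e) → inverse I u , (k , MaybeP.map-injective (inj I) (trans (sym (iter-comm k (just (inverse I u))))
       (trans (cong (λ x → iter p k (just x)) (inverseʳ I u)) e))) , inverseʳ I u) ,
    λ u v _ _ → proj₁ (proj₂ (Iso⇒IsIso I)) u v
    where
    desc : ∀ r k v → iter p k (just v) ≡ just r → iter p k (just (σ v)) ≡ just (σ r)
    desc r k v e = trans (iter-comm k (just v)) (cong (Maybe.map σ) e)

-- A forest that is not in the class has a tree different from all others, whose root is then
-- fixed by every automorphism.
aut-0 : ∀ {n} {p : Parent n} {g : V G → Fin n} → Iso par p g → IsForest p → ¬ IsMset2 p → aut G 0 ≡ 0ℚ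
aut-0 {G} {g = g} J forest ¬mset = trans
  (∑-All (All.map (λ {σ} I → ind-no (fix σ ℕ.≟ 0) (free σ I)) (sound (isos-enum G G)))) (∑-zero (isos G G) λ _ → refl)
  where
  free : ∀ σ → Isoⱽ G G σ → fix σ ≢ 0
  free σ I e = ¬mset (fixedPointFree⇒IsMset2 (Iso-∘ J (Iso-∘ I (Iso-inverse J))) forest λ v e′ →
    nonempty (∈P.∈-filter⁺ (λ v → σ v ≟ⱽ v) (verts-complete (inverse J v)) (inj J (trans e′ (sym (inverseʳ J v))))) e)
    where
    nonempty : ∀ {x xs} → x ∈ xs → length {A = V G} xs ≢ 0
    nonempty (here _)  ()
    nonempty (there _) ()

-- χ can be constantly 1, because outside the class it is multiplied by `aut G 0`, which is zero
-- there by `aut-0`.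
∑-mset2 : ∀ {n L} → RepSystem (IsMset2 {n}) L → ∑ L fpfWeight ≡ Φ n 0
∑-mset2 {n} {L} rep = trans
  (∑-rep (λ _ → 1ℚ) 0 proj₁ rep (λ _ _ → refl) λ {G} J forest ¬mset → trans (ℚP.*-identityˡ (aut G 0 * inv (w G)))
    (trans (cong (_* inv (w G)) (aut-0 J forest ¬mset)) (ℚP.*-zeroˡ (inv (w G)))))
  (∑-cong (allF n) λ G → cong (ind (size G ℕ.≟ n) *_) (ℚP.*-identityˡ (aut G 0 * inv (w G))))

-- Burnside's lemma

∑-indicator : {xs : List S} {y : S} (_≟_ : (x y : S) → Dec (x ≡ y)) → y ∈ xs → AllPairs _≢_ xs → ∑ xs (λ x → ind (x ≟ y)) ≡ 1ℚ
∑-indicator {xs = x ∷ xs} _≟_ (here refl) (x≢ ∷ _) = trans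
  (cong₂ _+_ (ind-yes (x ≟ x) refl) (trans (∑-All (All.map (λ {z} ≢ → ind-no (z ≟ x) (≢ ∘ sym)) x≢)) (∑-zero xs λ _ → refl)))
  (ℚP.+-identityʳ 1ℚ)
∑-indicator {xs = x ∷ xs} {y} _≟_ (there y∈) (x≢ ∷ xs≢) = trans
  (cong₂ _+_ (ind-no (x ≟ y) (All.lookup x≢ y∈)) (∑-indicator _≟_ y∈ xs≢)) (ℚP.+-identityˡ 1ℚ)

burnside : ∀ {n} {p : Parent n} → IsForest p → {L : List (Fin n)} → PointRep p L → derivWeight p ≡ c (length L)
burnside {n} {p} forest {L} rep = begin
  derivWeight p
    ≡⟨ frac-c (foldr ℕ._+_ 0 (map fixCount (autList p))) (length (autList p)) ⟩
  c (foldr ℕ._+_ 0 (map fixCount (autList p))) * inv (length (autList p))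
    ≡⟨ cong (_* inv (length (autList p))) fixed-total ⟩
  c (length (autList p)) * c (length L) * inv (length (autList p))
    ≡⟨ solve 3 (λ x y z → x :* y :* z := z :* (x :* y)) refl (c (length (autList p))) (c (length L)) (inv (length (autList p))) ⟩
  inv (length (autList p)) * (c (length (autList p)) * c (length L))
    ≡⟨ inv-c-cancel (c (length L)) (Enum-nonempty E (id , Iso-id)) ⟩
  c (length L) ∎
  where
  open ≡-Reasoning
  open +-*-Solver
  E = autList-enum forest
  moves : Fin n → Fin n → ℚ
  moves v u = ∑ (autList p) λ σ → ind (σ v FinP.≟ u)

  -- Composing with τ, which takes v to its representative, matches the automorphisms fixing v with
  -- those taking v to that representative; none takes v to another entry of `L`.
  orbit : ∀ v → moves v v ≡ ∑ L (moves v)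
  orbit v with rep v
  ... | i , (τ , isτ , τv) , uniq = sym (trans
    (∑-single L (moves v) i λ j j≢i → trans (∑-All (All.map (λ {σ} I → ind-no (σ v FinP.≟ lookup L j)
        λ e → j≢i (uniq j (σ , Iso⇒IsIso I , e))) (sound E))) (∑-zero (autList p) λ _ → refl))
    (sym (∑-transport Iso-id Iτ E E λ σ σ′ _ e → ind-iff (σ v FinP.≟ v) (σ′ v FinP.≟ lookup L i)
        (λ e′ → trans (e v) (trans (cong τ e′) τv))
        (λ e′ → inj Iτ (trans (sym (e v)) (trans e′ (sym τv)))))))
    where
    Iτ : Iso p p τ
    Iτ = IsIso⇒Iso forest isτ

  fixed-total : c (foldr ℕ._+_ 0 (map fixCount (autList p))) ≡ c (length (autList p)) * c (length L)
  fixed-total = begin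
    c (foldr ℕ._+_ 0 (map fixCount (autList p)))
      ≡⟨ c-sum fixCount (autList p) ⟩
    ∑ (autList p) (c ∘ fixCount)
      ≡⟨ ∑-cong (autList p) c-fixCount ⟩
    ∑ (autList p) (λ σ → ∑ (allFin n) λ v → ind (σ v FinP.≟ v))
      ≡⟨ ∑-swap (autList p) (allFin n) _ ⟩
    ∑ (allFin n) (λ v → moves v v)
      ≡⟨ ∑-cong (allFin n) orbit ⟩
    ∑ (allFin n) (λ v → ∑ L λ u → ∑ (autList p) λ σ → ind (σ v FinP.≟ u))
      ≡⟨ trans (∑-cong (allFin n) λ v → ∑-swap L (autList p) _) (∑-swap (allFin n) (autList p) _) ⟩
    ∑ (autList p) (λ σ → ∑ (allFin n) λ v → ∑ L λ u → ind (σ v FinP.≟ u))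
      -- For each σ and each u in `L` there is exactly one v with σ v = u.
      ≡⟨ ∑-All (All.map (λ {σ} I → trans (∑-swap (allFin n) L _) (∑-cong L λ u →
           trans (∑-bijection I allFin-complete (allFin-distinct n) allFin-complete (allFin-distinct n) λ x → ind (x FinP.≟ u))
                 (∑-indicator FinP._≟_ (allFin-complete u) (allFin-distinct n)))) (sound E)) ⟩
    ∑ (autList p) (λ _ → ∑ L λ _ → 1ℚ)
      ≡⟨ ∑-cong (autList p) (λ _ → sym (trans (ℚP.*-identityˡ _) (c-length L))) ⟩
    ∑ (autList p) (λ _ → 1ℚ * c (length L))
      ≡⟨ trans (∑-*ʳ (autList p) (c (length L)) (λ _ → 1ℚ)) (cong (_* c (length L)) (sym (c-length (autList p)))) ⟩
    c (length (autList p)) * c (length L) ∎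

open import Data.Integer using (+_)

theorem2 : (R : (k : ℕ) → List (Parent k)) → ((k : ℕ) → RepSystem IsTree (R k)) →
    ((n : ℕ) (L : List (Parent n)) → RepSystem IsMset2 L →
    Dser (countSeq R) n ≡ sumQ (map fpfWeight L))
    × ((tc : BS) → SolvesTc (countSeq R) tc → (n m : ℕ) → 1 ≤ n →
    tc n m ≡ sumQ (map (λ T → autWeight T m) (R n)))
    × ((n : ℕ) (T : Parent n) → IsTree T → (P : List (Fin n)) → PointRep T P →
    derivWeight T ≡ (+ length P) / 1)
theorem2 R reps =
  (λ n L rep → trans (sym (Φ-0 n)) (trans (sym (∑-mset2 rep)) (sym (sumQ-map fpfWeight L)))) ,
  (λ tc sol n m _ → trans (solution-unique tc sol n m) (trans (sym (∑-trees n (reps n) m))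
     (sym (sumQ-map (λ T → autWeight T m) (R n))))) ,
  λ n T (forest , _) P rep → trans (burnside {n} {T} forest {P} rep) (sym (c-def (length P)))
  where
  -- `Φ` is defined without reference to `R`; the given representatives enter only through this
  -- identification of the numbers of trees with z u Φ at u = 1.
  t-ev : ∀ n → countSeq R n ≡ ev (shiftZU Φ) n
  t-ev n = trans (c-def (length (R n))) (c-trees (reps n))
  t-0 : countSeq R 0 ≡ 0ℚ
  t-0 = trans (t-ev 0) (ℚP.+-identityˡ 0ℚ)
  t-suc : ∀ n → countSeq R (suc n) ≡ forestCount n
  t-suc n = trans (t-ev (suc n)) (trans (ev-shiftZU Φ n) (Φ-ev n))
  open FunctionalEquation (countSeq R) forestCount Φ t-0 t-suc Φ-deg Φ-ev Φ-∂ forestCount-0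
    (forestCount-δ (countSeq R) t-0 t-suc)
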